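{- Fix a tuple $\mu=(\mu_1,\ldots,\mu_n)$ of positive integers with sum $d=\mu_1+\cdots+\mu_n\geq 2$. Then there exist integers $C(\mu,m)\in\mathbb{Z}$, for $1\le m\le\binom{d}{2}$, such that for all non-negative integers $g$, \[ H_{g;\mu} = \frac{2}{d!\,\mu_1\cdots\mu_n}\sum_{1\le m\le \binom{d}{2}} C(\mu,m)\, m^{d+2g-2+n}. \]
   Context: For an integer $g$ and a tuple $\mu=(\mu_1,\ldots,\mu_n)$ of positive integers, the Hurwitz number $H_{g;\mu}$ is the weighted count of genus $g$ connected branched covers $f:\Sigma\to\mathbb{CP}^1$ with ramification profile $\mu$ over $\infty$, simple ramification over $|\mu|+2g-2+n$ fixed prescribed points of $\mathbb{CP}^1$, and no other branching; the preimages of $\infty$ are labelled $1,\ldots,n$ so that the point labelled $i$ has ramification index $\mu_i$. Isomorphisms are Riemann surface isomorphisms $\phi$ with $f=\tilde f\circ\phi$ preserving these labels, and each cover is counted with weight $1/|\mathrm{Aut}|$. Equivalently, $H_{g;\mu}$ equals $\frac{|\mathrm{Aut}(\mu)|}{|\mu|!}$ times the number of tuples $(\tau_1,\ldots,\tau_{|\mu|+2g-2+n})$ of transpositions in $S_{|\mu|}$ generating a transitive subgroup whose product has cycle type $\mu$, where $\mathrm{Aut}(\mu)$ is the group of permutations of the entries of the tuple $\mu$ fixing it. -}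

module Defs where

open import Data.Bool using (Bool; true; false; _∧_; _∨_; not; if_then_else_)
open import Data.Nat using (ℕ; zero; suc; _+_; _*_; _∸_; _^_; _≤_; _<_)
open import Data.Nat.Properties using (≤-decTotalOrder)
import Data.Nat as ℕ
open import Data.Nat using (_!)
open import Data.Fin using (Fin; toℕ)
import Data.Fin as F
open import Data.Integer using (ℤ; +_)
import Data.Integer as ℤ
open import Data.Rational using (ℚ; _/_)
import Data.Rational as ℚ
open import Data.List using (List; []; _∷_; length; map; concatMap; filterᵇ;
  allFin; upTo; foldr)
open import Data.Nat.ListAction using (sum; product)
open import Data.Bool.ListAction using (and; all; any)
open import Data.List.Properties using (≡-dec)
open import Data.List.Sort.InsertionSort.Base ≤-decTotalOrder using (sort)
open import Relation.Nullary.Decidable using (⌊_⌋)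
open import Function using (id; _∘_)

tuples : {A : Set} → ℕ → List A → List (List A)
tuples zero    xs = [] ∷ []
tuples (suc r) xs = concatMap (λ x → map (x ∷_) (tuples r xs)) xs

countᵇ : {A : Set} → (A → Bool) → List A → ℕ
countᵇ p xs = length (filterᵇ p xs)

iter : {A : Set} → ℕ → (A → A) → A → A
iter zero    f x = x
iter (suc k) f x = f (iter k f x)

-- division of an integer by a natural number, as a rational;
-- (only ever used with positive denominators; the value at 0 is a dummy)
_÷ℕ_ : ℤ → ℕ → ℚ
z ÷ℕ zero  = ℚ.0ℚ
z ÷ℕ suc k = z / suc k

sumFrom1 : ℕ → (ℕ → ℤ) → ℤ
sumFrom1 N f = foldr ℤ._+_ (+ 0) (map (λ k → f (suc k)) (upTo N))

-- Transpositions in S_d: the transposition (i j) with i < j is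
-- represented by the pair (i , j).

record Transp (d : ℕ) : Set where
  constructor ⟨_,_⟩
  field
    fst : Fin d
    snd : Fin d

allTransp : (d : ℕ) → List (Transp d)
allTransp d = filterᵇ (λ t → toℕ (Transp.fst t) ℕ.<ᵇ toℕ (Transp.snd t))
                      (concatMap (λ i → map (λ j → ⟨ i , j ⟩) (allFin d)) (allFin d))

_==_ : {d : ℕ} → Fin d → Fin d → Bool
i == j = toℕ i ℕ.≡ᵇ toℕ j

applyT : {d : ℕ} → Transp d → Fin d → Fin d
applyT ⟨ i , j ⟩ x = if x == i then j else (if x == j then i else x)

prodT : {d : ℕ} → List (Transp d) → Fin d → Fin d
prodT []       = id
prodT (t ∷ ts) = applyT t ∘ prodT ts

-- length of the cycle of σ through x: least k ∈ {1,…,d} with σ^k x = x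
-- (search below d; for a permutation such k always exists)
orbitLen : {d : ℕ} → (Fin d → Fin d) → Fin d → ℕ
orbitLen {d} σ x = go d 1
  where
  go : ℕ → ℕ → ℕ
  go zero    k = k
  go (suc f) k = if iter k σ x == x then k else go f (suc k)

isCycleRep : {d : ℕ} → (Fin d → Fin d) → Fin d → Bool
isCycleRep σ x = all (λ k → toℕ x ℕ.≤ᵇ toℕ (iter k σ x)) (upTo (orbitLen σ x))

cycleType : {d : ℕ} → (Fin d → Fin d) → List ℕ
cycleType {d} σ = map (orbitLen σ) (filterᵇ (isCycleRep σ) (allFin d))

hasCycleType : {d : ℕ} → (Fin d → Fin d) → List ℕ → Bool
hasCycleType σ μ = ⌊ ≡-dec ℕ._≟_ (sort (cycleType σ)) (sort μ) ⌋

-- Transitivity of the subgroup generated by a list of transpositions.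
-- The orbit of x under the generated group is the closure of {x} under
-- the generators (transpositions are involutions); d closure steps suffice.

orbitStep : {d : ℕ} → List (Transp d) → (Fin d → Bool) → (Fin d → Bool)
orbitStep ts S y = S y ∨ any (λ t → S (applyT t y)) ts

inOrbit : {d : ℕ} → List (Transp d) → Fin d → Fin d → Bool
inOrbit {d} ts x = iter d (orbitStep ts) (λ y → y == x)

isTransitive : {d : ℕ} → List (Transp d) → Bool
isTransitive {d} ts = and (map (λ x → all (inOrbit ts x) (allFin d)) (allFin d))

lookupℕ : List ℕ → ℕ → ℕ
lookupℕ []       _       = 0
lookupℕ (x ∷ xs) zero    = x
lookupℕ (x ∷ xs) (suc k) = lookupℕ xs k

isPermVec : {n : ℕ} → List (Fin n) → Bool
isPermVec {n} s = all (λ i → countᵇ (λ j → j == i) s ℕ.≡ᵇ 1) (allFin n)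

autSize : List ℕ → ℕ
autSize μ = countᵇ (λ s → isPermVec s ∧ fixes s) (tuples n (allFin n))
  where
  n = length μ
  fixes : List (Fin n) → Bool
  fixes s = go 0 s
    where
    go : ℕ → List (Fin n) → Bool
    go k []       = true
    go k (j ∷ js) = (lookupℕ μ (toℕ j) ℕ.≡ᵇ lookupℕ μ k) ∧ go (suc k) js

numBranch : ℕ → List ℕ → ℕ
numBranch g μ = sum μ + 2 * g + length μ ∸ 2

hurwitzCount : ℕ → List ℕ → ℕ
hurwitzCount g μ =
  countᵇ (λ ts → isTransitive ts ∧ hasCycleType (prodT ts) μ)
         (tuples (numBranch g μ) (allTransp (sum μ)))

H : ℕ → List ℕ → ℚ
H g μ = (+ (autSize μ * hurwitzCount g μ)) ÷ℕ (sum μ !)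

{-# OPTIONS --safe #-}
-- Write A_P for the sum of the transpositions that lie inside the blocks of a set partition P
-- of {1,…,d}, acting on functions of a map f : [d] → [d] by left composition. Let σ have cycle
-- type μ, and let S be right composition with σ⁻¹, cut down to bijective f. The trace of A_Pʳ S
-- counts pairs (transposition tuple inside P with product τ, bijection f with τ f = f σ), and the
-- number of such f is |Aut μ| μ₁⋯μₙ or 0 according to whether τ has cycle type μ.
-- A tuple is transitive iff it preserves no proper nonempty subset U; expanding the product
-- ∏_U (1 − [U preserved]) turns the transitive count into an integer combination of these traces.
--
-- A_P is a sum of commuting Jucys–Murphy elements, and y = s x s + s shows that the roots of an
-- annihilating polynomial grow by at most one from each element to the next; so A_P is annihilated
-- by a product of factors A_P − m with m ∈ ℤ and |m| ≤ d(d−1)/2. Since S commutes with A_P, splitting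
-- off the lattices ker (A_P − m) one after another gives Tr(A_Pʳ S) = Σ c_m mʳ with integer c_m.
-- Finally, parity makes the count vanish for every second r, which forces c_{−m} = ± c_m: this
-- pairs up m and −m and produces the factor 2.
module Submission where

open import Defs
import Data.Nat as ℕ
import Data.Nat.Properties as ℕP
import Data.Integer as ℤ
import Data.Integer.Properties as ℤP
import Data.List.Relation.Unary.All as All
import Data.List.Relation.Unary.All.Properties as All
import Data.Bool as 𝔹
import Data.Fin as F
import Data.Fin.Properties as FP
import Data.List.Properties as ListP
import Data.List.Relation.Unary.AllPairs.Properties as AllPairs
import Data.List.Relation.Unary.Unique.Propositional.Properties as Unique
import Data.List.Relation.Binary.Permutation.Propositional.Properties as Perm
import Data.List.Relation.Binary.Permutation.Setoid.Properties as SPerm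
import Data.Nat.Tactic.RingSolver as ℕ-Ring
import Data.Rational.Properties as ℚP
import Data.Rational.Unnormalised as ℚᵘ
open import Data.Nat using (ℕ; zero; suc; _<_; _≤_; s≤s; z≤n; _!)
open import Data.Integer using (ℤ; 0ℤ; 1ℤ; -1ℤ; _+_; _*_; -_; _-_; ∣_∣) renaming (_^_ to _^ℤ_)
open import Data.Integer.Tactic.RingSolver using (solve-∀)
open import Data.Fin using (Fin; zero; suc; toℕ; _≟_; finToFun; funToFin; combine)
open import Data.List using (List; []; _∷_; _++_; map; concatMap; allFin; tabulate; filterᵇ; length; upTo; cartesianProductWith)
open import Data.List.Properties using (map-tabulate)
open import Data.List.Relation.Unary.All using (All; []; _∷_)
open import Data.Product using (Σ; ∃; _×_; _,_; proj₁; proj₂)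
open import Function using (id; _∘_; mk⇔)
open import Relation.Binary.PropositionalEquality
open import Data.Nat.GCD using (module Bézout)
open import Data.List.Relation.Unary.Any using (here; there)
open import Data.List.Membership.Propositional using (_∈_)
open import Data.List.Membership.Propositional.Properties using (∈-allFin; ∈-map⁺; ∈-map⁻; ∈-filter⁺; ∈-filter⁻; ∈-upTo⁺; ∈-upTo⁻; ∈-cartesianProductWith⁺; ∈-cartesianProductWith⁻)
open import Data.Sum using (_⊎_; inj₁; inj₂)
open import Data.Unit using (⊤; tt)
open import Data.Empty using (⊥-elim; ⊥)
open import Relation.Nullary using (¬_; yes; no; Dec; does)
open import Data.Bool using (Bool; true; false; _∧_; _∨_; not; if_then_else_; T; _xor_)
open import Data.Nat.Combinatorics using (_C_; nCk+nC[k+1]≡[n+1]C[k+1]; nC1≡n)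
open import Data.List.Relation.Unary.AllPairs using (AllPairs; []; _∷_)
open import Data.List.Relation.Unary.Unique.Propositional using (Unique)
open import Data.List.Relation.Binary.Permutation.Propositional using (_↭_; ↭-refl; ↭-trans; ↭-sym; ↭⇒↭ₛ)
open import Data.List.Relation.Binary.BagAndSetEquality using (∼bag⇒↭)
open import Data.List.Membership.Propositional.Properties.WithK using (unique∧set⇒bag)
open import Relation.Nullary.Decidable using (dec-true; dec-false; _→-dec_; _×-dec_)
open import Function.Definitions using (Injective)
open import Data.Bool.ListAction using (all; any)
open import Data.Bool.Properties using (∧-comm)
open import Data.Nat.DivMod using (_%_; _/_; m≡m%n+[m/n]*n; m%n<n)
open import Data.Nat.Induction using (<-rec)
open import Data.List.Sort.InsertionSort.Base ℕP.≤-decTotalOrder using (sort)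
open import Data.List.Sort.InsertionSort.Properties ℕP.≤-decTotalOrder using (sort-↭; sort-↗)
open import Data.List.Relation.Unary.Sorted.TotalOrder.Properties using (↗↭↗⇒≋)
open import Data.List.Relation.Binary.Pointwise using (Pointwise-≡⇒≡)
open import Data.Nat.ListAction using (sum; product)
open import Data.Nat.ListAction.Properties using (product≢0)

-- Finite sums, integer linear maps and Jucys–Murphy elements

-- The requirement that shapes the argument is integrality. Projections onto the eigenspaces of A_P
-- have denominators, and the eigenlattices together may span only a sublattice of finite index, so
-- no eigenbasis is used. The kernel of an integer matrix is however a direct summand: one kernel is
-- split off, and the rest is treated as a quotient lattice on which the annihilating product has
-- one factor fewer. The input is therefore any annihilating product with integer roots. The bound
-- d(d-1)/2 is the sum of the bounds 0, 1, ..., d-1 obtained for the single Jucys-Murphy elements.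
-- The denominator d! μ₁⋯μₙ of the theorem is explained by the trace: it counts each transitive
-- tuple of the right type |Aut μ| μ₁⋯μₙ times, and d! μ₁⋯μₙ times the Hurwitz number is the same
-- quantity.

∑ : {A : Set} → List A → (A → ℤ) → ℤ
∑ []       f = 0ℤ
∑ (x ∷ xs) f = f x + ∑ xs f

∑-cong : {A : Set} (xs : List A) {f g : A → ℤ} → f ≗ g → ∑ xs f ≡ ∑ xs g
∑-cong []       h = refl
∑-cong (x ∷ xs) h = cong₂ _+_ (h x) (∑-cong xs h)

+-interchange : ∀ a b c d → (a + b) + (c + d) ≡ (a + c) + (b + d)
+-interchange = solve-∀

∑-+ : {A : Set} (xs : List A) (f g : A → ℤ) → ∑ xs (λ x → f x + g x) ≡ ∑ xs f + ∑ xs g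
∑-+ []       f g = refl
∑-+ (x ∷ xs) f g rewrite ∑-+ xs f g = +-interchange (f x) (g x) (∑ xs f) (∑ xs g)

∑-*ˡ : {A : Set} (xs : List A) (c : ℤ) (f : A → ℤ) → ∑ xs (λ x → c * f x) ≡ c * ∑ xs f
∑-*ˡ []       c f = sym (ℤP.*-zeroʳ c)
∑-*ˡ (x ∷ xs) c f rewrite ∑-*ˡ xs c f = sym (ℤP.*-distribˡ-+ c (f x) (∑ xs f))

∑-*ʳ : {A : Set} (xs : List A) (c : ℤ) (f : A → ℤ) → ∑ xs (λ x → f x * c) ≡ ∑ xs f * c
∑-*ʳ xs c f = trans (∑-cong xs (λ x → ℤP.*-comm (f x) c))
                    (trans (∑-*ˡ xs c f) (ℤP.*-comm c (∑ xs f)))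

∑-0 : {A : Set} (xs : List A) → ∑ xs (λ _ → 0ℤ) ≡ 0ℤ
∑-0 []       = refl
∑-0 (x ∷ xs) = trans (ℤP.+-identityˡ _) (∑-0 xs)

∑-neg : {A : Set} (xs : List A) (f : A → ℤ) → ∑ xs (λ x → - f x) ≡ - ∑ xs f
∑-neg []       f = refl
∑-neg (x ∷ xs) f rewrite ∑-neg xs f = sym (ℤP.neg-distrib-+ (f x) (∑ xs f))

∑-++ : {A : Set} (xs ys : List A) (f : A → ℤ) → ∑ (xs ++ ys) f ≡ ∑ xs f + ∑ ys f
∑-++ []       ys f = sym (ℤP.+-identityˡ _)
∑-++ (x ∷ xs) ys f rewrite ∑-++ xs ys f = sym (ℤP.+-assoc (f x) (∑ xs f) (∑ ys f))

∑-map : {A B : Set} (g : A → B) (xs : List A) (f : B → ℤ) → ∑ (map g xs) f ≡ ∑ xs (f ∘ g)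
∑-map g []       f = refl
∑-map g (x ∷ xs) f = cong (_+_ (f (g x))) (∑-map g xs f)

∑-concatMap : {A B : Set} (g : A → List B) (xs : List A) (f : B → ℤ) →
  ∑ (concatMap g xs) f ≡ ∑ xs (λ x → ∑ (g x) f)
∑-concatMap g []       f = refl
∑-concatMap g (x ∷ xs) f =
  trans (∑-++ (g x) _ f) (cong (λ z → ∑ (g x) f + z) (∑-concatMap g xs f))

∑-swap : {A B : Set} (xs : List A) (ys : List B) (f : A → B → ℤ) →
  ∑ xs (λ x → ∑ ys (f x)) ≡ ∑ ys (λ y → ∑ xs (λ x → f x y))
∑-swap []       ys f = sym (∑-0 ys)
∑-swap (x ∷ xs) ys f rewrite ∑-swap xs ys f = sym (∑-+ ys (f x) (λ y → ∑ xs (λ x → f x y)))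

∑-allFin : ∀ n (f : Fin (suc n) → ℤ) → ∑ (allFin (suc n)) f ≡ f zero + ∑ (allFin n) (f ∘ suc)
∑-allFin n f = cong (_+_ (f zero))
  (trans (cong (λ l → ∑ l f) (sym (map-tabulate id suc))) (∑-map suc (allFin n) f))

-- Integer-valued functions and the linear maps between them

V : Set → Set
V X = X → ℤ

infixl 6 _⊕_
infixl 7 _•_

_⊕_ : {X : Set} → V X → V X → V X
(u ⊕ v) i = u i + v i

_•_ : {X : Set} → ℤ → V X → V X
(c • u) i = c * u i

𝟎 : {X : Set} → V X
𝟎 _ = 0ℤ

record Lin (X Y : Set) : Set where
  field
    _$_  : V X → V Y
    $-cong : ∀ {u v} → u ≗ v → _$_ u ≗ _$_ v
    $-⊕ : ∀ u v → _$_ (u ⊕ v) ≗ (_$_ u ⊕ _$_ v)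
    $-• : ∀ c u → _$_ (c • u) ≗ c • _$_ u
  infixr 5 _$_
open Lin

module _ {X Y : Set} (A : Lin X Y) where
  $-𝟎 : A $ 𝟎 ≗ 𝟎
  $-𝟎 i = trans ($-cong A (λ _ → sym (ℤP.*-zeroˡ 0ℤ)) i) (trans ($-• A 0ℤ 𝟎 i) (ℤP.*-zeroˡ ((A $ 𝟎) i)))

  $-vanish : ∀ {v} → v ≗ 𝟎 → A $ v ≗ 𝟎
  $-vanish h i = trans ($-cong A h i) ($-𝟎 i)

  $-∑ : {Z : Set} (zs : List Z) (F : Z → V X) →
    A $ (λ i → ∑ zs (λ z → F z i)) ≗ (λ i → ∑ zs (λ z → (A $ F z) i))
  $-∑ []       F i = $-𝟎 i
  $-∑ (z ∷ zs) F i = trans ($-⊕ A (F z) (λ i → ∑ zs (λ z → F z i)) i)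
                           (cong (_+_ ((A $ F z) i)) ($-∑ zs F i))

idL : {X : Set} → Lin X X
idL = record { _$_ = id ; $-cong = id ; $-⊕ = λ _ _ _ → refl ; $-• = λ _ _ _ → refl }

infixr 9 _∘L_
_∘L_ : {X Y Z : Set} → Lin Y Z → Lin X Y → Lin X Z
A ∘L B = record
  { _$_ = λ v → A $ B $ v
  ; $-cong = λ h → $-cong A ($-cong B h)
  ; $-⊕ = λ u v i → trans ($-cong A ($-⊕ B u v) i) ($-⊕ A (B $ u) (B $ v) i)
  ; $-• = λ c u i → trans ($-cong A ($-• B c u) i) ($-• A c (B $ u) i)
  }

infixl 6 _+L_
_+L_ : {X Y : Set} → Lin X Y → Lin X Y → Lin X Y
A +L B = record
  { _$_ = λ v → (A $ v) ⊕ (B $ v)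
  ; $-cong = λ h i → cong₂ _+_ ($-cong A h i) ($-cong B h i)
  ; $-⊕ = λ u v i → trans (cong₂ _+_ ($-⊕ A u v i) ($-⊕ B u v i))
      (+-interchange ((A $ u) i) ((A $ v) i) ((B $ u) i) ((B $ v) i))
  ; $-• = λ c u i → trans (cong₂ _+_ ($-• A c u i) ($-• B c u i))
      (sym (ℤP.*-distribˡ-+ c ((A $ u) i) ((B $ u) i)))
  }

scalar : {X : Set} → ℤ → Lin X X
scalar a = record
  { _$_ = a •_
  ; $-cong = λ h i → cong (a *_) (h i)
  ; $-⊕ = λ u v i → ℤP.*-distribˡ-+ a (u i) (v i)
  ; $-• = λ c u i → lemma a c (u i)
  }
  where lemma : ∀ a c u → a * (c * u) ≡ c * (a * u)
        lemma = solve-∀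

_−_ : {X : Set} → Lin X X → ℤ → Lin X X
A − a = A +L scalar (- a)

kill : {X : Set} → List ℤ → Lin X X → Lin X X
kill []       A = idL
kill (a ∷ as) A = (A − a) ∘L kill as A

Commute : {X : Set} → Lin X X → Lin X X → Set
Commute A B = ∀ v → A $ B $ v ≗ B $ A $ v

module _ {X : Set} where

  commute-sym : {A B : Lin X X} → Commute A B → Commute B A
  commute-sym h v i = sym (h v i)

  commute-+ : {A B E : Lin X X} → Commute A E → Commute B E → Commute (A +L B) E
  commute-+ {A} {B} {E} h k v i =
    trans (cong₂ _+_ (h v i) (k v i)) (sym ($-⊕ E (A $ v) (B $ v) i))

  commute-scalar : ∀ a (E : Lin X X) → Commute (scalar a) E
  commute-scalar a E v i = sym ($-• E a v i)

  commute-− : ∀ {A E} a → Commute A E → Commute (A − a) E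
  commute-− {A} {E} a h = commute-+ {A} {scalar (- a)} {E} h (commute-scalar (- a) E)

  commute-∘ : {A B E : Lin X X} → Commute A E → Commute B E → Commute (A ∘L B) E
  commute-∘ {A} {B} {E} h k v i = trans ($-cong A (k v) i) (h (B $ v) i)

  commute-kill : ∀ {A E} as → Commute A E → Commute (kill as A) E
  commute-kill []       h v i = refl
  commute-kill {A} {E} (a ∷ as) h =
    commute-∘ {A − a} {kill as A} {E} (commute-− {A} {E} a h) (commute-kill {A} {E} as h)

  commute-self : (A : Lin X X) → Commute A A
  commute-self A v i = refl

  kill-++ : ∀ as bs (A : Lin X X) v → kill (as ++ bs) A $ v ≗ kill as A $ kill bs A $ v
  kill-++ []       bs A v i = refl
  kill-++ (a ∷ as) bs A v i = $-cong (A − a) (kill-++ as bs A v) i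

Splits : {X : Set} → ℕ → Lin X X → Set
Splits b A = Σ (List ℤ) λ as → All (λ a → ∣ a ∣ ≤ b) as × (∀ v → kill as A $ v ≗ 𝟎)

module SumSplits {X : Set} (A B : Lin X X) (AB : Commute A B) where
  private
    Z = A +L B

    AZ : Commute A Z
    AZ = commute-sym {A = Z} {A} (commute-+ {A = A} {B} {A} (commute-self A) (commute-sym {A = A} {B} AB))

  -- On ker (A - a) the factor Z - (a + b) acts as B - b. Polynomials in B commute with A and
  -- preserve this kernel, so the replacement can be made factor by factor.
  kill-shift : ∀ a bs v → (A − a) $ v ≗ 𝟎 → kill (map (a +_) bs) Z $ v ≗ kill bs B $ v
  kill-shift a []       v h i = refl
  kill-shift a (b ∷ bs) v h i = trans ($-cong (Z − (a + b)) (kill-shift a bs v h) i)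
    (trans (lemma ((A $ u) i) ((B $ u) i) a b (u i)) (trans (cong (_+ (B − b $ u) i) killed) (ℤP.+-identityˡ _)))
    where
    u = kill bs B $ v
    killed : (A − a $ u) i ≡ 0ℤ
    killed = trans (sym (commute-kill {A = B} {A − a} bs
               (commute-sym {A = A − a} {B} (commute-− {A = A} {B} a AB)) v i)) ($-vanish (kill bs B) h i)
    lemma : ∀ x y a b u → (x + y) + (- (a + b)) * u ≡ (x + (- a) * u) + (y + (- b) * u)
    lemma = solve-∀

  -- If the full product kills v, then the factors `as` kill (A - a) v, and by induction so do the
  -- sums built from them. Moving A - a to the outside puts the image of v under those sums into ker
  -- (A - a); there Z acts as a + B, and the factors a + b finish.
  kill-sumset : ∀ as bs → (∀ v → kill bs B $ v ≗ 𝟎) → ∀ v → kill as A $ v ≗ 𝟎 →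
    kill (concatMap (λ a → map (a +_) bs) as) Z $ v ≗ 𝟎
  kill-sumset []       bs hB v hv i = hv i
  kill-sumset (a ∷ as) bs hB v hv i =
    trans (kill-++ (map (a +_) bs) cs Z v i)
    (trans (kill-shift a bs v′ killed i) (hB v′ i))
    where
    cs = concatMap (λ a → map (a +_) bs) as
    v′ = kill cs Z $ v
    killed : (A − a) $ v′ ≗ 𝟎
    killed i = trans (sym (commute-kill {A = Z} {A − a} cs
                 (commute-sym {A = A − a} {Z} (commute-− {A = A} {Z} a AZ)) v i))
      (kill-sumset as bs hB ((A − a) $ v)
         (λ j → trans (commute-kill {A = A} {A − a} as
              (commute-sym {A = A − a} {A} (commute-− {A = A} {A} a (commute-self A))) v j) (hv j)) i)

sumset-bounded : ∀ {b c} as bs → All (λ a → ∣ a ∣ ≤ b) as → All (λ a → ∣ a ∣ ≤ c) bs →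
  All (λ a → ∣ a ∣ ≤ b ℕ.+ c) (concatMap (λ a → map (a +_) bs) as)
sumset-bounded []       bs []         hbs = []
sumset-bounded (a ∷ as) bs (ha ∷ has) hbs =
  All.++⁺ (shifted bs hbs) (sumset-bounded as bs has hbs)
  where
  shifted : ∀ bs → All (λ a → ∣ a ∣ ≤ _) bs → All (λ a → ∣ a ∣ ≤ _) (map (a +_) bs)
  shifted []       []       = []
  shifted (b ∷ bs) (h ∷ hs) = ℕP.≤-trans (ℤP.∣i+j∣≤∣i∣+∣j∣ a b) (ℕP.+-mono-≤ ha h) ∷ shifted bs hs

splits-+ : ∀ {X b c} (A B : Lin X X) → Commute A B → Splits b A → Splits c B → Splits (b ℕ.+ c) (A +L B)
splits-+ A B AB (as , ha , kA) (bs , hb , kB) =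
  concatMap (λ a → map (a +_) bs) as , sumset-bounded as bs ha hb ,
  (λ v → SumSplits.kill-sumset A B AB as bs kB v (kA v))

-- The relation y s = s x + 1 of the degenerate affine Hecke algebra satisfied
-- by consecutive Jucys–Murphy elements x, y.
module JucysMurphyStep {X : Set} (s x y : Lin X X)
  (s² : ∀ v → s $ s $ v ≗ v)
  (ys : ∀ v → y $ s $ v ≗ (s $ x $ v) ⊕ v)
  (xy : Commute x y) where
  private
    D : Lin X X
    D = y +L (scalar -1ℤ ∘L x)

    D-comm-y : ∀ as → Commute (kill as y) D
    D-comm-y as = commute-kill {A = y} {D} as (commute-sym {A = D} {y}
      (commute-+ {A = y} {scalar -1ℤ ∘L x} {y} (commute-self y)
        (commute-∘ {A = scalar -1ℤ} {x} {y} (commute-scalar -1ℤ y) xy)))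

    -- For p the product of the factors T - a, the relation yields p(y) s = s p(x) + (p(y) -
    -- p(x))/(y - x), with a divided difference on the right. Multiplying by `D` = y - x clears its
    -- denominator.
    intertwine : ∀ as v → D $ kill as y $ s $ v ≗ (D $ s $ kill as x $ v) ⊕ (kill as y $ v) ⊕ -1ℤ • (kill as x $ v)
    intertwine []       v i = lemma ((D $ s $ v) i) (v i)
      where lemma : ∀ a b → a ≡ a + b + -1ℤ * b
            lemma = solve-∀
    intertwine (a ∷ as) v i = begin
      (D $ (y − a) $ kill as y $ s $ v) i
        ≡⟨ sym (D-comm-y-a (kill as y $ s $ v) i) ⟩
      ((y − a) $ D $ kill as y $ s $ v) i
        ≡⟨ $-cong (y − a) (intertwine as v) i ⟩
      ((y − a) $ (D $ s $ p) ⊕ q ⊕ -1ℤ • p) i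
        ≡⟨ trans ($-⊕ (y − a) ((D $ s $ p) ⊕ q) (-1ℤ • p) i)
             (cong₂ _+_ ($-⊕ (y − a) (D $ s $ p) q i) ($-• (y − a) -1ℤ p i)) ⟩
      ((y − a) $ D $ s $ p) i + ((y − a) $ q) i + -1ℤ * ((y − a) $ p) i
        ≡⟨ cong (λ z → z + ((y − a) $ q) i + -1ℤ * ((y − a) $ p) i)
             (trans (D-comm-y-a (s $ p) i) (trans ($-cong D shift i) ($-⊕ D (s $ (x − a) $ p) p i))) ⟩
      ((D $ s $ (x − a) $ p) i + (D $ p) i) + ((y − a) $ q) i + -1ℤ * ((y − a) $ p) i
        ≡⟨ lemma ((D $ s $ (x − a) $ p) i) ((y $ p) i) ((x $ p) i) (((y − a) $ q) i) a (p i) ⟩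
      (D $ s $ (x − a) $ p) i + ((y − a) $ q) i + -1ℤ * ((x − a) $ p) i ∎
      where
      open ≡-Reasoning
      p = kill as x $ v
      q = kill as y $ v
      D-comm-y-a : Commute (y − a) D
      D-comm-y-a = D-comm-y (a ∷ [])
      shift : (y − a) $ s $ p ≗ (s $ (x − a) $ p) ⊕ p
      shift j = trans (cong (_+ (- a) * (s $ p) j) (ys p j))
        (trans (lemma₁ ((s $ x $ p) j) (p j) (- a) ((s $ p) j))
          (cong (_+ p j) (sym (trans ($-⊕ s (x $ p) ((- a) • p) j) (cong (_+_ ((s $ x $ p) j)) ($-• s (- a) p j))))))
        where lemma₁ : ∀ t p a u → (t + p) + a * u ≡ (t + a * u) + p
              lemma₁ = solve-∀
      lemma : ∀ t yp xp q a p → t + (yp + -1ℤ * xp) + q + -1ℤ * (yp + (- a) * p) ≡ t + q + -1ℤ * (xp + (- a) * p)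
      lemma = solve-∀

  module _ (as : List ℤ) (kx : ∀ v → kill as x $ v ≗ 𝟎) where
    private
      absorb : ∀ v → D $ kill as y $ s $ v ≗ kill as y $ v
      absorb v i = begin
        (D $ kill as y $ s $ v) i
          ≡⟨ intertwine as v i ⟩
        (D $ s $ kill as x $ v) i + (kill as y $ v) i + -1ℤ * (kill as x $ v) i
          ≡⟨ cong₂ (λ a b → a + (kill as y $ v) i + -1ℤ * b) ($-vanish (D ∘L s) (kx v) i) (kx v i) ⟩
        0ℤ + (kill as y $ v) i + -1ℤ * 0ℤ
          ≡⟨ lemma ((kill as y $ v) i) ⟩
        (kill as y $ v) i ∎
        where
        open ≡-Reasoning
        lemma : ∀ q → 0ℤ + q + -1ℤ * 0ℤ ≡ q
        lemma = solve-∀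

      -- When p(x) = 0, what remains is D p(y) s = p(y). Using it twice, with s² = 1 inserted, gives
      -- (y - x)² = 1 on the image of p(y).
      D² : ∀ v → D $ D $ kill as y $ v ≗ kill as y $ v
      D² v i = trans ($-cong D (λ j → trans ($-cong D ($-cong (kill as y) (λ k → sym (s² v k))) j)
                                            (absorb (s $ v) j)) i)
                     (absorb v i)

    spread : List ℤ → List ℤ
    spread = concatMap (λ a → a + 1ℤ ∷ a - 1ℤ ∷ [])

    -- Where x acts as b, the relation (y - x)² = 1 on the image of p(y) becomes (y - b - 1)(y - b +
    -- 1) = 0. So each root b of x is traded for the two roots b + 1 and b - 1 of y.
    spread-kills : ∀ bs v → kill bs x $ kill as y $ v ≗ 𝟎 → kill (spread bs) y $ kill as y $ v ≗ 𝟎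
    spread-kills []       v h = h
    spread-kills (b ∷ bs) v h i = trans (cong (_+ (- (b + 1ℤ)) * ((y − (b - 1ℤ)) $ w) i)
        (trans ($-⊕ y (y $ w) ((- (b - 1ℤ)) • w) i) (cong (_+_ ((y $ y $ w) i)) ($-• y (- (b - 1ℤ)) w i))))
      (spread-step ((y $ y $ w) i) ((y $ w) i) b (w i) yy)
      where
      w = kill (spread bs) y $ kill as y $ v
      comm : ∀ {E} cs → Commute y E → Commute (kill cs y) E
      comm {E} cs = commute-kill {A = y} {E} cs
      y-x-b : Commute y (x − b)
      y-x-b = commute-sym {A = x − b} {y} (commute-− {A = x} {y} b xy)
      killed : (x − b) $ w ≗ 𝟎
      killed j = trans (sym (trans ($-cong (kill (spread bs) y) (comm {x − b} as y-x-b v) j)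
                                   (comm {x − b} (spread bs) y-x-b (kill as y $ v) j)))
        (spread-kills bs ((x − b) $ v)
          (λ k → trans ($-cong (kill bs x) (comm {x − b} as y-x-b v) k)
            (trans (commute-kill {A = x} {x − b} bs
              (commute-sym {A = x − b} {x} (commute-− {A = x} {x} b (commute-self x))) _ k) (h k))) j)
      DDw : D $ D $ w ≗ w
      DDw j = trans ($-cong D (λ k → sym (D-comm-y (spread bs) (kill as y $ v) k)) j)
        (trans (sym (D-comm-y (spread bs) (D $ kill as y $ v) j)) ($-cong (kill (spread bs) y) (D² v) j))
      xw : x $ w ≗ b • w
      xw j = trans (lemma₀ ((x $ w) j) b (w j)) (trans (cong (_+ b * w j) (killed j)) (ℤP.+-identityˡ _))
        where lemma₀ : ∀ u b w → u ≡ (u + (- b) * w) + b * w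
              lemma₀ = solve-∀
      Dw : D $ w ≗ (y $ w) ⊕ (- b) • w
      Dw j = trans (cong (λ z → (y $ w) j + -1ℤ * z) (xw j)) (cong (_+_ ((y $ w) j)) (lemma₀ b (w j)))
        where lemma₀ : ∀ b w → -1ℤ * (b * w) ≡ (- b) * w
              lemma₀ = solve-∀
      yy : w i ≡ ((y $ y $ w) i + (- b) * (y $ w) i) + -1ℤ * (b * (y $ w) i + (- b) * (b * w i))
      yy = trans (sym (DDw i)) (trans ($-cong D Dw i)
        (cong₂ (λ p q → p + -1ℤ * q)
          (trans ($-⊕ y (y $ w) ((- b) • w) i) (cong (_+_ ((y $ y $ w) i)) ($-• y (- b) w i)))
          (trans ($-⊕ x (y $ w) ((- b) • w) i)
            (cong₂ _+_ (trans (xy w i) (trans ($-cong y xw i) ($-• y b w i)))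
                       (trans ($-• x (- b) w i) (cong ((- b) *_) (xw i)))))))
      spread-step : ∀ yy y b w → w ≡ (yy + (- b) * y) + -1ℤ * (b * y + (- b) * (b * w)) →
        (yy + (- (b - 1ℤ)) * y) + (- (b + 1ℤ)) * (y + (- (b - 1ℤ)) * w) ≡ 0ℤ
      spread-step yy y b w h = trans (lemma₁ yy y b w) (trans (cong (λ z → z - w) (sym h)) (ℤP.+-inverseʳ w))
        where lemma₁ : ∀ yy y b w → (yy + (- (b - 1ℤ)) * y) + (- (b + 1ℤ)) * (y + (- (b - 1ℤ)) * w)
                         ≡ ((yy + (- b) * y) + -1ℤ * (b * y + (- b) * (b * w))) - w
              lemma₁ = solve-∀

    spread-bounded : ∀ {b} as → All (λ a → ∣ a ∣ ≤ b) as → All (λ a → ∣ a ∣ ≤ suc b) (spread as)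
    spread-bounded []       []       = []
    spread-bounded (a ∷ as) (h ∷ hs) =
      bound a 1ℤ refl h ∷ bound a -1ℤ refl h ∷ spread-bounded as hs
      where
      bound : ∀ {b} a u → ∣ u ∣ ≡ 1 → ∣ a ∣ ≤ b → ∣ a + u ∣ ≤ suc b
      bound {b} a u hu ha = ℕP.≤-trans (ℤP.∣i+j∣≤∣i∣+∣j∣ a u)
        (subst (∣ a ∣ ℕ.+ ∣ u ∣ ≤_) (ℕP.+-comm b 1) (ℕP.+-mono-≤ ha (ℕP.≤-reflexive hu)))

    spread-splits : ∀ {b} → All (λ a → ∣ a ∣ ≤ b) as → Splits (suc b) y
    -- The factors `as` act first: they carry every vector into the image of p(y), where (y - x)² =
    -- 1 is available.
    spread-splits h = spread as ++ as ,
      All.++⁺ (spread-bounded as h) (All.map ℕP.m≤n⇒m≤1+n h) ,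
      (λ v i → trans (kill-++ (spread as) as y v i) (spread-kills as v (kx (kill as y $ v)) i))

  splits-suc : ∀ {b} → Splits b x → Splits (suc b) y
  splits-suc (as , h , kx) = spread-splits as kx h

-- Traces of commuting integer matrices

δ : ∀ {n} → Fin n → V (Fin n)
δ zero    zero    = 1ℤ
δ zero    (suc i) = 0ℤ
δ (suc j) zero    = 0ℤ
δ (suc j) (suc i) = δ j i

∑-δ : ∀ {n} (v : V (Fin n)) i → ∑ (allFin n) (λ j → v j * δ j i) ≡ v i
∑-δ {suc n} v i = trans (∑-allFin n (λ j → v j * δ j i)) (lemma i)
  where
  lemma : ∀ i → v zero * δ zero i + ∑ (allFin n) (λ j → v (suc j) * δ (suc j) i) ≡ v i
  lemma zero    = trans (cong₂ _+_ (ℤP.*-identityʳ (v zero))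
    (trans (∑-cong (allFin n) (λ j → ℤP.*-zeroʳ (v (suc j)))) (∑-0 (allFin n)))) (ℤP.+-identityʳ (v zero))
  lemma (suc i) = trans (cong₂ _+_ (ℤP.*-zeroʳ (v zero)) (∑-δ (v ∘ suc) i)) (ℤP.+-identityˡ _)

$-expand : ∀ {n Y} (A : Lin (Fin n) Y) v → A $ v ≗ (λ y → ∑ (allFin n) (λ j → v j * (A $ δ j) y))
$-expand {n} A v y = trans ($-cong A (λ i → sym (∑-δ v i)) y)
  (trans ($-∑ A (allFin n) (λ j → v j • δ j) y) (∑-cong (allFin n) (λ j → $-• A (v j) (δ j) y)))

tr : ∀ {n} → Lin (Fin n) (Fin n) → ℤ
tr {n} A = ∑ (allFin n) (λ i → (A $ δ i) i)

tr-cong : ∀ {n} {A B : Lin (Fin n) (Fin n)} → (∀ v → A $ v ≗ B $ v) → tr A ≡ tr B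
tr-cong {n} h = ∑-cong (allFin n) (λ i → h (δ i) i)

tr-+ : ∀ {n} (A B : Lin (Fin n) (Fin n)) → tr (A +L B) ≡ tr A + tr B
tr-+ {n} A B = ∑-+ (allFin n) (λ i → (A $ δ i) i) (λ i → (B $ δ i) i)

tr-scale : ∀ {n} a (A : Lin (Fin n) (Fin n)) → tr (scalar a ∘L A) ≡ a * tr A
tr-scale {n} a A = ∑-*ˡ (allFin n) a (λ i → (A $ δ i) i)

tr-comm : ∀ {m n} (A : Lin (Fin m) (Fin n)) (B : Lin (Fin n) (Fin m)) → tr (A ∘L B) ≡ tr (B ∘L A)
tr-comm {m} {n} A B = begin
  ∑ (allFin n) (λ i → (A $ B $ δ i) i)
    ≡⟨ ∑-cong (allFin n) (λ i → $-expand A (B $ δ i) i) ⟩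
  ∑ (allFin n) (λ i → ∑ (allFin m) (λ j → (B $ δ i) j * (A $ δ j) i))
    ≡⟨ ∑-swap (allFin n) (allFin m) _ ⟩
  ∑ (allFin m) (λ j → ∑ (allFin n) (λ i → (B $ δ i) j * (A $ δ j) i))
    ≡⟨ ∑-cong (allFin m) (λ j → trans (∑-cong (allFin n) (λ i → ℤP.*-comm ((B $ δ i) j) _)) (sym ($-expand B (A $ δ j) j))) ⟩
  ∑ (allFin m) (λ j → (B $ A $ δ j) j) ∎
  where open ≡-Reasoning

-- Unimodular splitting of integer lattices

record Bezout (a b : ℤ) : Set where
  field
    g p q x y : ℤ
    a≡gp : a ≡ g * p
    b≡gq : b ≡ g * q
    xp+yq≡1 : x * p + y * q ≡ 1ℤ

unit : ∀ a → ∃ λ s → ℤ.+ ∣ a ∣ ≡ s * a × s * s ≡ 1ℤ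
unit (ℤ.+ n)      = 1ℤ , sym (ℤP.*-identityˡ (ℤ.+ n)) , refl
unit (ℤ.-[1+ n ]) = -1ℤ , sym (ℤP.-1*i≡-i ℤ.-[1+ n ]) , refl

-- A Bézout identity for |a| and |b| can be divided by their gcd, which is nonzero since b is; so
-- the quotients are coprime. The signs of a and b are moved into p, q, x, y.
bezout : ∀ a b → ¬ b ≡ 0ℤ → Bezout a b
bezout a b b≢0 with unit a | unit b | Bézout.lemma ∣ a ∣ ∣ b ∣
... | s , ∣a∣ , s² | t , ∣b∣ , t² | Bézout.result d gcd id′ = record
  { g = ℤ.+ d ; p = s * P ; q = t * Q ; x = s * X ; y = t * Y
  ; a≡gp = sgn s a ∣ a ∣ P ∣a∣ s² a′ ; b≡gq = sgn t b ∣ b ∣ Q ∣b∣ t² b′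
  ; xp+yq≡1 = trans (lemma s X P t Y Q) (trans (cong₂ (λ u v → u * (X * P) + v * (Y * Q)) s² t²) (cancel (proj₂ (proj₂ XY)))) }
  where
  open import Data.Nat.GCD using (module GCD)
  open import Data.Nat.Divisibility using (_∣_)
  open _∣_ (proj₁ (GCD.commonDivisor gcd)) using () renaming (quotient to pn; equality to a-eq)
  open _∣_ (proj₂ (GCD.commonDivisor gcd)) using () renaming (quotient to qn; equality to b-eq)
  P = ℤ.+ pn
  Q = ℤ.+ qn
  a′ : ℤ.+ ∣ a ∣ ≡ ℤ.+ d * P
  a′ = trans (cong ℤ.+_ a-eq) (trans (ℤP.pos-* pn d) (ℤP.*-comm P (ℤ.+ d)))
  b′ : ℤ.+ ∣ b ∣ ≡ ℤ.+ d * Q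
  b′ = trans (cong ℤ.+_ b-eq) (trans (ℤP.pos-* qn d) (ℤP.*-comm Q (ℤ.+ d)))
  sgn : ∀ s a n P → ℤ.+ n ≡ s * a → s * s ≡ 1ℤ → ℤ.+ n ≡ ℤ.+ d * P → a ≡ ℤ.+ d * (s * P)
  sgn s a n P e s² e′ = begin
    a                ≡⟨ sym (ℤP.*-identityˡ a) ⟩
    1ℤ * a           ≡⟨ cong (_* a) (sym s²) ⟩
    s * s * a        ≡⟨ ℤP.*-assoc s s a ⟩
    s * (s * a)      ≡⟨ cong (s *_) (trans (sym e) e′) ⟩
    s * (ℤ.+ d * P)  ≡⟨ lemma₀ s (ℤ.+ d) P ⟩
    ℤ.+ d * (s * P)  ∎
    where open ≡-Reasoning
          lemma₀ : ∀ s d P → s * (d * P) ≡ d * (s * P)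
          lemma₀ = solve-∀
  lemma : ∀ s X P t Y Q → (s * X) * (s * P) + (t * Y) * (t * Q) ≡ (s * s) * (X * P) + (t * t) * (Y * Q)
  lemma = solve-∀
  d≢0 : ¬ ℤ.+ d ≡ 0ℤ
  d≢0 h = b≢0 (ℤP.∣i∣≡0⇒i≡0 (ℤP.+-injective (trans b′ (trans (cong (_* Q) h) (ℤP.*-zeroˡ Q)))))
  combination : Bézout.Identity d ∣ a ∣ ∣ b ∣ → ∃ λ X → ∃ λ Y → X * (ℤ.+ ∣ a ∣) + Y * (ℤ.+ ∣ b ∣) ≡ ℤ.+ d
  combination (Bézout.+- x y e) = ℤ.+ x , - ℤ.+ y , move (ℤ.+ x) (ℤ.+ y) (ℤ.+ ∣ a ∣) (ℤ.+ ∣ b ∣) (cast x y ∣ a ∣ ∣ b ∣ e)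
    where
    move : ∀ x y a b → ℤ.+ d + y * b ≡ x * a → x * a + (- y) * b ≡ ℤ.+ d
    move x y a b h = trans (cong (_+ (- y) * b) (sym h)) (lemma₁ (ℤ.+ d) y b)
      where lemma₁ : ∀ d y b → (d + y * b) + (- y) * b ≡ d
            lemma₁ = solve-∀
    cast : ∀ x y m n → d ℕ.+ y ℕ.* n ≡ x ℕ.* m → ℤ.+ d + ℤ.+ y * ℤ.+ n ≡ ℤ.+ x * ℤ.+ m
    cast x y m n e = trans (cong (ℤ.+ d +_) (sym (ℤP.pos-* y n))) (trans (cong ℤ.+_ e) (ℤP.pos-* x m))
  combination (Bézout.-+ x y e) = - ℤ.+ x , ℤ.+ y , move (ℤ.+ x) (ℤ.+ y) (ℤ.+ ∣ a ∣) (ℤ.+ ∣ b ∣) (cast x y ∣ a ∣ ∣ b ∣ e)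
    where
    move : ∀ x y a b → ℤ.+ d + x * a ≡ y * b → (- x) * a + y * b ≡ ℤ.+ d
    move x y a b h = trans (cong ((- x) * a +_) (sym h)) (lemma₁ (ℤ.+ d) x a)
      where lemma₁ : ∀ d x a → (- x) * a + (d + x * a) ≡ d
            lemma₁ = solve-∀
    cast : ∀ x y m n → d ℕ.+ x ℕ.* m ≡ y ℕ.* n → ℤ.+ d + ℤ.+ x * ℤ.+ m ≡ ℤ.+ y * ℤ.+ n
    cast x y m n e = trans (cong (ℤ.+ d +_) (sym (ℤP.pos-* x m))) (trans (cong ℤ.+_ e) (ℤP.pos-* y n))
  XY = combination id′
  X = proj₁ XY
  Y = proj₁ (proj₂ XY)
  cancel : X * ℤ.+ ∣ a ∣ + Y * ℤ.+ ∣ b ∣ ≡ ℤ.+ d → 1ℤ * (X * P) + 1ℤ * (Y * Q) ≡ 1ℤ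
  cancel h = ℤP.*-cancelˡ-≡ (ℤ.+ d) _ 1ℤ {{ℤ.≢-nonZero d≢0}}
    (trans (lemma₁ (ℤ.+ d) X P Y Q) (trans (cong₂ (λ u v → X * u + Y * v) (sym a′) (sym b′)) (trans h (sym (ℤP.*-identityʳ (ℤ.+ d))))))
    where lemma₁ : ∀ d X P Y Q → d * (1ℤ * (X * P) + 1ℤ * (Y * Q)) ≡ X * (d * P) + Y * (d * Q)
          lemma₁ = solve-∀

zeroL : {X Y : Set} → Lin X Y
zeroL = record { _$_ = λ _ → 𝟎 ; $-cong = λ _ _ → refl ; $-⊕ = λ _ _ _ → refl ; $-• = λ c _ _ → sym (ℤP.*-zeroʳ c) }

reindex : {X Y : Set} → (Y → X) → Lin X Y
reindex g = record { _$_ = λ v → v ∘ g ; $-cong = λ h → h ∘ g ; $-⊕ = λ _ _ _ → refl ; $-• = λ _ _ _ → refl }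

column : {Y : Set} → V Y → Lin ⊤ Y
column z = record
  { _$_ = λ s → s tt • z
  ; $-cong = λ h i → cong (_* z i) (h tt)
  ; $-⊕ = λ s t i → ℤP.*-distribʳ-+ (z i) (s tt) (t tt)
  ; $-• = λ c s i → ℤP.*-assoc c (s tt) (z i)
  }

consV : ∀ {l} → ℤ → V (Fin l) → V (Fin (suc l))
consV a v zero    = a
consV a v (suc i) = v i

consL : ∀ {X l} → Lin X ⊤ → Lin X (Fin l) → Lin X (Fin (suc l))
consL w W = record
  { _$_ = λ v → consV ((w $ v) tt) (W $ v)
  ; $-cong = λ { h zero → $-cong w h tt ; h (suc i) → $-cong W h i }
  ; $-⊕ = λ { u v zero → $-⊕ w u v tt ; u v (suc i) → $-⊕ W u v i }
  ; $-• = λ { c u zero → $-• w c u tt ; c u (suc i) → $-• W c u i }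
  }

headL : ∀ {l} → Lin (Fin (suc l)) ⊤
headL = reindex (λ _ → zero)

tailL : ∀ {l} → Lin (Fin (suc l)) (Fin l)
tailL = reindex suc

shiftL : ∀ {l} → Lin (Fin l) (Fin (suc l))
shiftL = consL zeroL idL

-- In the second case the lattice is spanned by z and the image of Z, with Z mapping into ker φ; w
-- and W supply integral coordinates. The condition φ z ≠ 0 is what later makes the complement of a
-- kernel inject.
data Peeled {l} (φ : Lin (Fin l) ⊤) : Set where
  vanishing : (∀ v → φ $ v ≗ 𝟎) → Peeled φ
  peel : ∀ {k} (z : V (Fin l)) (w : Lin (Fin l) ⊤) (Z : Lin (Fin k) (Fin l)) (W : Lin (Fin l) (Fin k)) →
    (∀ v i → (w $ v) tt * z i + (Z $ W $ v) i ≡ v i) →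
    (∀ v → φ $ Z $ v ≗ 𝟎) → ¬ (φ $ z) tt ≡ 0ℤ → Peeled φ

functional-cons : ∀ {l} (φ : Lin (Fin (suc l)) ⊤) v →
  (φ $ v) tt ≡ v zero * (φ $ δ zero) tt + (φ $ shiftL $ v ∘ suc) tt
functional-cons φ v = trans ($-cong φ split tt) (trans ($-⊕ φ (v zero • δ zero) (shiftL $ v ∘ suc) tt)
    (cong (_+ (φ $ shiftL $ v ∘ suc) tt) ($-• φ (v zero) (δ zero) tt)))
  where
  split : v ≗ (v zero • δ zero) ⊕ (shiftL $ v ∘ suc)
  split zero    = sym (trans (ℤP.+-identityʳ _) (ℤP.*-identityʳ (v zero)))
  split (suc i) = sym (trans (cong (_+ v (suc i)) (ℤP.*-zeroʳ (v zero))) (ℤP.+-identityˡ _))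

-- Splits off a complement of the kernel of an integer functional, one coordinate at a time;
-- the Bézout matrix with rows (p , q) and (−y , x) has determinant 1.
peelOff : ∀ {l} (φ : Lin (Fin l) ⊤) → Peeled φ
peelOff {zero}  φ = vanishing (λ v → $-vanish φ (λ ()))
peelOff {suc l} φ with peelOff (φ ∘L shiftL) | (φ $ δ zero) tt ℤ.≟ 0ℤ
... | vanishing h | yes e = vanishing (λ v i → trans (functional-cons φ v)
        (trans (cong₂ _+_ (trans (cong (v zero *_) e) (ℤP.*-zeroʳ (v zero))) (h (v ∘ suc) tt)) refl))
... | vanishing h | no ¬e = peel (δ zero) headL shiftL tailL
        (λ { v zero → trans (ℤP.+-identityʳ _) (ℤP.*-identityʳ (v zero))
           ; v (suc i) → trans (cong (_+ v (suc i)) (ℤP.*-zeroʳ (v zero))) (ℤP.+-identityˡ _) })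
        h ¬e
... | peel {k} z w Z W dec φZ φz | _ = peel z′ w′ Z′ W′ dec′ φZ′ φz′
  where
  λ₀ = (φ $ δ zero) tt
  λ₁ = (φ $ shiftL $ z) tt
  open Bezout (bezout λ₀ λ₁ φz)
  z′ u : V (Fin (suc l))
  z′ = consV x (y • z)
  u  = consV (- q) (p • z)
  w′ : Lin (Fin (suc l)) ⊤
  w′ = (scalar p ∘L headL) +L (scalar q ∘L w ∘L tailL)
  W₀ : Lin (Fin (suc l)) ⊤
  W₀ = (scalar (- y) ∘L headL) +L (scalar x ∘L w ∘L tailL)
  W′ : Lin (Fin (suc l)) (Fin (suc k))
  W′ = consL W₀ (W ∘L tailL)
  Z′ : Lin (Fin (suc k)) (Fin (suc l))
  Z′ = (column u ∘L headL) +L (shiftL ∘L Z ∘L tailL)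
  φ-cons : ∀ a b → (φ $ consV a (b • z)) tt ≡ a * λ₀ + b * λ₁
  φ-cons a b = trans (functional-cons φ (consV a (b • z)))
    (cong (a * λ₀ +_) ($-• (φ ∘L shiftL) b z tt))
  dec′ : ∀ v i → (w′ $ v) tt * z′ i + (Z′ $ W′ $ v) i ≡ v i
  dec′ v zero    = trans (lemma p q x y (v zero) ((w $ v ∘ suc) tt)) (trans (cong (_* v zero) xp+yq≡1) (ℤP.*-identityˡ _))
    where lemma : ∀ p q x y a t → (p * a + q * t) * x + (((- y) * a + x * t) * (- q) + 0ℤ) ≡ (x * p + y * q) * a
          lemma = solve-∀
  dec′ v (suc i) = trans (lemma p q x y (v zero) ((w $ v ∘ suc) tt) (z i) ((Z $ W $ v ∘ suc) i))
    (trans (cong (λ e → e * ((w $ v ∘ suc) tt * z i) + (Z $ W $ v ∘ suc) i) xp+yq≡1)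
      (trans (cong (_+ (Z $ W $ v ∘ suc) i) (ℤP.*-identityˡ ((w $ v ∘ suc) tt * z i))) (dec (v ∘ suc) i)))
    where lemma : ∀ p q x y a t z s → (p * a + q * t) * (y * z) + (((- y) * a + x * t) * (p * z) + s) ≡ (x * p + y * q) * (t * z) + s
          lemma = solve-∀
  φu : (φ $ u) tt ≡ 0ℤ
  φu = trans (φ-cons (- q) p) (trans (cong₂ (λ a b → (- q) * a + p * b) a≡gp b≡gq) (lemma g p q))
    where lemma : ∀ g p q → (- q) * (g * p) + p * (g * q) ≡ 0ℤ
          lemma = solve-∀
  φZ′ : ∀ v → φ $ Z′ $ v ≗ 𝟎
  φZ′ v tt = trans ($-⊕ φ (v zero • u) (shiftL $ Z $ v ∘ suc) tt)
    (cong₂ _+_ (trans ($-• φ (v zero) u tt) (trans (cong (v zero *_) φu) (ℤP.*-zeroʳ (v zero)))) (φZ (v ∘ suc) tt))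
  φz≡g : (φ $ z′) tt ≡ g
  φz≡g = trans (φ-cons x y) (trans (cong₂ (λ a b → x * a + y * b) a≡gp b≡gq)
    (trans (lemma g p q x y) (trans (cong (g *_) xp+yq≡1) (ℤP.*-identityʳ g))))
    where lemma : ∀ g p q x y → x * (g * p) + y * (g * q) ≡ g * (x * p + y * q)
          lemma = solve-∀
  φz′ : ¬ (φ $ z′) tt ≡ 0ℤ
  φz′ h = φz (trans b≡gq (trans (cong (_* q) (trans (sym φz≡g) h)) (ℤP.*-zeroˡ q)))

-- V₂ spans the common kernel of the rows `ys` of B, V₁ a complement on which these rows are jointly
-- injective, and U₁, U₂ are the coordinates, all over ℤ. The list of rows is a parameter so that
-- they can be treated one at a time.
record KernelSplitting {n} {Y : Set} (B : Lin (Fin n) Y) (ys : List Y) : Set where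
  field
    {k l} : ℕ
    V₁ : Lin (Fin k) (Fin n)
    U₁ : Lin (Fin n) (Fin k)
    V₂ : Lin (Fin l) (Fin n)
    U₂ : Lin (Fin n) (Fin l)
    decompose : ∀ v i → (V₁ $ U₁ $ v) i + (V₂ $ U₂ $ v) i ≡ v i
    B∘V₂ : ∀ {y} → y ∈ ys → ∀ v → (B $ V₂ $ v) y ≡ 0ℤ
    B∘V₁-injective : ∀ v → (∀ {y} → y ∈ ys → (B $ V₁ $ v) y ≡ 0ℤ) → v ≗ 𝟎

-- The new row is restricted to the current V₂, and a vector z on which it is nonzero moves over to
-- V₁. Injectivity is triangular: the old rows vanish on V₂ z and force the old coordinates to be
-- zero, after which the new row forces the coordinate of z to be zero.
kernelSplitting : ∀ {n Y} (B : Lin (Fin n) Y) ys → KernelSplitting B ys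
kernelSplitting B [] = record
  { V₁ = zeroL {Fin 0} ; U₁ = zeroL ; V₂ = idL ; U₂ = idL
  ; decompose = λ v i → ℤP.+-identityˡ (v i) ; B∘V₂ = λ () ; B∘V₁-injective = λ { _ _ () } }
kernelSplitting B (y ∷ ys) with kernelSplitting B ys
... | S with peelOff (reindex (λ _ → y) ∘L B ∘L KernelSplitting.V₂ S)
... | vanishing h = record
  { V₁ = V₁ ; U₁ = U₁ ; V₂ = V₂ ; U₂ = U₂ ; decompose = decompose
  ; B∘V₂ = λ { (here refl) v → h v tt ; (there i) v → B∘V₂ i v }
  ; B∘V₁-injective = λ v hv → B∘V₁-injective v (hv ∘ there) }
  where open KernelSplitting S
... | peel z w Z W dec φZ φz = record
  { V₁ = V₁′ ; U₁ = consL (w ∘L U₂) U₁ ; V₂ = V₂ ∘L Z ; U₂ = W ∘L U₂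
  ; decompose = dec′
  ; B∘V₂ = λ { (here refl) v → φZ v tt ; (there i) v → B∘V₂ i (Z $ v) }
  ; B∘V₁-injective = inj′ }
  where
  open KernelSplitting S
  V₁′ : Lin (Fin (suc k)) (Fin _)
  V₁′ = (column (V₂ $ z) ∘L headL) +L (V₁ ∘L tailL)
  dec′ : ∀ v i → ((w $ U₂ $ v) tt * (V₂ $ z) i + (V₁ $ U₁ $ v) i) + (V₂ $ Z $ W $ U₂ $ v) i ≡ v i
  dec′ v i = trans (lemma (a * (V₂ $ z) i) ((V₁ $ U₁ $ v) i) ((V₂ $ Z $ W $ U₂ $ v) i))
    (trans (cong ((V₁ $ U₁ $ v) i +_)
      (trans (cong (_+ (V₂ $ Z $ W $ U₂ $ v) i) (sym ($-• V₂ a z i)))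
        (trans (sym ($-⊕ V₂ (a • z) (Z $ W $ U₂ $ v) i)) ($-cong V₂ (dec (U₂ $ v)) i)))) (decompose v i))
    where
    a = (w $ U₂ $ v) tt
    lemma : ∀ a b c → (a + b) + c ≡ b + (a + c)
    lemma = solve-∀
  BV₁′ : ∀ v y → (B $ V₁′ $ v) y ≡ v zero * (B $ V₂ $ z) y + (B $ V₁ $ v ∘ suc) y
  BV₁′ v y = trans ($-⊕ B (v zero • (V₂ $ z)) (V₁ $ v ∘ suc) y) (cong (_+ (B $ V₁ $ v ∘ suc) y) ($-• B (v zero) (V₂ $ z) y))
  module _ (v : V (Fin (suc k))) (hv : ∀ {y′} → y′ ∈ (y ∷ ys) → (B $ V₁′ $ v) y′ ≡ 0ℤ) where
    tail≗𝟎 : v ∘ suc ≗ 𝟎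
    tail≗𝟎 = B∘V₁-injective (v ∘ suc) (λ {y′} i → trans (sym (trans
      (cong (_+ (B $ V₁ $ v ∘ suc) y′) (trans (cong (v zero *_) (B∘V₂ i z)) (ℤP.*-zeroʳ (v zero)))) (ℤP.+-identityˡ _)))
      (trans (sym (BV₁′ v y′)) (hv (there i))))
    inj′ : v ≗ 𝟎
    inj′ (suc i) = tail≗𝟎 i
    inj′ zero with ℤP.i*j≡0⇒i≡0∨j≡0 (v zero) (trans (sym (trans (BV₁′ v y)
                  (trans (cong (v zero * (B $ V₂ $ z) y +_) ($-vanish (B ∘L V₁) tail≗𝟎 y)) (ℤP.+-identityʳ _)))) (hv (here refl)))
    ... | inj₁ e = e
    ... | inj₂ e = ⊥-elim (φz e)

-- Trace on an eigenlattice and on its quotient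

pow : {X : Set} → Lin X X → ℕ → Lin X X
pow A zero    = idL
pow A (suc r) = A ∘L pow A r

-- A base may occur several times, and the base 0 is allowed, so that sums are formed by
-- concatenation; terms with equal base are collected only at the end.
Exponential : ℕ → (ℕ → ℤ) → Set
Exponential b f = Σ (List (ℤ × ℤ)) λ cs → All (λ cm → ∣ proj₂ cm ∣ ≤ b) cs ×
  (∀ r → f r ≡ ∑ cs (λ cm → proj₁ cm * proj₂ cm ^ℤ r))

module KernelComplement {n} (A : Lin (Fin n) (Fin n)) (a : ℤ) where
  open KernelSplitting (kernelSplitting (A − a) (allFin n)) public

  V₁-injective : ∀ v → (A − a) $ V₁ $ v ≗ 𝟎 → v ≗ 𝟎
  V₁-injective v hv = B∘V₁-injective v (λ {y} _ → hv y)

  V₂-kernel : ∀ v → (A − a) $ V₂ $ v ≗ 𝟎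
  V₂-kernel v y = B∘V₂ (∈-allFin y) v

  mod-kernel : ∀ v → (A − a) $ V₁ $ U₁ $ v ≗ (A − a) $ v
  mod-kernel v i = begin
    (A − a $ V₁ $ U₁ $ v) i
      ≡⟨ sym (ℤP.+-identityʳ _) ⟩
    (A − a $ V₁ $ U₁ $ v) i + 0ℤ
      ≡⟨ cong ((A − a $ V₁ $ U₁ $ v) i +_) (sym (V₂-kernel (U₂ $ v) i)) ⟩
    (A − a $ V₁ $ U₁ $ v) i + (A − a $ V₂ $ U₂ $ v) i
      ≡⟨ sym ($-⊕ (A − a) (V₁ $ U₁ $ v) (V₂ $ U₂ $ v) i) ⟩
    (A − a $ (V₁ $ U₁ $ v) ⊕ (V₂ $ U₂ $ v)) i
      ≡⟨ $-cong (A − a) (decompose v) i ⟩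
    (A − a $ v) i ∎
    where open ≡-Reasoning

  -- A - a is injective on V₁, so a kernel vector has no V₁ component. Hence `U₁` gives coordinates
  -- on the quotient by ker (A - a), to which operators commuting with A descend.
  U₁-kernel : ∀ v → (A − a) $ v ≗ 𝟎 → U₁ $ v ≗ 𝟎
  U₁-kernel v hv = V₁-injective (U₁ $ v) (λ i → trans (mod-kernel v i) (hv i))

  U₁∘V₁ : ∀ v → U₁ $ V₁ $ v ≗ v
  U₁∘V₁ v i = ℤP.i-j≡0⇒i≡j ((U₁ $ w) i) (v i)
    (trans (cong ((U₁ $ w) i +_) (sym (ℤP.-1*i≡-i (v i)))) (V₁-injective ((U₁ $ w) ⊕ -1ℤ • v) cancel i))
    where
    w = V₁ $ v
    B∘V₁ = (A − a) ∘L V₁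
    cancel : (A − a) $ V₁ $ (U₁ $ w) ⊕ -1ℤ • v ≗ 𝟎
    cancel j = trans ($-⊕ B∘V₁ (U₁ $ w) (-1ℤ • v) j)
      (trans (cong₂ _+_ (mod-kernel w j) ($-• B∘V₁ -1ℤ v j)) (lemma ((A − a $ w) j)))
      where lemma : ∀ x → x + -1ℤ * x ≡ 0ℤ
            lemma = solve-∀

  induced : Lin (Fin n) (Fin n) → Lin (Fin k) (Fin k)
  induced E = U₁ ∘L E ∘L V₁

  U₁-induced : ∀ E → Commute (A − a) E → ∀ v → U₁ $ E $ v ≗ induced E $ U₁ $ v
  U₁-induced E AC v i = trans ($-cong (U₁ ∘L E) (λ j → sym (decompose v j)) i)
    (trans ($-⊕ (U₁ ∘L E) (V₁ $ U₁ $ v) (V₂ $ U₂ $ v) i)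
      (trans (cong ((U₁ $ E $ V₁ $ U₁ $ v) i +_) (U₁-kernel (E $ V₂ $ U₂ $ v)
        (λ j → trans (AC (V₂ $ U₂ $ v) j) ($-vanish E (V₂-kernel (U₂ $ v)) j)) i)) (ℤP.+-identityʳ _)))

  P : Lin (Fin k) (Fin k)
  P = induced A

  U₁A : ∀ v → U₁ $ A $ v ≗ P $ U₁ $ v
  U₁A = U₁-induced A (commute-− {A = A} {A} a (commute-self A))

  U₁-pow : ∀ r v → U₁ $ pow A r $ v ≗ pow P r $ U₁ $ v
  U₁-pow zero    v i = refl
  U₁-pow (suc r) v i = trans (U₁A (pow A r $ v) i) ($-cong P (U₁-pow r v) i)

  U₁-kill : ∀ as v → U₁ $ kill as A $ v ≗ kill as P $ U₁ $ v
  U₁-kill []       v i = refl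
  U₁-kill (b ∷ as) v i = trans ($-⊕ U₁ (A $ u) ((- b) • u) i)
    (trans (cong₂ _+_ (U₁A u i) ($-• U₁ (- b) u i)) ($-cong (P − b) (U₁-kill as v) i))
    where u = kill as A $ v

  -- The product `kill as A` maps everything into ker (A - a), which is zero in the quotient; the
  -- factor for a can thus be dropped there.
  kill-P : ∀ as → (∀ v → kill (a ∷ as) A $ v ≗ 𝟎) → ∀ v → kill as P $ v ≗ 𝟎
  kill-P as kA v i = trans ($-cong (kill as P) (λ j → sym (U₁∘V₁ v j)) i)
    (trans (sym (U₁-kill as (V₁ $ v) i)) (U₁-kernel (kill as A $ V₁ $ v) (kA (V₁ $ v)) i))

  pow-V₂ : ∀ r v → pow A r $ V₂ $ v ≗ (a ^ℤ r) • (V₂ $ v)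
  pow-V₂ zero    v i = sym (ℤP.*-identityˡ _)
  pow-V₂ (suc r) v i = trans ($-cong A (pow-V₂ r v) i) (trans ($-• A (a ^ℤ r) (V₂ $ v) i)
    (trans (cong (a ^ℤ r *_) (eigen ((A $ V₂ $ v) i) ((V₂ $ v) i) (V₂-kernel v i))) (lemma (a ^ℤ r) a ((V₂ $ v) i))))
    where
    eigen : ∀ x y → x + (- a) * y ≡ 0ℤ → x ≡ a * y
    eigen x y h = ℤP.i-j≡0⇒i≡j x (a * y) (trans (cong (x +_) (ℤP.neg-distribˡ-* a y)) h)
    lemma : ∀ p a x → p * (a * x) ≡ (a * p) * x
    lemma = solve-∀

  module _ (S : Lin (Fin n) (Fin n)) (AS : Commute A S) where
    S₁ : Lin (Fin k) (Fin k)
    S₁ = induced S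

    P-S₁ : Commute P S₁
    P-S₁ v i = trans (sym (U₁A (S $ V₁ $ v) i)) (trans ($-cong U₁ (AS (V₁ $ v)) i)
      (U₁-induced S (commute-− {A = A} {S} a AS) (A $ V₁ $ v) i))

    pow-comm : ∀ r → Commute (pow A r) S
    pow-comm zero    v i = refl
    pow-comm (suc r) = commute-∘ {A = A} {pow A r} {S} AS (pow-comm r)

    -- A and S preserve ker (A - a), so the trace is the trace on it plus the trace on the quotient.
    -- Cyclicity turns each projection into a smaller square matrix, and on the kernel Aʳ is the
    -- scalar aʳ.
    tr-split : ∀ r → tr (pow A r ∘L S) ≡ tr (U₂ ∘L S ∘L V₂) * a ^ℤ r + tr (pow P r ∘L S₁)
    tr-split r = begin
      tr M                                    ≡⟨ tr-cong {A = M} {(V₁ ∘L U₁ ∘L M) +L (V₂ ∘L U₂ ∘L M)} (λ v i → sym (decompose (M $ v) i)) ⟩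
      tr ((V₁ ∘L U₁ ∘L M) +L (V₂ ∘L U₂ ∘L M)) ≡⟨ tr-+ (V₁ ∘L U₁ ∘L M) (V₂ ∘L U₂ ∘L M) ⟩
      tr (V₁ ∘L U₁ ∘L M) + tr (V₂ ∘L U₂ ∘L M) ≡⟨ cong₂ _+_ first second ⟩
      tr (pow P r ∘L S₁) + t * a ^ℤ r ≡⟨ ℤP.+-comm (tr (pow P r ∘L S₁)) (t * a ^ℤ r) ⟩
      t * a ^ℤ r + tr (pow P r ∘L S₁)         ∎
      where
      open ≡-Reasoning
      M = pow A r ∘L S
      t = tr (U₂ ∘L S ∘L V₂)
      first : tr (V₁ ∘L U₁ ∘L M) ≡ tr (pow P r ∘L S₁)
      first = trans (tr-comm V₁ (U₁ ∘L M)) (tr-cong {A = (U₁ ∘L M) ∘L V₁} {pow P r ∘L S₁} (λ v i → U₁-pow r (S $ V₁ $ v) i))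
      second : tr (V₂ ∘L U₂ ∘L M) ≡ t * a ^ℤ r
      second = trans (tr-comm V₂ (U₂ ∘L M))
        (trans (tr-cong {A = (U₂ ∘L M) ∘L V₂} {scalar (a ^ℤ r) ∘L U₂ ∘L S ∘L V₂}
          (λ v i → trans ($-cong U₂ (λ j → trans (pow-comm r (V₂ $ v) j) ($-cong S (pow-V₂ r v) j)) i)
                         ($-• (U₂ ∘L S) (a ^ℤ r) (V₂ $ v) i)))
        (trans (tr-scale (a ^ℤ r) (U₂ ∘L S ∘L V₂)) (ℤP.*-comm (a ^ℤ r) t)))

-- The coefficient of aʳ is the trace of S on the saturated lattice ker (A − a), hence an integer.
trace-exponential : ∀ {b} as → All (λ a → ∣ a ∣ ≤ b) as → ∀ {n} (A S : Lin (Fin n) (Fin n)) →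
  Commute A S → (∀ v → kill as A $ v ≗ 𝟎) → Exponential b (λ r → tr (pow A r ∘L S))
trace-exponential []       _        {n} A S AS kA =
  [] , [] , λ r → trans (∑-cong (allFin n) (λ i → kA (pow A r $ S $ δ i) i)) (∑-0 (allFin n))
trace-exponential (a ∷ as) (h ∷ hs) A S AS kA =
  let cs , bounded , eq = trace-exponential as hs P (S₁ S AS) (P-S₁ S AS) (kill-P as kA)
  in (tr (U₂ ∘L S ∘L V₂) , a) ∷ cs , h ∷ bounded ,
     λ r → trans (tr-split S AS r) (cong (tr (U₂ ∘L S ∘L V₂) * a ^ℤ r +_) (eq r))
  where open KernelComplement A a

-- The action of S_d on maps, and sums over Young subgroups

∑-cong-∈ : {A : Set} (xs : List A) {f g : A → ℤ} → (∀ {x} → x ∈ xs → f x ≡ g x) → ∑ xs f ≡ ∑ xs g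
∑-cong-∈ []       h = refl
∑-cong-∈ (x ∷ xs) h = cong₂ _+_ (h (here refl)) (∑-cong-∈ xs (h ∘ there))

∑-↭ : {A : Set} {xs ys : List A} (f : A → ℤ) → xs ↭ ys → ∑ xs f ≡ ∑ ys f
∑-↭ f _↭_.refl        = refl
∑-↭ f (_↭_.prep x p)  = cong (f x +_) (∑-↭ f p)
∑-↭ f (_↭_.swap x y p) = trans (cong (λ s → f x + (f y + s)) (∑-↭ f p)) (lemma (f x) (f y) _)
  where lemma : ∀ a b s → a + (b + s) ≡ b + (a + s)
        lemma = solve-∀
∑-↭ f (_↭_.trans p q) = trans (∑-↭ f p) (∑-↭ f q)

∑-filter : {A : Set} (p : A → Bool) (xs : List A) (f : A → ℤ) →
  ∑ (filterᵇ p xs) f ≡ ∑ xs (λ x → if p x then f x else 0ℤ)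
∑-filter p []       f = refl
∑-filter p (x ∷ xs) f with p x
... | true  = cong (f x +_) (∑-filter p xs f)
... | false = trans (∑-filter p xs f) (sym (ℤP.+-identityˡ _))

∑-if : {A : Set} (b : Bool) (xs : List A) (f : A → ℤ) →
  (if b then ∑ xs f else 0ℤ) ≡ ∑ xs (λ x → if b then f x else 0ℤ)
∑-if true  xs f = refl
∑-if false xs f = sym (∑-0 xs)

-- Transpositions and their conjugates

==⇒≡ : ∀ {d} {x y : Fin d} → (x == y) ≡ true → x ≡ y
==⇒≡ {x = x} {y} h = FP.toℕ-injective (ℕP.≡ᵇ⇒≡ (toℕ x) (toℕ y) (subst T (sym h) tt))

≡⇒== : ∀ {d} {x y : Fin d} → x ≡ y → (x == y) ≡ true
≡⇒== {x = x} refl = go (toℕ x)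
  where go : ∀ n → (n ℕ.≡ᵇ n) ≡ true
        go zero    = refl
        go (suc n) = go n

≢⇒== : ∀ {d} {x y : Fin d} → ¬ x ≡ y → (x == y) ≡ false
≢⇒== {x = x} {y} h with x == y in eq
... | true  = ⊥-elim (h (==⇒≡ eq))
... | false = refl

module _ {d : ℕ} where

  applyT-fst : (i j : Fin d) → applyT ⟨ i , j ⟩ i ≡ j
  applyT-fst i j rewrite ≡⇒== {x = i} refl = refl

  applyT-snd : (i j : Fin d) → applyT ⟨ i , j ⟩ j ≡ i
  applyT-snd i j with j == i in eq
  ... | true  = ==⇒≡ eq
  ... | false rewrite ≡⇒== {x = j} refl = refl

  applyT-other : ∀ {i j x : Fin d} → ¬ x ≡ i → ¬ x ≡ j → applyT ⟨ i , j ⟩ x ≡ x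
  applyT-other h k rewrite ≢⇒== h | ≢⇒== k = refl

  data TranspCase (i j x : Fin d) : Set where
    is-fst : x ≡ i → applyT ⟨ i , j ⟩ x ≡ j → TranspCase i j x
    is-snd : x ≡ j → applyT ⟨ i , j ⟩ x ≡ i → TranspCase i j x
    other  : ¬ x ≡ i → ¬ x ≡ j → applyT ⟨ i , j ⟩ x ≡ x → TranspCase i j x

  transpCase : ∀ i j x → TranspCase i j x
  transpCase i j x with x ≟ i | x ≟ j
  ... | yes refl | _        = is-fst refl (applyT-fst i j)
  ... | no _     | yes refl = is-snd refl (applyT-snd i j)
  ... | no h     | no k     = other h k (applyT-other h k)

  applyT-involutive : ∀ t (x : Fin d) → applyT t (applyT t x) ≡ x
  applyT-involutive ⟨ i , j ⟩ x with transpCase i j x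
  ... | is-fst refl e = trans (cong (applyT ⟨ i , j ⟩) e) (applyT-snd i j)
  ... | is-snd refl e = trans (cong (applyT ⟨ i , j ⟩) e) (applyT-fst i j)
  ... | other _ _ e   = trans (cong (applyT ⟨ i , j ⟩) e) e

  applyT-injective : ∀ t → Injective _≡_ _≡_ (applyT {d} t)
  applyT-injective t {x} {y} h = trans (sym (applyT-involutive t x)) (trans (cong (applyT t) h) (applyT-involutive t y))

  applyT-conj : ∀ {π : Fin d → Fin d} → Injective _≡_ _≡_ π → ∀ i j x →
    π (applyT ⟨ i , j ⟩ x) ≡ applyT ⟨ π i , π j ⟩ (π x)
  applyT-conj {π} inj i j x with transpCase i j x
  ... | is-fst refl e = trans (cong π e) (sym (applyT-fst (π i) (π j)))
  ... | is-snd refl e = trans (cong π e) (sym (applyT-snd (π i) (π j)))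
  ... | other h k e   = trans (cong π e) (sym (applyT-other (h ∘ inj) (k ∘ inj)))

funToFin-cong : ∀ {m n} {f g : Fin m → Fin n} → f ≗ g → funToFin f ≡ funToFin g
funToFin-cong {zero}  h = refl
funToFin-cong {suc m} h = cong₂ combine (h zero) (funToFin-cong (h ∘ suc))

sumL : {A X : Set} → List A → (A → Lin X X) → Lin X X
sumL as F = record
  { _$_ = λ v i → ∑ as (λ a → (F a $ v) i)
  ; $-cong = λ h i → ∑-cong as (λ a → $-cong (F a) h i)
  ; $-⊕ = λ u v i → trans (∑-cong as (λ a → $-⊕ (F a) u v i)) (∑-+ as (λ a → (F a $ u) i) (λ a → (F a $ v) i))
  ; $-• = λ c u i → trans (∑-cong as (λ a → $-• (F a) c u i)) (∑-*ˡ as c (λ a → (F a $ u) i))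
  }

commute-sumL : {A X : Set} (as : List A) (F : A → Lin X X) (B : Lin X X) →
  (∀ {a} → a ∈ as → Commute (F a) B) → Commute (sumL as F) B
commute-sumL as F B h v i = trans (∑-cong-∈ as (λ a∈ → h a∈ v i)) (sym ($-∑ B as (λ a → F a $ v) i))

splits-weaken : ∀ {X b c} {A : Lin X X} → b ≤ c → Splits b A → Splits c A
splits-weaken b≤c (as , h , k) = as , All.map (λ a≤b → ℕP.≤-trans a≤b b≤c) h , k

module Action (d : ℕ) where

  -- All self-maps are taken, in the numbering of `finToFun`, so that matrices are indexed by a
  -- `Fin`; bijectivity is imposed later through S.
  Maps : Set
  Maps = Fin (d ℕ.^ d)

  decode : Maps → Fin d → Fin d
  decode = finToFun {d} {d}

  encode : (Fin d → Fin d) → Maps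
  encode = funToFin {d} {d}

  act : (Fin d → Fin d) → Maps → Maps
  act π f = encode (π ∘ decode f)

  act-cong : ∀ {π ρ} → π ≗ ρ → ∀ f → act π f ≡ act ρ f
  act-cong h f = funToFin-cong (λ x → h (decode f x))

  act-∘ : ∀ π ρ f → act π (act ρ f) ≡ act (π ∘ ρ) f
  act-∘ π ρ f = funToFin-cong (λ x → cong π (FP.finToFun-funToFin {d} {d} (ρ ∘ decode f) x))

  act-id : ∀ f → act id f ≡ f
  act-id = FP.funToFin-finToFin {d} {d}

  transL : Transp d → Lin Maps Maps
  transL t = reindex (act (applyT t))

  -- For k outside `cs` this is the Jucys-Murphy element of k, with `cs` in place of the letters
  -- below k.
  jm : Fin d → List (Fin d) → Lin Maps Maps
  jm k cs = sumL cs (λ c → transL ⟨ k , c ⟩)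

  private
    act² : ∀ t t′ f → act (applyT t) (act (applyT t′) f) ≡ act (applyT t ∘ applyT t′) f
    act² t t′ = act-∘ (applyT t) (applyT t′)

  -- Conjugation by t turns (k c) into (k t(c)); when t fixes k and permutes `cs`, it only reorders
  -- the summands.
  jm-commute : ∀ t k cs → applyT t k ≡ k → (∀ (F : Fin d → ℤ) → ∑ cs (F ∘ applyT t) ≡ ∑ cs F) → Commute (transL t) (jm k cs)
  jm-commute t k cs tk≡k inv v i = trans (sym (inv (λ c → v (act (applyT ⟨ k , c ⟩) (act (applyT t) i)))))
    (∑-cong cs (λ c → cong v (trans (act² ⟨ k , applyT t c ⟩ t i) (trans (act-cong (λ x →
        sym (trans (applyT-conj (applyT-injective t) k c x) (cong (λ m → applyT ⟨ m , applyT t c ⟩ (applyT t x)) tk≡k))) i)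
        (sym (act² t ⟨ k , c ⟩ i))))))

  ∑-invariant : ∀ (t : Transp d) (cs : List (Fin d)) → Unique cs → (∀ {c} → c ∈ cs → applyT t c ∈ cs) → ∀ (F : Fin d → ℤ) → ∑ cs (F ∘ applyT t) ≡ ∑ cs F
  ∑-invariant t cs u stable F = trans (sym (∑-map (applyT t) cs F))
    (∑-↭ F (∼bag⇒↭ (unique∧set⇒bag (Unique.map⁺ (applyT-injective t) u) u
      (mk⇔ (λ c∈ → let b , b∈ , e = ∈-map⁻ (applyT t) c∈ in subst (_∈ cs) (sym e) (stable b∈))
           back))))
    where
    back : ∀ {c} → c ∈ cs → c ∈ map (applyT t) cs
    back {c} c∈ = subst (_∈ map (applyT t) cs) (applyT-involutive t c) (∈-map⁺ (applyT t) (stable c∈))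

  applyT-stable : ∀ {i j : Fin d} {cs} → (i ∈ cs → j ∈ cs) → (j ∈ cs → i ∈ cs) → ∀ {c} → c ∈ cs → applyT ⟨ i , j ⟩ c ∈ cs
  applyT-stable {i} {j} {cs} i→j j→i {c} c∈ with transpCase i j c
  ... | is-fst refl e = subst (_∈ cs) (sym e) (i→j c∈)
  ... | is-snd refl e = subst (_∈ cs) (sym e) (j→i c∈)
  ... | other _ _ e   = subst (_∈ cs) (sym e) c∈

  ∉⇒≢ : ∀ {k c : Fin d} {cs} → All (k ≢_) cs → c ∈ cs → ¬ k ≡ c
  ∉⇒≢ h c∈ = All.lookup h c∈

  -- For s = (k j), conjugation by s turns (j c) into (k c), and the remaining summand (k j) cancels
  -- against s to give 1. So the elements of j over `cs` and of k over `j ∷ cs` satisfy the Hecke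
  -- relation, and each further letter costs one in the bound.
  jm-splits : ∀ k cs → All (k ≢_) cs → Unique cs → Splits (length cs) (jm k cs)
  jm-splits k []       _        _        = 0ℤ ∷ [] , z≤n ∷ [] , λ v i → ℤP.*-zeroˡ (v i)
  jm-splits k (j ∷ cs) (k≢j ∷ k∉) (j∉ ∷ u) =
    JucysMurphyStep.splits-suc s (jm j cs) (jm k (j ∷ cs)) s² ys xy (jm-splits j cs j∉ u)
    where
    s = transL ⟨ k , j ⟩
    s² : ∀ v → s $ s $ v ≗ v
    s² v i = cong v (trans (act² ⟨ k , j ⟩ ⟨ k , j ⟩ i) (trans (act-cong (applyT-involutive ⟨ k , j ⟩) i) (act-id i)))
    ys : ∀ v → jm k (j ∷ cs) $ s $ v ≗ (s $ jm j cs $ v) ⊕ v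
    ys v i = trans (cong (_+ (jm k cs $ s $ v) i) (s² v i)) (trans (ℤP.+-comm (v i) _)
      (cong (_+ v i) (∑-cong-∈ cs (λ {c} c∈ → cong v (trans (act² ⟨ k , j ⟩ ⟨ k , c ⟩ i)
        (trans (act-cong (λ x → trans (applyT-conj (applyT-injective ⟨ k , j ⟩) k c x)
            (cong₂ (λ m n → applyT ⟨ m , n ⟩ (applyT ⟨ k , j ⟩ x)) (applyT-fst k j)
              (applyT-other (∉⇒≢ k∉ c∈ ∘ sym) (∉⇒≢ j∉ c∈ ∘ sym)))) i)
          (sym (act² ⟨ j , c ⟩ ⟨ k , j ⟩ i))))))))
    xy : Commute (jm j cs) (jm k (j ∷ cs))
    xy = commute-sumL cs (λ c → transL ⟨ j , c ⟩) (jm k (j ∷ cs)) (λ {c} c∈ →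
      jm-commute ⟨ j , c ⟩ k (j ∷ cs) (applyT-other k≢j (∉⇒≢ k∉ c∈))
        (∑-invariant ⟨ j , c ⟩ (j ∷ cs) (j∉ ∷ u) (λ {m} → applyT-stable {j} {c} {j ∷ cs} (λ _ → there c∈) (λ _ → here refl) {m})))

-- A set partition is encoded by its colour classes. With lists of Booleans as colours, cutting
-- every block by a subset is a cons, and the constant empty list is the partition with one block.
Colouring : ℕ → Set
Colouring d = Fin d → List Bool

same : ∀ {d} → Colouring d → Fin d → Fin d → Bool
same P i j = does (ListP.≡-dec 𝔹._≟_ (P i) (P j))

same⇒≡ : ∀ {d} (P : Colouring d) {i j} → same P i j ≡ true → P i ≡ P j
same⇒≡ P {i} {j} h with ListP.≡-dec 𝔹._≟_ (P i) (P j)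
... | yes e = e

≡⇒same : ∀ {d} (P : Colouring d) {i j} → P i ≡ P j → same P i j ≡ true
≡⇒same P {i} {j} = dec-true (ListP.≡-dec 𝔹._≟_ (P i) (P j))

T⇒≡ : ∀ {b} → T b → b ≡ true
T⇒≡ {true} _ = refl

≡⇒T : ∀ {b} → b ≡ true → T b
≡⇒T refl = tt

∈-filterᵇ⁺ : {A : Set} (p : A → Bool) {xs : List A} {x : A} → x ∈ xs → p x ≡ true → x ∈ filterᵇ p xs
∈-filterᵇ⁺ p x∈ h = ∈-filter⁺ (𝔹.T? ∘ p) x∈ (≡⇒T h)

∈-filterᵇ⁻ : {A : Set} (p : A → Bool) {xs : List A} {x : A} → x ∈ filterᵇ p xs → x ∈ xs × p x ≡ true
∈-filterᵇ⁻ p x∈ with ∈-filter⁻ (𝔹.T? ∘ p) x∈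
... | x∈xs , h = x∈xs , T⇒≡ h

triangle : ℕ → ℕ
triangle zero    = 0
triangle (suc n) = n ℕ.+ triangle n

triangle≡C2 : ∀ n → triangle n ≡ n C 2
triangle≡C2 zero    = refl
triangle≡C2 (suc n) = trans (cong₂ ℕ._+_ (sym (nC1≡n n)) (triangle≡C2 n)) (nCk+nC[k+1]≡[n+1]C[k+1] n 1)

module Young (d : ℕ) (P : Colouring d) where
  open Action d

  later : Fin d → List (Fin d) → List (Fin d)
  later c cs = filterᵇ (same P c) cs

  -- Each letter is paired with the later letters of its own block, which groups the transpositions
  -- inside blocks into Jucys-Murphy elements.
  youngL : List (Fin d) → Lin Maps Maps
  youngL []       = zeroL
  youngL (c ∷ cs) = jm c (later c cs) +L youngL cs

  -- The transpositions (m c) on the left lie inside a block and avoid k. Either both of m and c are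
  -- in the block of k or neither is, so (m c) permutes the letters of `cs` in that block.
  youngL-commute : ∀ k cs → All (k ≢_) cs → Unique cs → ∀ ms → (∀ {m} → m ∈ ms → m ∈ cs) →
    Commute (youngL ms) (jm k (later k cs))
  youngL-commute k cs k∉ u []       _ v i = sym ($-𝟎 (jm k (later k cs)) i)
  youngL-commute k cs k∉ u (m ∷ ms) ⊆ =
    commute-+ {A = jm m (later m ms)} {youngL ms} {jm k (later k cs)}
      (commute-sumL (later m ms) (λ c → transL ⟨ m , c ⟩) (jm k (later k cs)) comm)
      (youngL-commute k cs k∉ u ms (⊆ ∘ there))
    where
    comm : ∀ {c} → c ∈ later m ms → Commute (transL ⟨ m , c ⟩) (jm k (later k cs))
    comm {c} c∈ = jm-commute ⟨ m , c ⟩ k (later k cs) (applyT-other (∉⇒≢ k∉ m∈cs) (∉⇒≢ k∉ c∈cs))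
      (∑-invariant ⟨ m , c ⟩ (later k cs) (Unique.filter⁺ _ u) (λ {j} → applyT-stable {m} {c} {later k cs} (transfer m~c c∈cs) (transfer (sym m~c) m∈cs) {j}))
      where
      m∈cs = ⊆ (here refl)
      c∈cs = ⊆ (there (proj₁ (∈-filterᵇ⁻ (same P m) {ms} c∈)))
      m~c : P m ≡ P c
      m~c = same⇒≡ P (proj₂ (∈-filterᵇ⁻ (same P m) {ms} c∈))
      transfer : ∀ {a b} → P a ≡ P b → b ∈ cs → a ∈ later k cs → b ∈ later k cs
      transfer e b∈ a∈ = ∈-filterᵇ⁺ (same P k) b∈ (≡⇒same P (trans (same⇒≡ P (proj₂ (∈-filterᵇ⁻ (same P k) {cs} a∈))) e))

  youngL-splits : ∀ cs → Unique cs → Splits (triangle (length cs)) (youngL cs)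
  youngL-splits []       _ = 0ℤ ∷ [] , z≤n ∷ [] , λ v i → ℤP.*-zeroˡ (v i)
  youngL-splits (c ∷ cs) (c∉ ∷ u) = splits-+ (jm c (later c cs)) (youngL cs)
    (commute-sym {A = youngL cs} {jm c (later c cs)} (youngL-commute c cs c∉ u cs id))
    (splits-weaken {A = jm c (later c cs)} (ListP.length-filter (𝔹.T? ∘ same P c) cs)
      (jm-splits c (later c cs) (All.filter⁺ _ c∉) (Unique.filter⁺ _ u)))
    (youngL-splits cs u)

  blockT : Transp d → Bool
  blockT t = same P (Transp.fst t) (Transp.snd t)

  ordered : Transp d → Bool
  ordered t = toℕ (Transp.fst t) ℕ.<ᵇ toℕ (Transp.snd t)

  pairsSum : List (Fin d) → (Transp d → ℤ) → ℤ
  pairsSum []       F = 0ℤ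
  pairsSum (c ∷ cs) F = ∑ (later c cs) (λ j → F ⟨ c , j ⟩) + pairsSum cs F

  youngL-pairs : ∀ cs v i → (youngL cs $ v) i ≡ pairsSum cs (λ t → v (act (applyT t) i))
  youngL-pairs []       v i = refl
  youngL-pairs (c ∷ cs) v i = cong ((jm c (later c cs) $ v) i +_) (youngL-pairs cs v i)

  private
    term : (Transp d → ℤ) → Fin d → Fin d → ℤ
    term F i j = if toℕ i ℕ.<ᵇ toℕ j then (if same P i j then F ⟨ i , j ⟩ else 0ℤ) else 0ℤ

    term-< : ∀ F {i j} → i F.< j → term F i j ≡ (if same P i j then F ⟨ i , j ⟩ else 0ℤ)
    term-< F {i} {j} h rewrite T⇒≡ (ℕP.<⇒<ᵇ h) = refl

    term-≮ : ∀ F {i j} → ¬ i F.< j → term F i j ≡ 0ℤ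
    term-≮ F {i} {j} h with toℕ i ℕ.<ᵇ toℕ j in eq
    ... | true  = ⊥-elim (h (ℕP.<ᵇ⇒< (toℕ i) (toℕ j) (≡⇒T eq)))
    ... | false = refl

  pairsSum-sorted : ∀ cs F → AllPairs F._<_ cs → pairsSum cs F ≡ ∑ cs (λ i → ∑ cs (term F i))
  pairsSum-sorted []       F _        = refl
  pairsSum-sorted (c ∷ cs) F (c< ∷ s) = cong₂ _+_
    (trans (∑-filter (same P c) cs (λ j → F ⟨ c , j ⟩)) (trans (∑-cong-∈ cs (λ {j} j∈ → sym (term-< F {c} {j} (All.lookup c< j∈))))
      (trans (sym (ℤP.+-identityˡ _)) (cong (_+ ∑ cs (term F c)) (sym (term-≮ F {c} {c} (ℕP.<-irrefl refl)))))))
    (trans (pairsSum-sorted cs F s) (∑-cong-∈ cs (λ {i} i∈ → trans (sym (ℤP.+-identityˡ _))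
      (cong (_+ ∑ cs (term F i)) (sym (term-≮ F {i} {c} (ℕP.<-asym (All.lookup c< i∈))))))))

  youngSum : Lin Maps Maps
  youngSum = sumL (filterᵇ blockT (allTransp d)) transL

  -- Because `allFin` is increasing, the pairs with i < j are the pairs in which j comes later than
  -- i.
  youngSum≗youngL : ∀ v → youngSum $ v ≗ youngL (allFin d) $ v
  youngSum≗youngL v i = begin
    ∑ (filterᵇ blockT (filterᵇ ordered pairs)) F
      ≡⟨ trans (∑-filter blockT (filterᵇ ordered pairs) F) (∑-filter ordered pairs _) ⟩
    ∑ pairs G
      ≡⟨ trans (∑-concatMap (λ a → map (λ b → ⟨ a , b ⟩) (allFin d)) (allFin d) G)
               (∑-cong (allFin d) (λ a → ∑-map (λ b → ⟨ a , b ⟩) (allFin d) G)) ⟩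
    ∑ (allFin d) (λ a → ∑ (allFin d) (term F a))
      ≡⟨ sym (pairsSum-sorted (allFin d) F (AllPairs.tabulate⁺-< id)) ⟩
    pairsSum (allFin d) F
      ≡⟨ sym (youngL-pairs (allFin d) v i) ⟩
    (youngL (allFin d) $ v) i ∎
    where
    open ≡-Reasoning
    pairs = concatMap (λ a → map (λ b → ⟨ a , b ⟩) (allFin d)) (allFin d)
    F : Transp d → ℤ
    F t = v (act (applyT t) i)
    G : Transp d → ℤ
    G t = if ordered t then (if blockT t then F t else 0ℤ) else 0ℤ

  kill-cong : {X : Set} (as : List ℤ) (A B : Lin X X) → (∀ v → A $ v ≗ B $ v) → ∀ v → kill as A $ v ≗ kill as B $ v
  kill-cong []       A B h v i = refl
  kill-cong (a ∷ as) A B h v i = cong₂ (λ p q → p + (- a) * q)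
    (trans (h (kill as A $ v) i) ($-cong B (kill-cong as A B h v) i)) (kill-cong as A B h v i)

  youngSum-splits : Splits (d C 2) youngSum
  youngSum-splits with youngL-splits (allFin d) (Unique.allFin⁺ d)
  ... | as , h , k = as ,
    subst (λ b → All (λ a → ∣ a ∣ ≤ b) as) (trans (cong triangle (ListP.length-tabulate {n = d} id)) (triangle≡C2 d)) h ,
    λ v i → trans (kill-cong as youngSum (youngL (allFin d)) youngSum≗youngL v i) (k v i)

-- The trace formula and inclusion–exclusion for transitivity

exponential-− : ∀ {b f g} → Exponential b f → Exponential b g → Exponential b (λ r → f r - g r)
exponential-− {b} (cs , hc , ec) (es , he , ee) =
  cs ++ map negate es , All.++⁺ hc (All.map⁺ (All.map id he)) ,
  λ r → trans (cong₂ _-_ (ec r) (ee r)) (sym (trans (∑-++ cs (map negate es) _)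
    (cong (∑ cs _ +_) (trans (∑-map negate es _)
      (trans (∑-cong es (λ cm → sym (ℤP.neg-distribˡ-* (proj₁ cm) (proj₂ cm ^ℤ r)))) (∑-neg es (λ cm → proj₁ cm * proj₂ cm ^ℤ r)))))))
  where
  negate : ℤ × ℤ → ℤ × ℤ
  negate (c , m) = - c , m

exponential-cong : ∀ {b f g} → f ≗ g → Exponential b f → Exponential b g
exponential-cong h (cs , hc , ec) = cs , hc , λ r → trans (sym (h r)) (ec r)

∑-tuples-suc : {A : Set} (r : ℕ) (xs : List A) (F : List A → ℤ) →
  ∑ (tuples (suc r) xs) F ≡ ∑ xs (λ x → ∑ (tuples r xs) (λ ts → F (x ∷ ts)))
∑-tuples-suc r xs F = trans (∑-concatMap (λ x → map (x ∷_) (tuples r xs)) xs F)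
  (∑-cong xs (λ x → ∑-map (x ∷_) (tuples r xs) F))

if-∧ : ∀ a b (z : ℤ) → (if a ∧ b then z else 0ℤ) ≡ (if a then (if b then z else 0ℤ) else 0ℤ)
if-∧ true  b z = refl
if-∧ false b z = refl

∑-tuples-filter : {A : Set} (p : A → Bool) (r : ℕ) (xs : List A) (F : List A → ℤ) →
  ∑ (tuples r (filterᵇ p xs)) F ≡ ∑ (tuples r xs) (λ ts → if all p ts then F ts else 0ℤ)
∑-tuples-filter p zero    xs F = refl
∑-tuples-filter p (suc r) xs F = begin
  ∑ (tuples (suc r) (filterᵇ p xs)) F
    ≡⟨ ∑-tuples-suc r (filterᵇ p xs) F ⟩
  ∑ (filterᵇ p xs) (λ x → ∑ (tuples r (filterᵇ p xs)) (λ ts → F (x ∷ ts)))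
    ≡⟨ ∑-cong (filterᵇ p xs) (λ x → ∑-tuples-filter p r xs (λ ts → F (x ∷ ts))) ⟩
  ∑ (filterᵇ p xs) (λ x → ∑ (tuples r xs) (λ ts → if all p ts then F (x ∷ ts) else 0ℤ))
    ≡⟨ ∑-filter p xs _ ⟩
  ∑ xs (λ x → if p x then ∑ (tuples r xs) (λ ts → if all p ts then F (x ∷ ts) else 0ℤ) else 0ℤ)
    ≡⟨ ∑-cong xs (λ x → trans (∑-if (p x) (tuples r xs) _)
         (∑-cong (tuples r xs) (λ ts → sym (if-∧ (p x) (all p ts) (F (x ∷ ts)))))) ⟩
  ∑ xs (λ x → ∑ (tuples r xs) (λ ts → if p x ∧ all p ts then F (x ∷ ts) else 0ℤ))
    ≡⟨ sym (∑-tuples-suc r xs _) ⟩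
  ∑ (tuples (suc r) xs) (λ ts → if all p ts then F ts else 0ℤ) ∎
  where open ≡-Reasoning

injective? : ∀ {m n} (f : Fin m → Fin n) → Dec (∀ x y → f x ≡ f y → x ≡ y)
injective? f = FP.all? (λ x → FP.all? (λ y → (f x ≟ f y) →-dec (x ≟ y)))

does-⇔ : {A B : Set} (a? : Dec A) (b? : Dec B) → (A → B) → (B → A) → does a? ≡ does b?
does-⇔ (yes a) b? f g = sym (dec-true b? (f a))
does-⇔ (no ¬a) b? f g = sym (dec-false b? (¬a ∘ g))

module TraceFormula (d : ℕ) (ς : Fin d → Fin d) where
  open Action d

  rightMult : Maps → Maps
  rightMult f = encode (decode f ∘ ς)

  isInjective : Maps → Bool
  isInjective f = does (injective? (decode f))

  rightMult-act : ∀ π f → rightMult (act π f) ≡ act π (rightMult f)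
  rightMult-act π f = funToFin-cong (λ x → trans (FP.finToFun-funToFin {d} {d} (π ∘ decode f) (ς x))
    (cong π (sym (FP.finToFun-funToFin {d} {d} (decode f ∘ ς) x))))

  isInjective-act : ∀ {π} → Injective _≡_ _≡_ π → ∀ f → isInjective (act π f) ≡ isInjective f
  isInjective-act {π} inj f = does-⇔ (injective? (decode (act π f))) (injective? (decode f))
    (λ h x y e → h x y (trans (dec-act x) (trans (cong π e) (sym (dec-act y)))))
    (λ h x y e → h x y (inj (trans (sym (dec-act x)) (trans e (dec-act y)))))
    where
    dec-act : decode (act π f) ≗ π ∘ decode f
    dec-act = FP.finToFun-funToFin {d} {d} (π ∘ decode f)

  -- Without the test, the trace would also count non-injective solutions f of the intertwining
  -- equation. Left composition with a permutation leaves the test unchanged, so it does not disturb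
  -- commutation with the transpositions.
  S : Lin Maps Maps
  S = record
    { _$_ = λ v f → if isInjective f then v (rightMult f) else 0ℤ
    ; $-cong = λ h f → cong (λ z → if isInjective f then z else 0ℤ) (h (rightMult f))
    ; $-⊕ = λ u v f → if-+ (isInjective f) (u (rightMult f)) (v (rightMult f))
    ; $-• = λ c u f → if-* (isInjective f) c (u (rightMult f))
    }
    where
    if-+ : ∀ b x y → (if b then x + y else 0ℤ) ≡ (if b then x else 0ℤ) + (if b then y else 0ℤ)
    if-+ true  x y = refl
    if-+ false x y = refl
    if-* : ∀ b c x → (if b then c * x else 0ℤ) ≡ c * (if b then x else 0ℤ)
    if-* true  c x = refl
    if-* false c x = sym (ℤP.*-zeroʳ c)

  transL-S : ∀ t → Commute (transL t) S
  transL-S t v f = cong₂ (λ b g → if b then v g else 0ℤ) (isInjective-act (applyT-injective t) f) (rightMult-act (applyT t) f)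

  pow-transL : ∀ (ts : List (Transp d)) r v f →
    (pow (sumL ts transL) r $ v) f ≡ ∑ (tuples r ts) (λ us → v (act (prodT us) f))
  pow-transL ts zero    v f = trans (cong v (sym (act-id f))) (sym (ℤP.+-identityʳ _))
  pow-transL ts (suc r) v f = begin
    ∑ ts (λ t → (pow (sumL ts transL) r $ v) (act (applyT t) f))
      -- `transL` reverses composition while `prodT` puts the new transposition outermost, so the
      -- new factor is first moved to the other end of the power.
      ≡⟨ pow-suc r v f ⟩
    (pow (sumL ts transL) r $ sumL ts transL $ v) f
      ≡⟨ pow-transL ts r (sumL ts transL $ v) f ⟩
    ∑ (tuples r ts) (λ us → ∑ ts (λ t → v (act (applyT t) (act (prodT us) f))))
      ≡⟨ ∑-cong (tuples r ts) (λ us → ∑-cong ts (λ t → cong v (act-∘ (applyT t) (prodT us) f))) ⟩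
    ∑ (tuples r ts) (λ us → ∑ ts (λ t → v (act (prodT (t ∷ us)) f)))
      ≡⟨ ∑-swap (tuples r ts) ts _ ⟩
    ∑ ts (λ t → ∑ (tuples r ts) (λ us → v (act (prodT (t ∷ us)) f)))
      ≡⟨ sym (∑-tuples-suc r ts _) ⟩
    ∑ (tuples (suc r) ts) (λ us → v (act (prodT us) f)) ∎
    where
    open ≡-Reasoning
    A = sumL ts transL
    pow-suc : ∀ r v → A $ pow A r $ v ≗ pow A r $ A $ v
    pow-suc zero    v i = refl
    pow-suc (suc r) v i = $-cong A (pow-suc r v) i

  -- The contribution of one tuple to the diagonal: with τ its product, the number of injective f
  -- such that f = τ f ς.
  weight : List (Transp d) → ℤ
  weight ts = ∑ (allFin (d ℕ.^ d)) (λ f → (S $ δ f) (act (prodT ts) f))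

  trace-formula : ∀ ts r → tr (pow (sumL ts transL) r ∘L S) ≡ ∑ (tuples r ts) weight
  trace-formula ts r = trans (∑-cong (allFin (d ℕ.^ d)) (λ f → pow-transL ts r (S $ δ f) f))
    (∑-swap (allFin (d ℕ.^ d)) (tuples r ts) _)

  young-exponential : ∀ P → Exponential (d C 2)
    (λ r → ∑ (tuples r (allTransp d)) (λ ts → if all (Young.blockT d P) ts then weight ts else 0ℤ))
  young-exponential P with Young.youngSum-splits d P
  ... | as , h , k = exponential-cong
    (λ r → trans (trace-formula (filterᵇ (blockT) (allTransp d)) r) (∑-tuples-filter blockT r (allTransp d) weight))
    (trace-exponential as h youngSum S (commute-sumL (filterᵇ blockT (allTransp d)) transL S (λ {t} _ → transL-S t)) k)
    where open Young d P

-- Preserved subsets and inclusion-exclusion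

_⇔ᵇ_ : Bool → Bool → Bool
a ⇔ᵇ b = does (a 𝔹.≟ b)

preserves : ∀ {d} → (Fin d → Bool) → List (Transp d) → Bool
preserves U = all (λ t → U (Transp.fst t) ⇔ᵇ U (Transp.snd t))

refine : ∀ {d} → (Fin d → Bool) → Colouring d → Colouring d
refine U P x = U x ∷ P x

blockT-refine : ∀ {d} U P (t : Transp d) →
  Young.blockT d (refine U P) t ≡ Young.blockT d P t ∧ (U (Transp.fst t) ⇔ᵇ U (Transp.snd t))
blockT-refine U P t = ∧-comm (U (Transp.fst t) ⇔ᵇ U (Transp.snd t)) _

all-∧ : {A : Set} {p q s : A → Bool} → (∀ x → p x ≡ q x ∧ s x) → ∀ xs → all p xs ≡ all q xs ∧ all s xs
all-∧ h []       = refl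
all-∧ {p = p} {q} {s} h (x ∷ xs) rewrite h x | all-∧ {p = p} {q} {s} h xs = lemma (q x) (s x) (all q xs) (all s xs)
  where lemma : ∀ a b c d → (a ∧ b) ∧ c ∧ d ≡ (a ∧ c) ∧ b ∧ d
        lemma true  true  c d = refl
        lemma true  false true  d = refl
        lemma true  false false d = refl
        lemma false b c d = refl

module InclusionExclusion (d : ℕ) (K : List (Transp d) → ℤ) where

  breaksAll : List (Fin d → Bool) → List (Transp d) → Bool
  breaksAll Us ts = all (λ U → not (preserves U ts)) Us

  module _ {b} (young : ∀ P → Exponential b
      (λ r → ∑ (tuples r (allTransp d)) (λ ts → if all (Young.blockT d P) ts then K ts else 0ℤ))) where

    -- 1 − [ts preserves U] is a difference of block indicators, for P and for P refined by U.
    breaksAll-exponential : ∀ Us P → Exponential b (λ r → ∑ (tuples r (allTransp d))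
      (λ ts → if all (Young.blockT d P) ts ∧ breaksAll Us ts then K ts else 0ℤ))
    breaksAll-exponential []       P = exponential-cong
      (λ r → ∑-cong (tuples r (allTransp d)) (λ ts → cong (λ c → if c then K ts else 0ℤ) (sym (∧-true (all (Young.blockT d P) ts)))))
      (young P)
      where ∧-true : ∀ a → a ∧ true ≡ a
            ∧-true true  = refl
            ∧-true false = refl
    breaksAll-exponential (U ∷ Us) P = exponential-cong
      (λ r → trans (cong (_+_ (∑ (tuples r (allTransp d)) F)) (sym (∑-neg (tuples r (allTransp d)) G)))
        (trans (sym (∑-+ (tuples r (allTransp d)) F (λ ts → - G ts))) (∑-cong (tuples r (allTransp d)) pointwise)))
      (exponential-− (breaksAll-exponential Us P) (breaksAll-exponential Us (refine U P)))
      where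
      F G : List (Transp d) → ℤ
      F ts = if all (Young.blockT d P) ts ∧ breaksAll Us ts then K ts else 0ℤ
      G ts = if all (Young.blockT d (refine U P)) ts ∧ breaksAll Us ts then K ts else 0ℤ
      cases : ∀ a p n z → (if a ∧ n then z else 0ℤ) - (if (a ∧ p) ∧ n then z else 0ℤ) ≡ (if a ∧ not p ∧ n then z else 0ℤ)
      cases true  true  true  z = ℤP.+-inverseʳ z
      cases true  true  false z = refl
      cases true  false true  z = ℤP.+-identityʳ z
      cases true  false false z = refl
      cases false p     n     z = refl
      pointwise : ∀ ts → F ts - G ts ≡ (if all (Young.blockT d P) ts ∧ breaksAll (U ∷ Us) ts then K ts else 0ℤ)
      pointwise ts rewrite all-∧ {p = Young.blockT d (refine U P)} {Young.blockT d P} {λ t → U (Transp.fst t) ⇔ᵇ U (Transp.snd t)}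
                                 (blockT-refine U P) ts =
        cases (all (Young.blockT d P) ts) (preserves U ts) (breaksAll Us ts) (K ts)

∧-elim : ∀ {a b} → a ∧ b ≡ true → a ≡ true × b ≡ true
∧-elim {true} h = refl , h

∧-intro : ∀ {a b} → a ≡ true → b ≡ true → a ∧ b ≡ true
∧-intro refl h = h

module _ {A : Set} (p : A → Bool) where

  all-elim : ∀ xs {x} → all p xs ≡ true → x ∈ xs → p x ≡ true
  all-elim (x ∷ xs) h (here refl) = proj₁ (∧-elim h)
  all-elim (x ∷ xs) h (there i)   = all-elim xs (proj₂ (∧-elim {p x} h)) i

  all-intro : ∀ xs → (∀ {x} → x ∈ xs → p x ≡ true) → all p xs ≡ true
  all-intro []       h = refl
  all-intro (x ∷ xs) h = ∧-intro (h (here refl)) (all-intro xs (h ∘ there))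

  all-false : ∀ xs → all p xs ≡ false → ∃ λ x → x ∈ xs × p x ≡ false
  all-false (x ∷ xs) h with p x in eq
  ... | false = x , here refl , eq
  ... | true  = let y , y∈ , e = all-false xs h in y , there y∈ , e

  any-elim : ∀ xs → any p xs ≡ true → ∃ λ x → x ∈ xs × p x ≡ true
  any-elim (x ∷ xs) h with p x in eq
  ... | true  = x , here refl , eq
  ... | false = let y , y∈ , e = any-elim xs h in y , there y∈ , e

  any-intro : ∀ xs {x} → x ∈ xs → p x ≡ true → any p xs ≡ true
  any-intro (x ∷ xs) (here refl) e rewrite e = refl
  any-intro (x ∷ xs) (there i)   e with p x
  ... | true  = refl
  ... | false = any-intro xs i e

⇔ᵇ-elim : ∀ {a b} → a ⇔ᵇ b ≡ true → a ≡ b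
⇔ᵇ-elim {true}  {true}  _ = refl
⇔ᵇ-elim {false} {false} _ = refl

⇔ᵇ-intro : ∀ {a b} → a ≡ b → a ⇔ᵇ b ≡ true
⇔ᵇ-intro {true}  refl = refl
⇔ᵇ-intro {false} refl = refl

countᵇ-mono : {A : Set} {p q : A → Bool} → (∀ x → p x ≡ true → q x ≡ true) → ∀ xs → countᵇ p xs ≤ countᵇ q xs
countᵇ-mono h [] = z≤n
countᵇ-mono {p = p} {q} h (x ∷ xs) with p x in e | q x in e′
... | true  | true  = s≤s (countᵇ-mono h xs)
... | true  | false with () ← trans (sym e′) (h x e)
... | false | true  = ℕP.m≤n⇒m≤1+n (countᵇ-mono h xs)
... | false | false = countᵇ-mono h xs

countᵇ-strict : {A : Set} {p q : A → Bool} → (∀ x → p x ≡ true → q x ≡ true) →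
  ∀ {x xs} → x ∈ xs → p x ≡ false → q x ≡ true → countᵇ p xs < countᵇ q xs
countᵇ-strict {p = p} {q} h {xs = x ∷ xs} (here refl) e e′ rewrite e | e′ = s≤s (countᵇ-mono h xs)
countᵇ-strict {p = p} {q} h {xs = x ∷ xs} (there i)   e e′ with p x in f | q x in f′
... | true  | true  = s≤s (countᵇ-strict h i e e′)
... | true  | false with () ← trans (sym f′) (h x f)
... | false | true  = ℕP.m≤n⇒m≤1+n (countᵇ-strict h i e e′)
... | false | false = countᵇ-strict h i e e′

module Transitivity {d : ℕ} (ts : List (Transp d)) where

  preserves-applyT : ∀ U → preserves U ts ≡ true → ∀ {t} → t ∈ ts → ∀ y → U (applyT t y) ≡ U y
  preserves-applyT U h {⟨ i , j ⟩} t∈ y with transpCase i j y | ⇔ᵇ-elim {U i} {U j} (all-elim (λ t → U (Transp.fst t) ⇔ᵇ U (Transp.snd t)) ts h t∈)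
  ... | is-fst refl e | Ui≡Uj = trans (cong U e) (sym Ui≡Uj)
  ... | is-snd refl e | Ui≡Uj = trans (cong U e) Ui≡Uj
  ... | other _ _ e   | _     = cong U e

  orbitAt : ℕ → Fin d → Fin d → Bool
  orbitAt k x = iter k (orbitStep ts) (λ y → y == x)

  orbitStep-elim : ∀ S y → orbitStep ts S y ≡ true → S y ≡ true ⊎ ∃ λ t → t ∈ ts × S (applyT t y) ≡ true
  orbitStep-elim S y h with S y
  ... | true  = inj₁ refl
  ... | false = inj₂ (any-elim (λ t → S (applyT t y)) ts h)

  orbitStep-⊇ : ∀ S y → S y ≡ true → orbitStep ts S y ≡ true
  orbitStep-⊇ S y h rewrite h = refl

  orbitStep-applyT : ∀ S {t} y → t ∈ ts → S (applyT t y) ≡ true → orbitStep ts S y ≡ true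
  orbitStep-applyT S y t∈ h with S y
  ... | true  = refl
  ... | false = any-intro (λ t → S (applyT t y)) ts t∈ h

  orbit-preserved : ∀ U → preserves U ts ≡ true → ∀ k {x y} → orbitAt k x y ≡ true → U y ≡ U x
  orbit-preserved U h zero    {x} {y} e = cong U (==⇒≡ e)
  orbit-preserved U h (suc k) {x} {y} e with orbitStep-elim (orbitAt k x) y e
  ... | inj₁ e′ = orbit-preserved U h k e′
  ... | inj₂ (t , t∈ , e′) = trans (sym (preserves-applyT U h t∈ y)) (orbit-preserved U h k e′)

  Stable : ℕ → Fin d → Set
  Stable k x = ∀ y → orbitAt (suc k) x y ≡ orbitAt k x y

  orbitStep-cong : ∀ {S S′} → S ≗ S′ → orbitStep ts S ≗ orbitStep ts S′
  orbitStep-cong {S} {S′} h y = cong₂ _∨_ (h y) (go ts)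
    where go : ∀ us → any (λ t → S (applyT t y)) us ≡ any (λ t → S′ (applyT t y)) us
          go []       = refl
          go (u ∷ us) = cong₂ _∨_ (h (applyT u y)) (go us)

  size : ℕ → Fin d → ℕ
  size k x = countᵇ (orbitAt k x) (allFin d)

  -- Each closure step that changes the set adds a point, and a step without change is followed by
  -- no further change. At k = d the second alternative would require d + 1 points, so d steps
  -- suffice.
  stable-or-large : ∀ k x → Stable k x ⊎ suc k ≤ size k x
  stable-or-large zero    x = inj₂ (subst (_< size 0 x) (countᵇ-false (allFin d))
    (countᵇ-strict {p = λ _ → false} (λ _ ()) (∈-allFin x) refl (≡⇒== {x = x} refl)))
    where countᵇ-false : ∀ (xs : List (Fin d)) → countᵇ (λ _ → false) xs ≡ 0
          countᵇ-false []       = refl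
          countᵇ-false (x ∷ xs) = countᵇ-false xs
  stable-or-large (suc k) x with stable-or-large k x
  ... | inj₁ s = inj₁ (orbitStep-cong s)
  ... | inj₂ l with FP.all? (λ y → orbitAt (suc k) x y 𝔹.≟ orbitAt k x y)
  ...   | yes s = inj₁ (orbitStep-cong s)
  ...   | no ¬s = let y , ne = FP.¬∀⟶∃¬ d _ (λ y → orbitAt (suc k) x y 𝔹.≟ orbitAt k x y) ¬s
                      new , old = grown y ne
                  in inj₂ (ℕP.≤-<-trans l (countᵇ-strict (orbitStep-⊇ (orbitAt k x)) (∈-allFin y) old new))
    where
    grown : ∀ y → ¬ orbitAt (suc k) x y ≡ orbitAt k x y → orbitAt (suc k) x y ≡ true × orbitAt k x y ≡ false
    grown y ne with orbitAt k x y | orbitAt (suc k) x y | orbitStep-⊇ (orbitAt k x) y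
    ... | true  | true  | _ = ⊥-elim (ne refl)
    ... | true  | false | f = ⊥-elim (ne (f refl))
    ... | false | true  | _ = refl , refl
    ... | false | false | _ = ⊥-elim (ne refl)

  stable : ∀ x → Stable d x
  stable x with stable-or-large d x
  ... | inj₁ s = s
  ... | inj₂ l = ⊥-elim (ℕP.<-irrefl refl (ℕP.≤-trans l
         (subst (size d x ≤_) (ListP.length-tabulate {n = d} id) (ListP.length-filter (𝔹.T? ∘ orbitAt d x) (allFin d)))))

  orbit-refl : ∀ k x → orbitAt k x x ≡ true
  orbit-refl zero    x = ≡⇒== {x = x} refl
  orbit-refl (suc k) x = orbitStep-⊇ (orbitAt k x) x (orbit-refl k x)

  -- Stability makes the orbit closed under every generator, and a transposition exchanges its two
  -- ends, so they are both inside or both outside.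
  preserves-orbit : ∀ x → preserves (inOrbit ts x) ts ≡ true
  preserves-orbit x = all-intro (λ t → inOrbit ts x (Transp.fst t) ⇔ᵇ inOrbit ts x (Transp.snd t)) ts (λ {t} t∈ → ⇔ᵇ-intro (equal t t∈))
    where
    closed : ∀ {t} → t ∈ ts → ∀ y → inOrbit ts x (applyT t y) ≡ true → inOrbit ts x y ≡ true
    closed t∈ y h = trans (sym (stable x y)) (orbitStep-applyT (inOrbit ts x) y t∈ h)
    equal : ∀ t → t ∈ ts → inOrbit ts x (Transp.fst t) ≡ inOrbit ts x (Transp.snd t)
    equal ⟨ i , j ⟩ t∈ with inOrbit ts x i in ei | inOrbit ts x j in ej
    ... | true  | true  = refl
    ... | false | false = refl
    ... | true  | false with () ← trans (sym ej) (closed t∈ j (trans (cong (inOrbit ts x) (applyT-snd i j)) ei))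
    ... | false | true  with () ← trans (sym ei) (closed t∈ i (trans (cong (inOrbit ts x) (applyT-fst i j)) ej))

  transitive-elim : isTransitive ts ≡ true → ∀ x y → inOrbit ts x y ≡ true
  transitive-elim h x y = all-elim (inOrbit ts x) (allFin d) (all-elim (λ x → all (inOrbit ts x) (allFin d)) (allFin d) h (∈-allFin x)) (∈-allFin y)

  intransitive-elim : isTransitive ts ≡ false → ∃ λ x → ∃ λ y → inOrbit ts x y ≡ false
  intransitive-elim h with all-false (λ x → all (inOrbit ts x) (allFin d)) (allFin d) h
  ... | x , _ , h′ with all-false (inOrbit ts x) (allFin d) h′
  ...   | y , _ , h″ = x , y , h″

isProper : ∀ {d} → (Fin d → Bool) → Bool
isProper {d} U = any U (allFin d) ∧ any (not ∘ U) (allFin d)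

allSubsets : ∀ d → List (Fin d → Bool)
allSubsets d = map (λ i x → does (finToFun {2} {d} i x ≟ zero)) (allFin (2 ℕ.^ d))

-- Subsets are Boolean functions, so the one in the list is found up to pointwise equality;
-- `preserves-cong` carries preservation across.
allSubsets-complete : ∀ {d} (U : Fin d → Bool) → ∃ λ U′ → U′ ∈ allSubsets d × U′ ≗ U
allSubsets-complete {d} U = _ , ∈-map⁺ _ (∈-allFin (funToFin {d} {2} code)) ,
  λ x → trans (cong (λ b → does (b ≟ zero)) (FP.finToFun-funToFin {d} {2} code x)) (decode-code (U x))
  where
  bit : Bool → Fin 2
  bit true  = zero
  bit false = suc zero
  code : Fin d → Fin 2
  code = bit ∘ U
  decode-code : ∀ b → does (bit b ≟ zero) ≡ b
  decode-code true  = refl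
  decode-code false = refl

properSubsets : ∀ d → List (Fin d → Bool)
properSubsets d = filterᵇ isProper (allSubsets d)

preserves-cong : ∀ {d} {U U′ : Fin d → Bool} → U ≗ U′ → ∀ ts → preserves U ts ≡ preserves U′ ts
preserves-cong h []       = refl
preserves-cong h (⟨ i , j ⟩ ∷ ts) rewrite h i | h j | preserves-cong h ts = refl

-- A preserved subset containing x but not y cannot contain the orbit of x, which is everything in
-- the transitive case. Conversely, if the orbit of x misses y, this orbit is itself a proper
-- nonempty preserved subset.
transitive≡breaksAll : ∀ {d} (ts : List (Transp d)) K → isTransitive ts ≡ InclusionExclusion.breaksAll d K (properSubsets d) ts
transitive≡breaksAll {d} ts K with isTransitive ts in eq
... | true  = sym (all-intro (λ U → not (preserves U ts)) (properSubsets d) (λ {U} U∈ → broken U (proj₂ (∈-filterᵇ⁻ isProper {allSubsets d} U∈))))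
  where
  open Transitivity ts
  broken : ∀ U → isProper U ≡ true → not (preserves U ts) ≡ true
  broken U proper with preserves U ts in e | ∧-elim proper
  ... | false | _ = refl
  ... | true  | p , q with any-elim U (allFin d) p | any-elim (not ∘ U) (allFin d) q
  ...   | x , _ , Ux | y , _ , ¬Uy with U y | orbit-preserved U e d (transitive-elim eq x y)
  ...     | false | Uy with () ← trans Uy Ux
... | false = sym (notTrue (λ h → absurd h))
  where
  open Transitivity ts
  notTrue : ∀ {b} → ¬ b ≡ true → b ≡ false
  notTrue {true}  h = ⊥-elim (h refl)
  notTrue {false} h = refl
  x = proj₁ (intransitive-elim eq)
  y = proj₁ (proj₂ (intransitive-elim eq))
  y∉ = proj₂ (proj₂ (intransitive-elim eq))
  absurd : InclusionExclusion.breaksAll d K (properSubsets d) ts ≡ true → ⊥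
  absurd h with allSubsets-complete (inOrbit ts x)
  ... | U , U∈ , U≗ = false≢true (trans (cong not (sym (trans (preserves-cong U≗ ts) (preserves-orbit x))))
      (all-elim (λ U → not (preserves U ts)) (properSubsets d) h (∈-filterᵇ⁺ isProper U∈ proper)))
    where
    false≢true : ¬ false ≡ true
    false≢true ()
    proper : isProper U ≡ true
    proper = ∧-intro (any-intro U (allFin d) (∈-allFin x) (trans (U≗ x) (orbit-refl d x)))
                     (any-intro (not ∘ U) (allFin d) (∈-allFin y) (cong not (trans (U≗ y) y∉)))

transitive-exponential : ∀ d (ς : Fin d → Fin d) → Exponential (d C 2)
  (λ r → ∑ (tuples r (allTransp d)) (λ ts → if isTransitive ts then TraceFormula.weight d ς ts else 0ℤ))
transitive-exponential d ς = exponential-cong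
  (λ r → ∑-cong (tuples r (allTransp d)) (λ ts → cong (λ b → if b then weight ts else 0ℤ)
    -- The expansion starts from the partition with one block, inside which every tuple lies.
    (trans (cong (_∧ breaksAll (properSubsets d) ts) (all-intro (Young.blockT d (λ _ → [])) ts (λ _ → refl))) (sym (transitive≡breaksAll ts weight)))))
  (breaksAll-exponential young-exponential (properSubsets d) (λ _ → []))
  where
  open TraceFormula d ς
  open InclusionExclusion d weight

-- Cycles of permutations

iter-+ : {A : Set} (f : A → A) (m n : ℕ) (x : A) → iter (m ℕ.+ n) f x ≡ iter m f (iter n f x)
iter-+ f zero    n x = refl
iter-+ f (suc m) n x = cong f (iter-+ f m n x)

iter-comm : {A : Set} (f : A → A) (m n : ℕ) (x : A) → iter m f (iter n f x) ≡ iter n f (iter m f x)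
iter-comm f m n x = trans (sym (iter-+ f m n x)) (trans (cong (λ k → iter k f x) (ℕP.+-comm m n)) (iter-+ f n m x))

iter-* : {A : Set} (f : A → A) (q m : ℕ) (x : A) → iter m f x ≡ x → iter (q ℕ.* m) f x ≡ x
iter-* f zero    m x h = refl
iter-* f (suc q) m x h = trans (iter-+ f m (q ℕ.* m) x) (trans (cong (iter m f) (iter-* f q m x h)) h)

iter-injective : {A : Set} {f : A → A} → Injective _≡_ _≡_ f → ∀ k → Injective _≡_ _≡_ (iter k f)
iter-injective inj zero    e = e
iter-injective inj (suc k) e = iter-injective inj k (inj e)

iter-intertwine : {A B : Set} {σ : A → A} {τ : B → B} (f : A → B) → τ ∘ f ≗ f ∘ σ → ∀ k → iter k τ ∘ f ≗ f ∘ iter k σ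
iter-intertwine         f h zero    x = refl
iter-intertwine {σ = σ} {τ} f h (suc k) x = trans (cong τ (iter-intertwine f h k x)) (h (iter k σ x))

-- `orbitSearch` is the where-bound search loop of `orbitLen`; it has no name outside Defs,
-- so unification has to produce it, which needs its arguments generalised to distinct variables.
mutual
  orbitSearch : ∀ {d} → (Fin d → Fin d) → Fin d → ℕ → ℕ → ℕ
  orbitSearch = _

  orbitLen-unfold : ∀ {d} (σ : Fin (suc d) → Fin (suc d)) (x : Fin (suc d)) →
    orbitLen σ x ≡ (if iter 1 σ x == x then 1 else orbitSearch σ x d 2)
  orbitLen-unfold {d} σ x with suc d | 2
  ... | _ | _ = refl

orbitSearch-cong : ∀ {d e} {σ : Fin d → Fin d} {τ : Fin e → Fin e} {x y} →
  (∀ k → (iter k σ x == x) ≡ (iter k τ y == y)) → ∀ f k → orbitSearch σ x f k ≡ orbitSearch τ y f k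
orbitSearch-cong h zero    k = refl
orbitSearch-cong {σ = σ} {τ} {x} {y} h (suc f) k rewrite h k | orbitSearch-cong {σ = σ} {τ} {x} {y} h f (suc k) = refl

-- The return at m lies within the range that the search examines, so it stops at a genuine first
-- return instead of by running out of fuel.
orbitSearch-hit : ∀ {d} (σ : Fin d → Fin d) x f k {m} → k ≤ m → m < k ℕ.+ f → iter m σ x ≡ x →
  let ℓ = orbitSearch σ x f k in k ≤ ℓ × iter ℓ σ x ≡ x × (∀ j → k ≤ j → j < ℓ → ¬ iter j σ x ≡ x)
orbitSearch-hit σ x zero k k≤m m<k e = ⊥-elim (ℕP.<-irrefl refl (ℕP.≤-<-trans k≤m (subst (_ <_) (ℕP.+-identityʳ k) m<k)))
orbitSearch-hit σ x (suc f) k {m} k≤m m<k e with iter k σ x == x in eq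
... | true  = ℕP.≤-refl , ==⇒≡ eq , λ j k≤j j<k → ⊥-elim (ℕP.<-irrefl refl (ℕP.≤-<-trans k≤j j<k))
... | false with orbitSearch-hit σ x f (suc k) (ℕP.≤∧≢⇒< k≤m k≢m) (subst (m <_) (ℕP.+-suc k f) m<k) e
  where k≢m : ¬ k ≡ m
        k≢m refl with () ← trans (sym eq) (≡⇒== e)
...   | k<ℓ , hit , miss = ℕP.<⇒≤ k<ℓ , hit , λ j k≤j j<ℓ → miss′ j k≤j j<ℓ (ℕP.m≤n⇒m<n∨m≡n k≤j)
  where
  miss′ : ∀ j → k ≤ j → j < orbitSearch σ x f (suc k) → k < j ⊎ k ≡ j → ¬ iter j σ x ≡ x
  miss′ j k≤j j<ℓ (inj₁ k<j)  = miss j k<j j<ℓ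
  miss′ j k≤j j<ℓ (inj₂ refl) e′ with () ← trans (sym eq) (≡⇒== e′)

module Orbits {d : ℕ} (σ : Fin d → Fin d) (inj : Injective _≡_ _≡_ σ) where

  iter-∸ : ∀ x {a b} → a ≤ b → iter a σ x ≡ iter b σ x → iter (b ℕ.∸ a) σ x ≡ x
  iter-∸ x {a} {b} a≤b e = iter-injective inj a (trans (sym (iter-+ σ a (b ℕ.∸ a) x))
    (trans (cong (λ k → iter k σ x) (ℕP.m+[n∸m]≡n a≤b)) (sym e)))

  -- Among the d + 1 points x, σ x, ..., σᵈ x two coincide, and injectivity cancels the common
  -- initial iterates.
  returns : ∀ x → ∃ λ m → 1 ≤ m × m ≤ d × iter m σ x ≡ x
  returns x with FP.pigeonhole (ℕP.n<1+n d) (λ (i : Fin (suc d)) → iter (toℕ i) σ x)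
  ... | i , j , i<j , e = toℕ j ℕ.∸ toℕ i , ℕP.m<n⇒0<n∸m i<j ,
    ℕP.≤-trans (ℕP.m∸n≤m (toℕ j) (toℕ i)) (ℕ.s≤s⁻¹ (FP.toℕ<n j)) , iter-∸ x (ℕP.<⇒≤ i<j) e

  ℓ : Fin d → ℕ
  ℓ = orbitLen σ

  private
    hit : ∀ x → 1 ≤ ℓ x × iter (ℓ x) σ x ≡ x × (∀ j → 1 ≤ j → j < ℓ x → ¬ iter j σ x ≡ x)
    hit x with returns x
    ... | m , 1≤m , m≤d , e = orbitSearch-hit σ x d 1 1≤m (s≤s m≤d) e

  ℓ-positive : ∀ x → 1 ≤ ℓ x
  ℓ-positive x = proj₁ (hit x)

  ℓ-returns : ∀ x → iter (ℓ x) σ x ≡ x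
  ℓ-returns x = proj₁ (proj₂ (hit x))

  ℓ-minimal : ∀ x j → j < ℓ x → iter j σ x ≡ x → j ≡ 0
  ℓ-minimal x zero    _ _ = refl
  ℓ-minimal x (suc j) h e = ⊥-elim (proj₂ (proj₂ (hit x)) (suc j) (s≤s z≤n) h e)

  reduce : ∀ x m → ∃ λ k → k < ℓ x × iter m σ x ≡ iter k σ x × ∃ λ q → m ≡ k ℕ.+ q ℕ.* ℓ x
  reduce x m = k , m%n<n m (ℓ x) , trans (cong (λ j → iter j σ x) eq)
      (trans (iter-+ σ k (m / ℓ x ℕ.* ℓ x) x) (cong (iter k σ) (iter-* σ (m / ℓ x) (ℓ x) x (ℓ-returns x)))) , m / ℓ x , eq
    where
    instance ℓ≢0 : ℕ.NonZero (ℓ x)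
             ℓ≢0 = ℕ.>-nonZero (ℓ-positive x)
    k  = m % ℓ x
    eq = m≡m%n+[m/n]*n m (ℓ x)

  period-divides : ∀ x m → iter m σ x ≡ x → ∃ λ q → m ≡ q ℕ.* ℓ x
  period-divides x m e with reduce x m
  ... | k , k<ℓ , e′ , q , eq with ℓ-minimal x k k<ℓ (trans (sym e′) e)
  ...   | refl = q , eq

  private
    unreduce-≤ : ∀ x {a b} → a ≤ b → b < ℓ x → iter a σ x ≡ iter b σ x → a ≡ b
    unreduce-≤ x {a} {b} a≤b b<ℓ e = ℕP.≤-antisym a≤b
      (ℕP.m∸n≡0⇒m≤n (ℓ-minimal x (b ℕ.∸ a) (ℕP.≤-<-trans (ℕP.m∸n≤m b a) b<ℓ) (iter-∸ x a≤b e)))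

  unreduce : ∀ x {a b} → a < ℓ x → b < ℓ x → iter a σ x ≡ iter b σ x → a ≡ b
  unreduce x {a} {b} a<ℓ b<ℓ e with ℕP.≤-total a b
  ... | inj₁ a≤b = unreduce-≤ x a≤b b<ℓ e
  ... | inj₂ b≤a = sym (unreduce-≤ x b≤a a<ℓ (sym e))

  inverse : Fin d → Fin d
  inverse x = iter (ℓ x ℕ.∸ 1) σ x

  σ-inverse : ∀ x → σ (inverse x) ≡ x
  σ-inverse x = trans (cong (λ k → iter k σ x) (ℕP.m+[n∸m]≡n (ℓ-positive x))) (ℓ-returns x)

  _~_ : Fin d → Fin d → Set
  x ~ y = ∃ λ k → iter k σ x ≡ y

  ~-refl : ∀ {x} → x ~ x
  ~-refl = 0 , refl

  ~-trans : ∀ {x y z} → x ~ y → y ~ z → x ~ z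
  ~-trans {x} (k , refl) (m , refl) = m ℕ.+ k , iter-+ σ m k x

  ~-sym : ∀ {x y} → x ~ y → y ~ x
  ~-sym {x} (k , refl) with reduce x k
  ... | j , j<ℓ , e , _ = ℓ x ℕ.∸ j , trans (cong (iter (ℓ x ℕ.∸ j) σ) e)
    (trans (sym (iter-+ σ (ℓ x ℕ.∸ j) j x)) (trans (cong (λ k → iter k σ x) (ℕP.m∸n+n≡m (ℕP.<⇒≤ j<ℓ))) (ℓ-returns x)))

  IsRep : Fin d → Set
  IsRep x = isCycleRep σ x ≡ true

  rep-minimal : ∀ {x y} → IsRep x → x ~ y → toℕ x ≤ toℕ y
  rep-minimal {x} h (k , refl) with reduce x k
  ... | j , j<ℓ , e , _ = subst (λ y → toℕ x ≤ toℕ y) (sym e) (ℕP.≤ᵇ⇒≤ (toℕ x) _ (≡⇒T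
      (all-elim (λ k → toℕ x ℕ.≤ᵇ toℕ (iter k σ x)) (upTo (ℓ x)) h (∈-upTo⁺ j<ℓ))))

  rep-unique : ∀ {x y} → IsRep x → IsRep y → x ~ y → x ≡ y
  rep-unique hx hy x~y = FP.toℕ-injective (ℕP.≤-antisym (rep-minimal hx x~y) (rep-minimal hy (~-sym x~y)))

  -- Descent on `toℕ x`: if x is not the least element of its cycle, the failing test exhibits a
  -- smaller element of the same cycle.
  representative : ∀ x → ∃ λ z → IsRep z × z ~ x
  representative x = <-rec (λ n → ∀ x → toℕ x ≡ n → ∃ λ z → IsRep z × z ~ x) step (toℕ x) x refl
    where
    step : ∀ n → (∀ {m} → m < n → ∀ x → toℕ x ≡ m → ∃ λ z → IsRep z × z ~ x) → ∀ x → toℕ x ≡ n → ∃ λ z → IsRep z × z ~ x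
    step n rec x refl with isCycleRep σ x in eq
    ... | true  = x , eq , ~-refl
    ... | false with all-false (λ k → toℕ x ℕ.≤ᵇ toℕ (iter k σ x)) (upTo (ℓ x)) eq
    ...   | k , _ , e with rec (ℕP.≰⇒> (λ le → contra (trans (sym e) (T⇒≡ (ℕP.≤⇒≤ᵇ le))))) (iter k σ x) refl
      where contra : ¬ false ≡ true
            contra ()
    ...     | z , hz , z~ = z , hz , ~-trans z~ (~-sym (k , refl))

  rep : Fin d → Fin d
  rep x = proj₁ (representative x)

  rep-isRep : ∀ x → IsRep (rep x)
  rep-isRep x = proj₁ (proj₂ (representative x))

  rep~ : ∀ x → rep x ~ x
  rep~ x = proj₂ (proj₂ (representative x))

  reps : List (Fin d)
  reps = filterᵇ (isCycleRep σ) (allFin d)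

  reps-unique : Unique reps
  reps-unique = Unique.filter⁺ _ (Unique.allFin⁺ d)

  ∈-reps⁺ : ∀ {x} → IsRep x → x ∈ reps
  ∈-reps⁺ {x} h = ∈-filterᵇ⁺ (isCycleRep σ) (∈-allFin x) h

  ∈-reps⁻ : ∀ {x} → x ∈ reps → IsRep x
  ∈-reps⁻ h = proj₂ (∈-filterᵇ⁻ (isCycleRep σ) {allFin d} h)

module _ {d e : ℕ} {σ : Fin d → Fin d} {τ : Fin e → Fin e} where

  ==-intertwine : (f : Fin d → Fin e) → Injective _≡_ _≡_ f → τ ∘ f ≗ f ∘ σ →
    ∀ x k → (iter k σ x == x) ≡ (iter k τ (f x) == f x)
  ==-intertwine f inj h x k with iter k σ x == x in eq
  ... | true  = sym (≡⇒== (trans (iter-intertwine f h k x) (cong f (==⇒≡ eq))))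
  ... | false = sym (≢⇒== (λ e → contra (trans (sym eq) (≡⇒== (inj (trans (sym (iter-intertwine f h k x)) e))))))
    where contra : ¬ false ≡ true
          contra ()

orbitLen-intertwine : ∀ {d} {σ τ : Fin d → Fin d} (f : Fin d → Fin d) → Injective _≡_ _≡_ f → τ ∘ f ≗ f ∘ σ →
  ∀ x → orbitLen τ (f x) ≡ orbitLen σ x
orbitLen-intertwine {d} {σ} {τ} f inj h x = sym (orbitSearch-cong {σ = σ} {τ} (==-intertwine f inj h x) d 1)

orbitLen-~ : ∀ {d} {σ : Fin d → Fin d} → Injective _≡_ _≡_ σ → ∀ k x → orbitLen σ (iter k σ x) ≡ orbitLen σ x
orbitLen-~ {σ = σ} inj k = orbitLen-intertwine (iter k σ) (iter-injective inj k) (λ x → iter-comm σ 1 k x)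

unique-map : {A B : Set} {f : A → B} {xs : List A} → Unique xs →
  (∀ {x y} → x ∈ xs → y ∈ xs → f x ≡ f y → x ≡ y) → Unique (map f xs)
unique-map []        h = []
unique-map (x∉ ∷ u) h = All.map⁺ (All.tabulate (λ {y} y∈ e → All.lookup x∉ y∈ (h (here refl) (there y∈) e)))
                      ∷ unique-map u (λ x∈ y∈ → h (there x∈) (there y∈))

unique⇒↭ : {A : Set} {xs ys : List A} → Unique xs → Unique ys →
  (∀ x → x ∈ xs → x ∈ ys) → (∀ x → x ∈ ys → x ∈ xs) → xs ↭ ys
unique⇒↭ u v f g = ∼bag⇒↭ (unique∧set⇒bag u v (λ {x} → mk⇔ (f x) (g x)))

-- The map f carries cycles of σ to cycles of τ of equal length, but not least elements to least
-- elements. The representatives are therefore matched by `g`, which renormalises after f, and the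
-- two lists agree only up to order.
cycleType-intertwine : ∀ {d} {σ τ : Fin d → Fin d} → Injective _≡_ _≡_ σ → Injective _≡_ _≡_ τ →
  (f : Fin d → Fin d) → Injective _≡_ _≡_ f → τ ∘ f ≗ f ∘ σ → cycleType τ ↭ cycleType σ
cycleType-intertwine {d} {σ} {τ} σ-inj τ-inj f f-inj h =
  ↭-trans (Perm.map⁺ (orbitLen τ) (↭-sym reps↭)) (subst (map (orbitLen τ) (map g Oσ.reps) ↭_) lengths ↭-refl)
  where
  module Oσ = Orbits σ σ-inj
  module Oτ = Orbits τ τ-inj
  module Of = Orbits f f-inj
  g : Fin d → Fin d
  g x = Oτ.rep (f x)
  ~-map : ∀ {x y} → x Oσ.~ y → f x Oτ.~ f y
  ~-map {x} (k , refl) = k , iter-intertwine f h k x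
  ~-unmap : ∀ {x y} → f x Oτ.~ f y → x Oσ.~ y
  ~-unmap {x} (k , e) = k , f-inj (trans (sym (iter-intertwine f h k x)) e)
  reps↭ : map g Oσ.reps ↭ Oτ.reps
  reps↭ = unique⇒↭ (unique-map Oσ.reps-unique g-inj) Oτ.reps-unique ⊆ ⊇
    where
    g-inj : ∀ {x y} → x ∈ Oσ.reps → y ∈ Oσ.reps → g x ≡ g y → x ≡ y
    g-inj {x} {y} x∈ y∈ e = Oσ.rep-unique (Oσ.∈-reps⁻ x∈) (Oσ.∈-reps⁻ y∈)
      (~-unmap (Oτ.~-trans (Oτ.~-sym (Oτ.rep~ (f x))) (subst (Oτ._~ f y) (sym e) (Oτ.rep~ (f y)))))
    ⊆ : ∀ z → z ∈ map g Oσ.reps → z ∈ Oτ.reps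
    ⊆ z z∈ with ∈-map⁻ g z∈
    ... | x , _ , refl = Oτ.∈-reps⁺ (Oτ.rep-isRep (f x))
    ⊇ : ∀ z → z ∈ Oτ.reps → z ∈ map g Oσ.reps
    ⊇ z z∈ = subst (_∈ map g Oσ.reps) same-rep (∈-map⁺ g (Oσ.∈-reps⁺ (Oσ.rep-isRep x₀)))
      where
      x₀ = Of.inverse z
      same-rep : g (Oσ.rep x₀) ≡ z
      same-rep = Oτ.rep-unique (Oτ.rep-isRep (f (Oσ.rep x₀))) (Oτ.∈-reps⁻ z∈)
        (Oτ.~-trans (Oτ.rep~ _) (subst (f (Oσ.rep x₀) Oτ.~_) (Of.σ-inverse z) (~-map (Oσ.rep~ x₀))))
  lengths : map (orbitLen τ) (map g Oσ.reps) ≡ map (orbitLen σ) Oσ.reps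
  lengths = trans (sym (ListP.map-∘ Oσ.reps)) (ListP.map-cong len Oσ.reps)
    where
    len : orbitLen τ ∘ g ≗ orbitLen σ
    len x with Oτ.rep~ (f x)
    ... | k , e = trans (sym (orbitLen-~ τ-inj k (g x))) (trans (cong (orbitLen τ) e) (orbitLen-intertwine f f-inj h x))

sort-cong : ∀ {xs ys} → xs ↭ ys → sort xs ≡ sort ys
sort-cong {xs} {ys} p = Pointwise-≡⇒≡ (↗↭↗⇒≋ ℕP.≤-totalOrder (sort-↗ xs) (sort-↗ ys)
  (↭⇒↭ₛ (↭-trans (sort-↭ xs) (↭-trans p (↭-sym (sort-↭ ys))))))

hasCycleType⇒↭ : ∀ {d} (σ : Fin d → Fin d) μ → hasCycleType σ μ ≡ true → cycleType σ ↭ μ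
hasCycleType⇒↭ σ μ h with ListP.≡-dec ℕ._≟_ (sort (cycleType σ)) (sort μ)
... | yes e = ↭-trans (↭-sym (sort-↭ (cycleType σ))) (subst (_↭ μ) (sym e) (sort-↭ μ))

↭⇒hasCycleType : ∀ {d} (σ : Fin d → Fin d) μ → cycleType σ ↭ μ → hasCycleType σ μ ≡ true
↭⇒hasCycleType σ μ p with ListP.≡-dec ℕ._≟_ (sort (cycleType σ)) (sort μ)
... | yes _ = refl
... | no ¬e = ⊥-elim (¬e (sort-cong p))

hasCycleType-intertwine : ∀ {d} {σ τ : Fin d → Fin d} {μ} → Injective _≡_ _≡_ σ → Injective _≡_ _≡_ τ →
  (f : Fin d → Fin d) → Injective _≡_ _≡_ f → τ ∘ f ≗ f ∘ σ → hasCycleType σ μ ≡ true → hasCycleType τ μ ≡ true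
hasCycleType-intertwine {σ = σ} {τ} {μ} σ-inj τ-inj f f-inj h hσ =
  ↭⇒hasCycleType τ μ (↭-trans (cycleType-intertwine σ-inj τ-inj f f-inj h) (hasCycleType⇒↭ σ μ hσ))

-- Tuples, automorphisms and fibres over cycles

-- The cycles are labelled by the positions of μ, since automorphisms of μ permute positions. Each
-- point is recorded by its cycle and by a number of steps from the base point, which matters only
-- modulo the length of the cycle.
record CycleData {d : ℕ} (σ : Fin d → Fin d) (μ : List ℕ) : Set where
  field
    base     : Fin (length μ) → Fin d
    idx      : Fin d → Fin (length μ)
    off      : Fin d → ℕ
    base-off : ∀ x → iter (off x) σ (base (idx x)) ≡ x
    idx-iter : ∀ k i → idx (iter k σ (base i)) ≡ i
    base-len : ∀ i → orbitLen σ (base i) ≡ lookupℕ μ (toℕ i)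

  idx-base : ∀ i → idx (base i) ≡ i
  idx-base = idx-iter 0

  idx-iter′ : ∀ k x → idx (iter k σ x) ≡ idx x
  idx-iter′ k x = trans (cong (λ y → idx (iter k σ y)) (sym (base-off x)))
    (trans (cong idx (sym (iter-+ σ k (off x) (base (idx x))))) (idx-iter (k ℕ.+ off x) (idx x)))

module _ {A B : Set} (g : A → B) where

  -- The index type is the length of `map g xs` because `cycleData` replaces μ by such a list, and
  -- positions must be positions of μ.
  at : ∀ xs → Fin (length (map g xs)) → A
  at (x ∷ xs) zero    = x
  at (x ∷ xs) (suc i) = at xs i

  at-∈ : ∀ xs i → at xs i ∈ xs
  at-∈ (x ∷ xs) zero    = here refl
  at-∈ (x ∷ xs) (suc i) = there (at-∈ xs i)

  position : ∀ {xs x} → x ∈ xs → Fin (length (map g xs))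
  position (here _)  = zero
  position (there i) = suc (position i)

  at-position : ∀ {xs x} (i : x ∈ xs) → at xs (position i) ≡ x
  at-position (here refl) = refl
  at-position (there i)   = at-position i

  at-injective : ∀ {xs} → Unique xs → ∀ i j → at xs i ≡ at xs j → i ≡ j
  at-injective {x ∷ xs} (x∉ ∷ u) zero    zero    e = refl
  at-injective {x ∷ xs} (x∉ ∷ u) zero    (suc j) e = ⊥-elim (All.lookup x∉ (at-∈ xs j) e)
  at-injective {x ∷ xs} (x∉ ∷ u) (suc i) zero    e = ⊥-elim (All.lookup x∉ (at-∈ xs i) (sym e))
  at-injective {x ∷ xs} (x∉ ∷ u) (suc i) (suc j) e = cong suc (at-injective u i j e)

lookupℕ-map : {A : Set} (g : A → ℕ) (xs : List A) (i : Fin (length (map g xs))) → g (at g xs i) ≡ lookupℕ (map g xs) (toℕ i)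
lookupℕ-map g (x ∷ xs) zero    = refl
lookupℕ-map g (x ∷ xs) (suc i) = lookupℕ-map g xs i

-- A permutation between the list of cycle lengths and μ lifts to a reordering `xs` of the cycle
-- representatives whose lengths are μ entry by entry.
cycleData : ∀ {d} (σ : Fin d → Fin d) μ → Injective _≡_ _≡_ σ → hasCycleType σ μ ≡ true → CycleData σ μ
cycleData {d} σ μ inj h with Perm.↭-map-inv (orbitLen σ) (hasCycleType⇒↭ σ μ h)
... | xs , refl , p = record
  { base = at ℓ xs
  ; idx = idx
  ; off = λ x → proj₁ (off~ x)
  ; base-off = λ x → proj₂ (off~ x)
  ; idx-iter = λ k i → at-injective ℓ xs-unique _ _ (trans (at-position ℓ (rep∈ (iter k σ (at ℓ xs i))))
      (sym (rep-unique (∈-reps⁻ (Perm.∈-resp-↭ (↭-sym p) (at-∈ ℓ xs i))) (rep-isRep _)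
        (~-trans (k , refl) (~-sym (rep~ _))))))
  ; base-len = lookupℕ-map ℓ xs
  }
  where
  open Orbits σ inj
  xs-unique : Unique xs
  xs-unique = SPerm.Unique-resp-↭ (setoid (Fin d)) (↭⇒↭ₛ p) reps-unique
  rep∈ : ∀ x → rep x ∈ xs
  rep∈ x = Perm.∈-resp-↭ p (∈-reps⁺ (rep-isRep x))
  idx : Fin d → Fin (length (map ℓ xs))
  idx x = position ℓ (rep∈ x)
  off~ : ∀ x → at ℓ xs (idx x) ~ x
  off~ x = subst (_~ x) (sym (at-position ℓ (rep∈ x))) (rep~ x)

module _ {d e} {σ : Fin d → Fin d} {τ : Fin e → Fin e} (σ-inj : Injective _≡_ _≡_ σ) (τ-inj : Injective _≡_ _≡_ τ)
  {x y} (same-len : orbitLen σ x ≡ orbitLen τ y) where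

  private
    transfer-≤ : ∀ {a b} → a ≤ b → iter a σ x ≡ iter b σ x → iter a τ y ≡ iter b τ y
    transfer-≤ {a} {b} a≤b h with Orbits.period-divides σ σ-inj x (b ℕ.∸ a) (Orbits.iter-∸ σ σ-inj x a≤b h)
    ... | q , eq = sym (begin
      iter b τ y                    ≡⟨ cong (λ k → iter k τ y) (sym (ℕP.m+[n∸m]≡n a≤b)) ⟩
      iter (a ℕ.+ (b ℕ.∸ a)) τ y    ≡⟨ iter-+ τ a (b ℕ.∸ a) y ⟩
      iter a τ (iter (b ℕ.∸ a) τ y) ≡⟨ cong (λ k → iter a τ (iter k τ y)) (trans eq (cong (q ℕ.*_) same-len)) ⟩
      iter a τ (iter (q ℕ.* orbitLen τ y) τ y)
        ≡⟨ cong (iter a τ) (iter-* τ q (orbitLen τ y) y (Orbits.ℓ-returns τ τ-inj y)) ⟩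
      iter a τ y                    ∎)
      where open ≡-Reasoning

  -- Two iterates coincide exactly when the difference of the exponents is a multiple of the cycle
  -- length, which is the same for x and y.
  iter-transfer : ∀ a b → iter a σ x ≡ iter b σ x → iter a τ y ≡ iter b τ y
  iter-transfer a b h with ℕP.≤-total a b
  ... | inj₁ a≤b = transfer-≤ a≤b h
  ... | inj₂ b≤a = sym (transfer-≤ b≤a (sym h))

tuples-product : {A : Set} (r : ℕ) (xs : List A) → tuples (suc r) xs ≡ cartesianProductWith _∷_ xs (tuples r xs)
tuples-product {A} r xs = go xs
  where go : ∀ ys → concatMap (λ x → map (x ∷_) (tuples r xs)) ys ≡ cartesianProductWith _∷_ ys (tuples r xs)
        go []       = refl
        go (y ∷ ys) = cong (map (y ∷_) (tuples r xs) ++_) (go ys)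

tuples-unique : {A : Set} (r : ℕ) {xs : List A} → Unique xs → Unique (tuples r xs)
tuples-unique zero        u = [] ∷ []
tuples-unique (suc r) {xs} u = subst Unique (sym (tuples-product r xs))
  (Unique.cartesianProductWith⁺ _∷_ ListP.∷-injective u (tuples-unique r u))

∈-tuples⁺ : {A : Set} (r : ℕ) {xs : List A} (f : Fin r → A) → (∀ i → f i ∈ xs) → tabulate f ∈ tuples r xs
∈-tuples⁺ zero        f h = here refl
∈-tuples⁺ (suc r) {xs} f h = subst (_ ∈_) (sym (tuples-product r xs))
  (∈-cartesianProductWith⁺ _∷_ (h zero) (∈-tuples⁺ r (f ∘ suc) (h ∘ suc)))

∈-tuples⁻ : {A : Set} (r : ℕ) (xs : List A) {e : List A} → e ∈ tuples r xs → ∃ λ (f : Fin r → A) → e ≡ tabulate f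
∈-tuples⁻ zero    xs (here refl) = (λ ()) , refl
∈-tuples⁻ (suc r) xs e∈ with ∈-cartesianProductWith⁻ _∷_ xs (tuples r xs) (subst (_ ∈_) (tuples-product r xs) e∈)
... | x , e′ , _ , e′∈ , refl with ∈-tuples⁻ r xs e′∈
...   | f , refl = (λ { zero → x ; (suc i) → f i }) , refl

-- As `orbitSearch`: the where-bound loop of `autSize`.
mutual
  fixes : (μ : List ℕ) → List (Fin (length μ)) → Bool
  fixes = _

  autSize-unfold : ∀ μ → autSize μ ≡ countᵇ (λ s → isPermVec s ∧ fixes μ s) (tuples (length μ) (allFin (length μ)))
  autSize-unfold μ = refl

mutual
  fixesFrom : (μ : List ℕ) → List (Fin (length μ)) → ℕ → List (Fin (length μ)) → Bool
  fixesFrom = _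

  fixes-unfold : ∀ μ j js → fixes μ (j ∷ js) ≡ (lookupℕ μ (toℕ j) ℕ.≡ᵇ lookupℕ μ 0) ∧ fixesFrom μ (j ∷ js) 1 js
  fixes-unfold μ j js with j ∷ js | 1
  ... | _ | _ = refl

≡ᵇ-elim : ∀ {m n} → (m ℕ.≡ᵇ n) ≡ true → m ≡ n
≡ᵇ-elim {m} {n} h = ℕP.≡ᵇ⇒≡ m n (≡⇒T h)

≡ᵇ-intro : ∀ {m n} → m ≡ n → (m ℕ.≡ᵇ n) ≡ true
≡ᵇ-intro {m} {n} h = T⇒≡ (ℕP.≡⇒≡ᵇ m n h)

module _ (μ : List ℕ) (s₀ : List (Fin (length μ))) where

  private
    μ[_] : ℕ → ℕ
    μ[_] = lookupℕ μ

  -- The loop carries the whole vector `s₀` as fixed context besides the suffix on which it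
  -- recurses; k is the position where that suffix starts.
  fixesFrom-elim : ∀ {m} (s : Fin m → Fin (length μ)) k → fixesFrom μ s₀ k (tabulate s) ≡ true →
    ∀ i → μ[ toℕ (s i) ] ≡ μ[ k ℕ.+ toℕ i ]
  fixesFrom-elim s k h zero    = trans (≡ᵇ-elim (proj₁ (∧-elim h))) (cong μ[_] (sym (ℕP.+-identityʳ k)))
  fixesFrom-elim s k h (suc i) = trans
    (fixesFrom-elim (s ∘ suc) (suc k) (proj₂ (∧-elim {μ[ toℕ (s zero) ] ℕ.≡ᵇ μ[ k ]} h)) i)
    (cong μ[_] (sym (ℕP.+-suc k (toℕ i))))

  fixesFrom-intro : ∀ {m} (s : Fin m → Fin (length μ)) k → (∀ i → μ[ toℕ (s i) ] ≡ μ[ k ℕ.+ toℕ i ]) →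
    fixesFrom μ s₀ k (tabulate s) ≡ true
  fixesFrom-intro {zero}  s k h = refl
  fixesFrom-intro {suc m} s k h = ∧-intro (≡ᵇ-intro (trans (h zero) (cong μ[_] (ℕP.+-identityʳ k))))
    (fixesFrom-intro (s ∘ suc) (suc k) (λ i → trans (h (suc i)) (cong μ[_] (ℕP.+-suc k (toℕ i)))))

count-unique : ∀ {n} {xs : List (Fin n)} {i} → Unique xs → i ∈ xs → countᵇ (λ j → j == i) xs ≡ 1
count-unique {i = i} (x∉ ∷ u) (here refl) rewrite ≡⇒== {x = i} refl = cong suc (none _ x∉)
  where
  none : ∀ ys → All (i ≢_) ys → countᵇ (λ j → j == i) ys ≡ 0
  none []       _        = refl
  none (y ∷ ys) (h ∷ hs) rewrite ≢⇒== (h ∘ sym) = none ys hs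
count-unique {xs = x ∷ xs} {i} (x∉ ∷ u) (there i∈) rewrite ≢⇒== {x = x} {i} (All.lookup x∉ i∈) = count-unique u i∈

count-positive : ∀ {m} {A : Set} (p : A → Bool) (s : Fin m → A) i → p (s i) ≡ true → 1 ≤ countᵇ p (tabulate s)
count-positive p s zero    h rewrite h = s≤s z≤n
count-positive p s (suc i) h with p (s zero)
... | true  = s≤s z≤n
... | false = count-positive p (s ∘ suc) i h

count-one : ∀ {m} {A : Set} (p : A → Bool) (s : Fin m → A) → countᵇ p (tabulate s) ≡ 1 →
  ∀ i j → p (s i) ≡ true → p (s j) ≡ true → i ≡ j
count-one p s h zero    zero    hi hj = refl
count-one p s h zero    (suc j) hi hj rewrite hi with count-positive p (s ∘ suc) j hj
... | le with () ← subst (1 ≤_) (ℕP.suc-injective h) le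
count-one p s h (suc i) zero    hi hj rewrite hj with count-positive p (s ∘ suc) i hi
... | le with () ← subst (1 ≤_) (ℕP.suc-injective h) le
count-one p s h (suc i) (suc j) hi hj with p (s zero)
... | false = cong suc (count-one p (s ∘ suc) h i j hi hj)
... | true with count-positive p (s ∘ suc) i hi
...   | le with () ← subst (1 ≤_) (ℕP.suc-injective h) le

isPermVec-elim : ∀ {n} (s : Fin n → Fin n) → isPermVec (tabulate s) ≡ true → Injective _≡_ _≡_ s
isPermVec-elim {n} s h {i} {j} e = count-one (λ k → k == s i) s
  (≡ᵇ-elim (all-elim (λ i → countᵇ (λ j → j == i) (tabulate s) ℕ.≡ᵇ 1) (allFin n) h (∈-allFin (s i))))
  i j (≡⇒== {x = s i} refl) (≡⇒== (sym e))

isPermVec-intro : ∀ {n} (s : Fin n → Fin n) → Injective _≡_ _≡_ s → isPermVec (tabulate s) ≡ true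
isPermVec-intro {n} s inj = all-intro (λ i → countᵇ (λ j → j == i) (tabulate s) ℕ.≡ᵇ 1) (allFin n)
  (λ {i} _ → ≡ᵇ-intro (count-unique (Unique.tabulate⁺ inj) (subst (_∈ tabulate s) (σ-inverse i) (∈-tabulate⁺ (inverse i)))))
  where open Orbits s inj
        open import Data.List.Membership.Propositional.Properties using (∈-tabulate⁺)

validVec : (μ : List ℕ) → List (Fin (length μ)) → Bool
validVec μ s = isPermVec s ∧ fixes μ s

validVec-elim : ∀ μ s → validVec μ (tabulate s) ≡ true →
  Injective _≡_ _≡_ s × (∀ i → lookupℕ μ (toℕ (s i)) ≡ lookupℕ μ (toℕ i))
validVec-elim μ s h = isPermVec-elim s (proj₁ (∧-elim h)) ,
  fixesFrom-elim μ (tabulate s) s 0 (proj₂ (∧-elim {isPermVec (tabulate s)} h))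

validVec-intro : ∀ μ s → Injective _≡_ _≡_ s → (∀ i → lookupℕ μ (toℕ (s i)) ≡ lookupℕ μ (toℕ i)) → validVec μ (tabulate s) ≡ true
validVec-intro μ s inj h = ∧-intro (isPermVec-intro s inj) (fixesFrom-intro μ (tabulate s) s 0 h)

countᵇ≡∑ : {A : Set} (p : A → Bool) (xs : List A) → ℤ.+ countᵇ p xs ≡ ∑ xs (λ x → if p x then 1ℤ else 0ℤ)
countᵇ≡∑ p []       = refl
countᵇ≡∑ p (x ∷ xs) with p x
... | true  = cong (1ℤ +_) (countᵇ≡∑ p xs)
... | false = trans (countᵇ≡∑ p xs) (sym (ℤP.+-identityˡ _))

∑-const : {A : Set} (xs : List A) (c : ℤ) → ∑ xs (λ _ → c) ≡ ℤ.+ length xs * c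
∑-const []       c = refl
∑-const (x ∷ xs) c = trans (cong (c +_) (∑-const xs c)) (lemma c (length xs))
  where lemma : ∀ c n → c + ℤ.+ n * c ≡ ℤ.+ suc n * c
        lemma c n = sym (trans (ℤP.*-distribʳ-+ c 1ℤ (ℤ.+ n)) (cong (_+ ℤ.+ n * c) (ℤP.*-identityˡ c)))

∑-pick : ∀ {n} (i : Fin n) (F : Fin n → ℤ) → ∑ (allFin n) (λ j → if i == j then F j else 0ℤ) ≡ F i
∑-pick {suc n} zero    F = trans (∑-allFin n (λ j → if zero == j then F j else 0ℤ))
  (trans (cong (F zero +_) (∑-0 (allFin n))) (ℤP.+-identityʳ _))
∑-pick {suc n} (suc i) F = trans (∑-allFin n (λ j → if suc i == j then F j else 0ℤ))
  (trans (ℤP.+-identityˡ _) (∑-pick i (F ∘ suc)))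

module Fibres {d : ℕ} {τ : Fin d → Fin d} {μ : List ℕ} (τ-inj : Injective _≡_ _≡_ τ) (D : CycleData τ μ) where
  open CycleData D
  open Orbits τ τ-inj
  private n = length μ

  fibre : Fin n → List (Fin d)
  fibre j = filterᵇ (λ y → idx y == j) (allFin d)

  fibre-length : ∀ j → length (fibre j) ≡ lookupℕ μ (toℕ j)
  fibre-length j = trans (Perm.↭-length fibre↭) (trans (ListP.length-map cyc (upTo (ℓ (base j))))
      (trans (ListP.length-upTo (ℓ (base j))) (base-len j)))
    where
    cyc : ℕ → Fin d
    cyc k = iter k τ (base j)
    fibre↭ : fibre j ↭ map cyc (upTo (ℓ (base j)))
    fibre↭ = unique⇒↭ (Unique.filter⁺ _ (Unique.allFin⁺ d))
      (unique-map (Unique.upTo⁺ _) (λ a∈ b∈ → unreduce (base j) (∈-upTo⁻ a∈) (∈-upTo⁻ b∈)))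
      (λ y y∈ → toCycle y (==⇒≡ (proj₂ (∈-filterᵇ⁻ (λ y → idx y == j) {allFin d} y∈))))
      (λ y y∈ → let k , _ , e = ∈-map⁻ cyc y∈ in
        ∈-filterᵇ⁺ (λ y → idx y == j) (∈-allFin y) (≡⇒== (trans (cong idx e) (idx-iter k j))))
      where
      toCycle : ∀ y → idx y ≡ j → y ∈ map cyc (upTo (ℓ (base j)))
      toCycle y refl with reduce (base j) (off y)
      ... | k , k<ℓ , e , _ = subst (_∈ map cyc (upTo (ℓ (base j)))) (trans (sym e) (base-off y)) (∈-map⁺ cyc (∈-upTo⁺ k<ℓ))

  ∑-fibres : ∀ (F : Fin n → ℤ) → ∑ (allFin d) (F ∘ idx) ≡ ∑ (allFin n) (λ j → ℤ.+ lookupℕ μ (toℕ j) * F j)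
  ∑-fibres F = begin
    ∑ (allFin d) (F ∘ idx)
      ≡⟨ ∑-cong (allFin d) (λ y → sym (∑-pick (idx y) F)) ⟩
    ∑ (allFin d) (λ y → ∑ (allFin n) (λ j → if idx y == j then F j else 0ℤ))
      ≡⟨ ∑-swap (allFin d) (allFin n) _ ⟩
    ∑ (allFin n) (λ j → ∑ (allFin d) (λ y → if idx y == j then F j else 0ℤ))
      ≡⟨ ∑-cong (allFin n) (λ j → trans (sym (∑-filter (λ y → idx y == j) (allFin d) (λ _ → F j)))
           (trans (∑-const (fibre j) (F j)) (cong (λ m → ℤ.+ m * F j) (fibre-length j)))) ⟩
    ∑ (allFin n) (λ j → ℤ.+ lookupℕ μ (toℕ j) * F j) ∎
    where open ≡-Reasoning

  weights : List (Fin n) → ℤ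
  weights s = ℤ.+ product (map (λ j → lookupℕ μ (toℕ j)) s)

  -- Tuples of points are grouped by the cycles that they meet. A tuple s of cycle labels arises
  -- from as many tuples of points as the product of its cycle lengths, which is `weights s`.
  ∑-tuples-fibres : ∀ r (G : List (Fin n) → ℤ) →
    ∑ (tuples r (allFin d)) (G ∘ map idx) ≡ ∑ (tuples r (allFin n)) (λ s → weights s * G s)
  ∑-tuples-fibres zero    G = cong (_+ 0ℤ) (sym (ℤP.*-identityˡ (G [])))
  ∑-tuples-fibres (suc r) G = begin
    ∑ (tuples (suc r) (allFin d)) (G ∘ map idx)
      ≡⟨ ∑-tuples-suc r (allFin d) (G ∘ map idx) ⟩
    ∑ (allFin d) (λ y → ∑ (tuples r (allFin d)) (λ e → G (idx y ∷ map idx e)))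
      ≡⟨ ∑-cong (allFin d) (λ y → ∑-tuples-fibres r (λ s → G (idx y ∷ s))) ⟩
    ∑ (allFin d) (λ y → ∑ (tuples r (allFin n)) (λ s → weights s * G (idx y ∷ s)))
      ≡⟨ ∑-fibres (λ j → ∑ (tuples r (allFin n)) (λ s → weights s * G (j ∷ s))) ⟩
    ∑ (allFin n) (λ j → ℤ.+ lookupℕ μ (toℕ j) * ∑ (tuples r (allFin n)) (λ s → weights s * G (j ∷ s)))
      ≡⟨ ∑-cong (allFin n) (λ j → trans (sym (∑-*ˡ (tuples r (allFin n)) (ℤ.+ lookupℕ μ (toℕ j)) _))
           (∑-cong (tuples r (allFin n)) (λ s → trans (sym (ℤP.*-assoc (ℤ.+ lookupℕ μ (toℕ j)) (weights s) (G (j ∷ s))))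
             (cong (_* G (j ∷ s)) (sym (ℤP.pos-* (lookupℕ μ (toℕ j)) _)))))) ⟩
    ∑ (allFin n) (λ j → ∑ (tuples r (allFin n)) (λ s → weights (j ∷ s) * G (j ∷ s)))
      ≡⟨ sym (∑-tuples-suc r (allFin n) _) ⟩
    ∑ (tuples (suc r) (allFin n)) (λ s → weights s * G s) ∎
    where open ≡-Reasoning

tabulate-lookupℕ : ∀ μ → tabulate (λ (i : Fin (length μ)) → lookupℕ μ (toℕ i)) ≡ μ
tabulate-lookupℕ []      = refl
tabulate-lookupℕ (m ∷ μ) = cong (m ∷_) (tabulate-lookupℕ μ)

-- Centralisers

does-elim : {A : Set} (a? : Dec A) → does a? ≡ true → A
does-elim (yes a) _ = a

module Centraliser {d : ℕ} (σ τ : Fin d → Fin d) (σ-inj : Injective _≡_ _≡_ σ) (τ-inj : Injective _≡_ _≡_ τ) where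
  open Action d using (decode; encode; Maps)

  Intertwines : (Fin d → Fin d) → Set
  Intertwines f = (∀ x y → f x ≡ f y → x ≡ y) × (∀ x → τ (f x) ≡ f (σ x))

  intertwines? : ∀ f → Dec (Intertwines f)
  intertwines? f = injective? f ×-dec FP.all? (λ x → τ (f x) ≟ f (σ x))

  intertwines-cong : ∀ {f g} → f ≗ g → Intertwines f → Intertwines g
  intertwines-cong {f} {g} h (inj , comm) =
    (λ x y e → inj x y (trans (h x) (trans e (sym (h y))))) ,
    (λ x → trans (cong τ (sym (h x))) (trans (comm x) (h (σ x))))

  isIntertwiner : Maps → Bool
  isIntertwiner f = does (intertwines? (decode f))

  isIntertwiner-elim : ∀ {f} → isIntertwiner f ≡ true → Intertwines (decode f)
  isIntertwiner-elim {f} h = does-elim (intertwines? (decode f)) h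

  isIntertwiner-intro : ∀ {f} → Intertwines (decode f) → isIntertwiner f ≡ true
  isIntertwiner-intro {f} = dec-true (intertwines? (decode f))

  intertwiners : List Maps
  intertwiners = filterᵇ isIntertwiner (allFin (d ℕ.^ d))

  module _ {μ : List ℕ} (Cσ : CycleData σ μ) (Cτ : CycleData τ μ) where
    module Cσ = CycleData Cσ
    module Cτ = CycleData Cτ
    n = length μ

    μ[_] : Fin n → ℕ
    μ[ i ] = lookupℕ μ (toℕ i)

    isValid : List (Fin d) → Bool
    isValid e = validVec μ (map Cτ.idx e)

    restrict : Maps → List (Fin d)
    restrict f = tabulate (decode f ∘ Cσ.base)

    len-τ : ∀ y → orbitLen τ y ≡ μ[ Cτ.idx y ]
    len-τ y = trans (cong (orbitLen τ) (sym (Cτ.base-off y)))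
      (trans (orbitLen-~ τ-inj (Cτ.off y) (Cτ.base (Cτ.idx y))) (Cτ.base-len (Cτ.idx y)))

    map-idx : ∀ (E : Fin n → Fin d) → map Cτ.idx (tabulate E) ≡ tabulate (Cτ.idx ∘ E)
    map-idx E = ListP.map-tabulate E Cτ.idx

    determined : ∀ {f} → Intertwines f → ∀ x → f x ≡ iter (Cσ.off x) τ (f (Cσ.base (Cσ.idx x)))
    determined {f} (_ , comm) x = trans (cong f (sym (Cσ.base-off x))) (sym (iter-intertwine f comm (Cσ.off x) _))

    restrict-valid : ∀ {f} → Intertwines f → validVec μ (tabulate (Cτ.idx ∘ f ∘ Cσ.base)) ≡ true
    restrict-valid {f} (inj , comm) = validVec-intro μ (Cτ.idx ∘ f ∘ Cσ.base)
      (λ {i} {j} e → same-cycle i j e)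
      (λ i → trans (sym (len-τ (f (Cσ.base i)))) (trans (orbitLen-intertwine f (inj _ _) comm (Cσ.base i)) (Cσ.base-len i)))
      where
      open Orbits τ τ-inj
      base~ : ∀ y → Cτ.base (Cτ.idx y) ~ y
      base~ y = Cτ.off y , Cτ.base-off y
      same-cycle : ∀ i j → Cτ.idx (f (Cσ.base i)) ≡ Cτ.idx (f (Cσ.base j)) → i ≡ j
      same-cycle i j e with ~-trans (~-sym (base~ (f (Cσ.base i)))) (subst (λ k → Cτ.base k ~ f (Cσ.base j)) (sym e) (base~ (f (Cσ.base j))))
      ... | k , h = trans (sym (Cσ.idx-iter k i))
        (trans (cong Cσ.idx (inj _ _ (trans (sym (iter-intertwine f comm k (Cσ.base i))) h))) (Cσ.idx-base j))

    -- E prescribes the images of the base points. The intertwining relation leaves no other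
    -- freedom, and equality of cycle lengths makes the prescription consistent.
    module Extend (E : Fin n → Fin d) (s-inj : Injective _≡_ _≡_ (Cτ.idx ∘ E)) (s-fix : ∀ i → μ[ Cτ.idx (E i) ] ≡ μ[ i ]) where

      extend : Fin d → Fin d
      extend x = iter (Cσ.off x) τ (E (Cσ.idx x))

      same-len : ∀ i → orbitLen σ (Cσ.base i) ≡ orbitLen τ (E i)
      same-len i = trans (Cσ.base-len i) (sym (trans (len-τ (E i)) (s-fix i)))

      extend-iter : ∀ k i → extend (iter k σ (Cσ.base i)) ≡ iter k τ (E i)
      extend-iter k i = trans (cong (λ j → iter (Cσ.off z) τ (E j)) (Cσ.idx-iter k i))
        -- The recorded offset of z may differ from k, but both lead from the base point to z, and
        -- this coincidence transfers to the cycle of E i.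
        (iter-transfer σ-inj τ-inj (same-len i) (Cσ.off z) k
          (trans (cong (λ j → iter (Cσ.off z) σ (Cσ.base j)) (sym (Cσ.idx-iter k i))) (Cσ.base-off z)))
        where z = iter k σ (Cσ.base i)

      extend-base : ∀ i → extend (Cσ.base i) ≡ E i
      extend-base = extend-iter 0

      extend-comm : ∀ x → τ (extend x) ≡ extend (σ x)
      extend-comm x = sym (trans (cong (extend ∘ σ) (sym (Cσ.base-off x))) (extend-iter (suc (Cσ.off x)) (Cσ.idx x)))

      extend-inj : ∀ x y → extend x ≡ extend y → x ≡ y
      extend-inj x y e = trans (sym (Cσ.base-off x)) (trans
        (iter-transfer τ-inj σ-inj (sym (same-len (Cσ.idx x))) (Cσ.off x) (Cσ.off y)
          (trans e (cong (λ j → iter (Cσ.off y) τ (E j)) (sym same-idx))))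
        (trans (cong (λ j → iter (Cσ.off y) σ (Cσ.base j)) same-idx) (Cσ.base-off y)))
        where
        same-idx : Cσ.idx x ≡ Cσ.idx y
        same-idx = s-inj (trans (sym (Cτ.idx-iter′ (Cσ.off x) (E (Cσ.idx x)))) (trans (cong Cτ.idx e) (Cτ.idx-iter′ (Cσ.off y) (E (Cσ.idx y)))))

      intertwines : Intertwines extend
      intertwines = extend-inj , extend-comm

    ∈-intertwiners⁻ : ∀ {f} → f ∈ intertwiners → Intertwines (decode f)
    ∈-intertwiners⁻ {f} f∈ = isIntertwiner-elim {f} (proj₂ (∈-filterᵇ⁻ isIntertwiner {allFin (d ℕ.^ d)} f∈))

    restrict-injective : ∀ {f g} → f ∈ intertwiners → g ∈ intertwiners → restrict f ≡ restrict g → f ≡ g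
    restrict-injective {f} {g} f∈ g∈ e = trans (sym (FP.funToFin-finToFin {d} {d} f))
      (trans (funToFin-cong (λ x → trans (determined {decode f} (∈-intertwiners⁻ {f} f∈) x)
          (trans (cong (iter (Cσ.off x) τ) (tabulate-≗ e (Cσ.idx x))) (sym (determined {decode g} (∈-intertwiners⁻ {g} g∈) x)))))
        (FP.funToFin-finToFin {d} {d} g))
      where
      tabulate-≗ : ∀ {m} {A : Set} {s t : Fin m → A} → tabulate s ≡ tabulate t → s ≗ t
      tabulate-≗ e zero    = ListP.∷-injectiveˡ e
      tabulate-≗ e (suc i) = tabulate-≗ (ListP.∷-injectiveʳ e) i

    -- An intertwiner is determined by its values on base points. A choice of values is admissible
    -- exactly when it sends distinct cycles to distinct cycles of the same length, that is, when
    -- the labels of the values form an automorphism of μ.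
    restrict↭ : map restrict intertwiners ↭ filterᵇ isValid (tuples n (allFin d))
    restrict↭ = unique⇒↭
      (unique-map (Unique.filter⁺ _ (Unique.allFin⁺ _)) (λ {f} {g} → restrict-injective {f} {g}))
      (Unique.filter⁺ _ (tuples-unique n (Unique.allFin⁺ d)))
      ⊆ ⊇
      where
      ⊆ : ∀ e → e ∈ map restrict intertwiners → e ∈ filterᵇ isValid (tuples n (allFin d))
      ⊆ e e∈ with ∈-map⁻ restrict e∈
      ... | f , f∈ , refl = ∈-filterᵇ⁺ isValid (∈-tuples⁺ n (decode f ∘ Cσ.base) (λ i → ∈-allFin _))
        (trans (cong (validVec μ) (map-idx (decode f ∘ Cσ.base))) (restrict-valid {decode f} (∈-intertwiners⁻ {f} f∈)))
      ⊇ : ∀ e → e ∈ filterᵇ isValid (tuples n (allFin d)) → e ∈ map restrict intertwiners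
      ⊇ e e∈ with ∈-filterᵇ⁻ isValid {tuples n (allFin d)} e∈
      ... | e∈t , valid with ∈-tuples⁻ n (allFin d) e∈t
      ...   | E , refl = subst (_∈ map restrict intertwiners)
                (ListP.tabulate-cong (λ i → trans (dec i) (extend-base i)))
                (∈-map⁺ restrict (∈-filterᵇ⁺ isIntertwiner (∈-allFin (encode extend)) (isIntertwiner-intro {encode extend}
                  (intertwines-cong (sym ∘ FP.finToFun-funToFin {d} {d} extend) intertwines))))
        where
        s-valid = validVec-elim μ (Cτ.idx ∘ E) (trans (cong (validVec μ) (sym (map-idx E))) valid)
        open Extend E (proj₁ s-valid) (proj₂ s-valid)
        dec : ∀ i → decode (encode extend) (Cσ.base i) ≡ extend (Cσ.base i)
        dec i = FP.finToFun-funToFin {d} {d} extend (Cσ.base i)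

    -- Each automorphism s of μ leaves one free point in each target cycle. This gives the product
    -- of the entries of μ at s(i), which equals the product of μ since s preserves the entries.
    intertwiner-count : ℤ.+ length intertwiners ≡ ℤ.+ (autSize μ ℕ.* product μ)
    intertwiner-count = begin
      ℤ.+ length intertwiners
        ≡⟨ cong ℤ.+_ (trans (sym (ListP.length-map restrict intertwiners)) (Perm.↭-length restrict↭)) ⟩
      ℤ.+ countᵇ isValid (tuples n (allFin d))
        ≡⟨ countᵇ≡∑ isValid (tuples n (allFin d)) ⟩
      ∑ (tuples n (allFin d)) (G ∘ map Cτ.idx)
        ≡⟨ ∑-tuples-fibres n G ⟩
      ∑ (tuples n (allFin n)) (λ s → weights s * G s)
        ≡⟨ ∑-cong-∈ (tuples n (allFin n)) constant ⟩
      ∑ (tuples n (allFin n)) (λ s → ℤ.+ product μ * G s)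
        ≡⟨ ∑-*ˡ (tuples n (allFin n)) (ℤ.+ product μ) G ⟩
      ℤ.+ product μ * ∑ (tuples n (allFin n)) G
        ≡⟨ cong (ℤ.+ product μ *_) (sym (countᵇ≡∑ (validVec μ) (tuples n (allFin n)))) ⟩
      ℤ.+ product μ * ℤ.+ autSize μ
        ≡⟨ trans (sym (ℤP.pos-* (product μ) (autSize μ))) (cong ℤ.+_ (ℕP.*-comm (product μ) (autSize μ))) ⟩
      ℤ.+ (autSize μ ℕ.* product μ) ∎
      where
      open ≡-Reasoning
      open Fibres τ-inj Cτ
      G : List (Fin n) → ℤ
      G s = if validVec μ s then 1ℤ else 0ℤ
      constant : ∀ {s} → s ∈ tuples n (allFin n) → weights s * G s ≡ ℤ.+ product μ * G s
      constant {s} s∈ with validVec μ s in eq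
      ... | false = trans (ℤP.*-zeroʳ (weights s)) (sym (ℤP.*-zeroʳ (ℤ.+ product μ)))
      ... | true with ∈-tuples⁻ n (allFin n) s∈
      ...   | S , refl = cong (λ l → ℤ.+ product l * 1ℤ)
                (trans (ListP.map-tabulate S (λ j → μ[ j ])) (trans (ListP.tabulate-cong (proj₂ (validVec-elim μ S eq))) (tabulate-lookupℕ μ)))

δ-≡ : ∀ {n} {i j : Fin n} → i ≡ j → δ i j ≡ 1ℤ
δ-≡ {i = zero}  refl = refl
δ-≡ {i = suc i} refl = δ-≡ {i = i} refl

δ-≢ : ∀ {n} {i j : Fin n} → ¬ i ≡ j → δ i j ≡ 0ℤ
δ-≢ {i = zero}  {zero}  h = ⊥-elim (h refl)
δ-≢ {i = zero}  {suc j} h = refl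
δ-≢ {i = suc i} {zero}  h = refl
δ-≢ {i = suc i} {suc j} h = δ-≢ (h ∘ cong suc)

prodT-injective : ∀ {d} (ts : List (Transp d)) → Injective _≡_ _≡_ (prodT ts)
prodT-injective []       e = e
prodT-injective (t ∷ ts) e = prodT-injective ts (applyT-injective t e)

module _ {d : ℕ} (σ : Fin d → Fin d) (σ-inj : Injective _≡_ _≡_ σ) where
  private
    ς = Orbits.inverse σ σ-inj

  open TraceFormula d ς
  open Action d

  -- The term of f is 1 exactly when f is injective and f = τ f σ⁻¹, which is the intertwining
  -- relation τ f = f σ.
  weight≡count : ∀ ts → weight ts ≡ ℤ.+ length (Centraliser.intertwiners σ (prodT ts) σ-inj (prodT-injective ts))
  weight≡count ts = trans (∑-cong (allFin (d ℕ.^ d)) pointwise) (sym (countᵇ≡∑ isIntertwiner (allFin (d ℕ.^ d))))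
    where
    τ = prodT ts
    open Centraliser σ τ σ-inj (prodT-injective ts)
    ς-σ : ∀ x → ς (σ x) ≡ x
    ς-σ x = σ-inj (Orbits.σ-inverse σ σ-inj (σ x))
    term : ∀ f → (S $ δ f) (act τ f) ≡ (if isInjective f then δ f (act τ (rightMult f)) else 0ℤ)
    term f = cong₂ (λ b g → if b then δ f g else 0ℤ) (isInjective-act (prodT-injective ts) f) (rightMult-act τ f)
    decoded : ∀ f → decode (act τ (rightMult f)) ≗ τ ∘ decode f ∘ ς
    decoded f x = trans (FP.finToFun-funToFin {d} {d} (τ ∘ decode (rightMult f)) x)
      (cong τ (FP.finToFun-funToFin {d} {d} (decode f ∘ ς) x))
    fixed⇒comm : ∀ f → f ≡ act τ (rightMult f) → ∀ x → τ (decode f x) ≡ decode f (σ x)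
    fixed⇒comm f e x = trans (cong (τ ∘ decode f) (sym (ς-σ x))) (trans (sym (decoded f (σ x))) (cong (λ g → decode g (σ x)) (sym e)))
    comm⇒fixed : ∀ f → (∀ x → τ (decode f x) ≡ decode f (σ x)) → f ≡ act τ (rightMult f)
    comm⇒fixed f h = trans (sym (act-id f)) (trans
      (funToFin-cong (λ x → sym (trans (decoded f x) (trans (h (ς x)) (cong (decode f) (Orbits.σ-inverse σ σ-inj x))))))
      (act-id (act τ (rightMult f))))
    pointwise : ∀ f → (S $ δ f) (act τ f) ≡ (if isIntertwiner f then 1ℤ else 0ℤ)
    pointwise f = trans (term f) (go (injective? (decode f)) (FP.all? (λ x → τ (decode f x) ≟ decode f (σ x))))
      where
      go : (a? : Dec (∀ x y → decode f x ≡ decode f y → x ≡ y)) (b? : Dec (∀ x → τ (decode f x) ≡ decode f (σ x))) →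
        (if does a? then δ f (act τ (rightMult f)) else 0ℤ) ≡ (if does (a? ×-dec b?) then 1ℤ else 0ℤ)
      go (no _)  b?      = refl
      go (yes _) (yes h) = δ-≡ (comm⇒fixed f h)
      go (yes _) (no ¬h) = δ-≢ (λ e → ¬h (fixed⇒comm f e))

  weight-value : ∀ {μ} → hasCycleType σ μ ≡ true → ∀ ts →
    weight ts ≡ (if hasCycleType (prodT ts) μ then ℤ.+ (autSize μ ℕ.* product μ) else 0ℤ)
  weight-value {μ} hσ ts with hasCycleType (prodT ts) μ in eq
  ... | true  = trans (weight≡count ts) (intertwiner-count (cycleData σ μ σ-inj hσ) (cycleData (prodT ts) μ (prodT-injective ts) eq))
    where open Centraliser σ (prodT ts) σ-inj (prodT-injective ts)
  ... | false = trans (weight≡count ts) (cong (λ l → ℤ.+ length l) (empty intertwiners none))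
    where
    open Centraliser σ (prodT ts) σ-inj (prodT-injective ts)
    empty : {A : Set} (xs : List A) → (∀ {x} → x ∈ xs → ⊥) → xs ≡ []
    empty []       h = refl
    empty (x ∷ xs) h = ⊥-elim (h (here refl))
    -- An intertwiner would conjugate σ into the product and so give the product the cycle type μ.
    none : ∀ {f} → f ∈ intertwiners → ⊥
    none {f} f∈ with isIntertwiner-elim {f} (proj₂ (∈-filterᵇ⁻ isIntertwiner {allFin (d ℕ.^ d)} f∈))
    ... | inj , comm with () ← trans (sym eq) (hasCycleType-intertwine {μ = μ} σ-inj (prodT-injective ts) (decode f) (inj _ _) comm hσ)

-- Parity

record _≡₂_ (x y : ℤ) : Set where
  constructor mod₂
  field
    half : ℤ
    eq   : x ≡ y + ℤ.+ 2 * half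

≡₂-sym : ∀ {x y} → x ≡₂ y → y ≡₂ x
≡₂-sym {x} {y} (mod₂ q refl) = mod₂ (- q) (lemma y q)
  where lemma : ∀ y q → y ≡ (y + ℤ.+ 2 * q) + ℤ.+ 2 * (- q)
        lemma = solve-∀

≡₂-trans : ∀ {x y z} → x ≡₂ y → y ≡₂ z → x ≡₂ z
≡₂-trans {z = z} (mod₂ q refl) (mod₂ p refl) = mod₂ (p + q) (lemma z p q)
  where lemma : ∀ z p q → (z + ℤ.+ 2 * p) + ℤ.+ 2 * q ≡ z + ℤ.+ 2 * (p + q)
        lemma = solve-∀

≡₂-reflexive : ∀ {x y} → x ≡ y → x ≡₂ y
≡₂-reflexive {x} refl = mod₂ 0ℤ (sym (ℤP.+-identityʳ x))

≡₂-+ : ∀ {x y x′ y′} → x ≡₂ y → x′ ≡₂ y′ → (x + x′) ≡₂ (y + y′)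
≡₂-+ {y = y} {y′ = y′} (mod₂ q refl) (mod₂ p refl) = mod₂ (q + p) (lemma y q y′ p)
  where lemma : ∀ y q y′ p → (y + ℤ.+ 2 * q) + (y′ + ℤ.+ 2 * p) ≡ (y + y′) + ℤ.+ 2 * (q + p)
        lemma = solve-∀

≡₂-cancelʳ : ∀ {x y} z → (x + z) ≡₂ (y + z) → x ≡₂ y
≡₂-cancelʳ {x} {y} z (mod₂ q e) = mod₂ q (trans (lemma₁ x z) (trans (cong (_- z) e) (lemma₂ y z q)))
  where lemma₁ : ∀ x z → x ≡ (x + z) - z
        lemma₁ = solve-∀
        lemma₂ : ∀ y z q → (y + z) + ℤ.+ 2 * q - z ≡ y + ℤ.+ 2 * q
        lemma₂ = solve-∀

∑-reindex : ∀ {d} {σ : Fin d → Fin d} → Injective _≡_ _≡_ σ → ∀ G → ∑ (allFin d) (G ∘ σ) ≡ ∑ (allFin d) G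
∑-reindex {d} {σ} inj G = trans (sym (∑-map σ (allFin d) G)) (∑-↭ G (unique⇒↭
  (Unique.map⁺ inj (Unique.allFin⁺ d)) (Unique.allFin⁺ d) (λ x _ → ∈-allFin x)
  (λ x _ → subst (_∈ map σ (allFin d)) (Orbits.σ-inverse σ inj x) (∈-map⁺ σ (∈-allFin (Orbits.inverse σ inj x))))))

module _ {d : ℕ} where

  lt : Fin d → Fin d → Bool
  lt a b = toℕ a ℕ.<ᵇ toℕ b

  lt-irrefl : ∀ a → lt a a ≡ false
  lt-irrefl a = go (toℕ a)
    where go : ∀ n → (n ℕ.<ᵇ n) ≡ false
          go zero    = refl
          go (suc n) = go n

  lt-flip : ∀ {a b} → ¬ a ≡ b → lt b a ≡ not (lt a b)
  lt-flip {a} {b} h = go (toℕ a) (toℕ b) (h ∘ FP.toℕ-injective)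
    where go : ∀ m n → ¬ m ≡ n → (n ℕ.<ᵇ m) ≡ not (m ℕ.<ᵇ n)
          go zero    zero    h = ⊥-elim (h refl)
          go zero    (suc n) h = refl
          go (suc m) zero    h = refl
          go (suc m) (suc n) h = go m n (h ∘ cong suc)

  ∑∑ : (Fin d → Fin d → ℤ) → ℤ
  ∑∑ G = ∑ (allFin d) (λ a → ∑ (allFin d) (G a))

  ∑∑-cong : ∀ {G G′} → (∀ a b → G a b ≡ G′ a b) → ∑∑ G ≡ ∑∑ G′
  ∑∑-cong h = ∑-cong (allFin d) (λ a → ∑-cong (allFin d) (h a))

  ∑∑-+ : ∀ G G′ → ∑∑ (λ a b → G a b + G′ a b) ≡ ∑∑ G + ∑∑ G′
  ∑∑-+ G G′ = trans (∑-cong (allFin d) (λ a → ∑-+ (allFin d) (G a) (G′ a))) (∑-+ (allFin d) _ _)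

  ∑∑-*ˡ : ∀ c G → ∑∑ (λ a b → c * G a b) ≡ c * ∑∑ G
  ∑∑-*ˡ c G = trans (∑-cong (allFin d) (λ a → ∑-*ˡ (allFin d) c (G a))) (∑-*ˡ (allFin d) c _)

  increasing : (Fin d → Fin d → ℤ) → Fin d → Fin d → ℤ
  increasing G a b = if lt a b then G a b else 0ℤ

  ∑∑-symmetric : ∀ G → (∀ a b → G a b ≡ G b a) → (∀ a → G a a ≡ 0ℤ) → ∑∑ G ≡ ℤ.+ 2 * ∑∑ (increasing G)
  ∑∑-symmetric G G-sym G-diag = begin
    ∑∑ G
      ≡⟨ ∑∑-cong split ⟩
    ∑∑ (λ a b → increasing G a b + increasing G b a)
      ≡⟨ ∑∑-+ (increasing G) (λ a b → increasing G b a) ⟩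
    ∑∑ (increasing G) + ∑∑ (λ a b → increasing G b a)
      ≡⟨ cong (∑∑ (increasing G) +_) (∑-swap (allFin d) (allFin d) (λ a b → increasing G b a)) ⟩
    ∑∑ (increasing G) + ∑∑ (increasing G)
      ≡⟨ double (∑∑ (increasing G)) ⟩
    ℤ.+ 2 * ∑∑ (increasing G) ∎
    where
    open ≡-Reasoning
    double : ∀ x → x + x ≡ ℤ.+ 2 * x
    double = solve-∀
    split : ∀ a b → G a b ≡ increasing G a b + increasing G b a
    split a b with a ≟ b
    ... | yes refl rewrite lt-irrefl a = G-diag a
    ... | no a≢b rewrite lt-flip a≢b with lt a b
    ...   | true  = sym (ℤP.+-identityʳ _)
    ...   | false = trans (G-sym a b) (sym (ℤP.+-identityˡ _))

  -- The exclusive or is symmetric in a and b for injective f, so summing over all ordered pairs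
  -- counts every inversion twice.
  inverted : (Fin d → Fin d) → Fin d → Fin d → ℤ
  inverted f a b = if lt a b xor lt (f a) (f b) then 1ℤ else 0ℤ

  inversions : (Fin d → Fin d) → ℤ
  inversions f = ∑∑ (increasing (inverted f))

  inversions-cong : ∀ {f g} → f ≗ g → inversions f ≡ inversions g
  inversions-cong h = ∑∑-cong (λ a b → cong (λ c → if lt a b then (if lt a b xor c then 1ℤ else 0ℤ) else 0ℤ) (cong₂ lt (h a) (h b)))

  inverted-sym : ∀ {f} → Injective _≡_ _≡_ f → ∀ a b → inverted f a b ≡ inverted f b a
  inverted-sym {f} inj a b with a ≟ b
  ... | yes refl = refl
  ... | no a≢b rewrite lt-flip a≢b | lt-flip (a≢b ∘ inj) = go (lt a b) (lt (f a) (f b))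
    where go : ∀ x y → (if x xor y then 1ℤ else 0ℤ) ≡ (if not x xor not y then 1ℤ else 0ℤ)
          go true  true  = refl
          go true  false = refl
          go false true  = refl
          go false false = refl

  inverted-diag : ∀ f a → inverted f a a ≡ 0ℤ
  inverted-diag f a rewrite lt-irrefl a | lt-irrefl (f a) = refl

  inversions-double : ∀ {f} → Injective _≡_ _≡_ f → ∑∑ (inverted f) ≡ ℤ.+ 2 * inversions f
  inversions-double {f} inj = ∑∑-symmetric (inverted f) (inverted-sym inj) (inverted-diag f)

  -- Counting ordered pairs instead of increasing ones makes the reindexing by σ harmless.
  inversions-∘ : ∀ {f σ} → Injective _≡_ _≡_ f → Injective _≡_ _≡_ σ →
    inversions (f ∘ σ) ≡₂ (inversions f + inversions σ)
  inversions-∘ {f} {σ} f-inj σ-inj = mod₂ (- q) (ℤP.*-cancelˡ-≡ (ℤ.+ 2) _ _ (begin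
    ℤ.+ 2 * inversions (f ∘ σ)
      ≡⟨ sym (inversions-double (λ e → σ-inj (f-inj e))) ⟩
    ∑∑ (inverted (f ∘ σ))
      ≡⟨ ∑∑-cong (λ a b → pointwise (lt a b) (lt (σ a) (σ b)) (lt (f (σ a)) (f (σ b)))) ⟩
    ∑∑ (λ a b → (f′-inverted a b + inverted σ a b) + -[2] * both a b)
      ≡⟨ ∑∑-+ (λ a b → f′-inverted a b + inverted σ a b) (λ a b → -[2] * both a b) ⟩
    ∑∑ (λ a b → f′-inverted a b + inverted σ a b) + ∑∑ (λ a b → -[2] * both a b)
      ≡⟨ cong₂ _+_ (∑∑-+ f′-inverted (inverted σ)) (∑∑-*ˡ -[2] both) ⟩
    (∑∑ f′-inverted + ∑∑ (inverted σ)) + -[2] * ∑∑ both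
      ≡⟨ cong₂ (λ x y → x + -[2] * y) (cong₂ _+_ (trans reindexed (inversions-double f-inj)) (inversions-double σ-inj))
           (∑∑-symmetric both both-sym (λ a → trans (cong (_* inverted σ a a) (inverted-diag f (σ a))) (ℤP.*-zeroˡ (inverted σ a a)))) ⟩
    (ℤ.+ 2 * inversions f + ℤ.+ 2 * inversions σ) + -[2] * (ℤ.+ 2 * q)
      ≡⟨ lemma (inversions f) (inversions σ) q ⟩
    ℤ.+ 2 * (inversions f + inversions σ + ℤ.+ 2 * (- q)) ∎))
    where
    open ≡-Reasoning
    -[2] = ℤ.- ℤ.+ 2
    f′-inverted : Fin d → Fin d → ℤ
    f′-inverted a b = inverted f (σ a) (σ b)
    both : Fin d → Fin d → ℤ
    both a b = f′-inverted a b * inverted σ a b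
    q = ∑∑ (increasing both)
    both-sym : ∀ a b → both a b ≡ both b a
    both-sym a b = cong₂ _*_ (inverted-sym f-inj (σ a) (σ b)) (inverted-sym σ-inj a b)
    reindexed : ∑∑ f′-inverted ≡ ∑∑ (inverted f)
    reindexed = trans (∑-cong (allFin d) (λ a → ∑-reindex σ-inj (inverted f (σ a)))) (∑-reindex σ-inj (λ a → ∑ (allFin d) (inverted f a)))
    pointwise : ∀ x y z → (if x xor z then 1ℤ else 0ℤ) ≡
      ((if y xor z then 1ℤ else 0ℤ) + (if x xor y then 1ℤ else 0ℤ)) + -[2] * ((if y xor z then 1ℤ else 0ℤ) * (if x xor y then 1ℤ else 0ℤ))
    pointwise true  true  true  = refl
    pointwise true  true  false = refl
    pointwise true  false true  = refl
    pointwise true  false false = refl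
    pointwise false true  true  = refl
    pointwise false true  false = refl
    pointwise false false true  = refl
    pointwise false false false = refl
    lemma : ∀ a b q → (ℤ.+ 2 * a + ℤ.+ 2 * b) + (ℤ.- ℤ.+ 2) * (ℤ.+ 2 * q) ≡ ℤ.+ 2 * (a + b + ℤ.+ 2 * (- q))
    lemma = solve-∀

-- Both sides of τ f = f σ have additive parity, and the contribution of f cancels.
inversions-conj : ∀ {d} {σ τ f : Fin d → Fin d} → Injective _≡_ _≡_ σ → Injective _≡_ _≡_ τ → Injective _≡_ _≡_ f →
  τ ∘ f ≗ f ∘ σ → inversions τ ≡₂ inversions σ
inversions-conj {σ = σ} {τ} {f} σ-inj τ-inj f-inj h = ≡₂-cancelʳ (inversions f)
  (≡₂-trans (≡₂-sym (inversions-∘ τ-inj f-inj)) (≡₂-trans (≡₂-reflexive (inversions-cong h))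
    (≡₂-trans (inversions-∘ f-inj σ-inj) (≡₂-reflexive (ℤP.+-comm (inversions f) (inversions σ))))))

inversions-01 : ∀ d → inversions (applyT {suc (suc d)} ⟨ zero , suc zero ⟩) ≡ 1ℤ
inversions-01 d = trans (∑-allFin (suc d) row) (cong₂ _+_ row-0
    (trans (∑-allFin d (row ∘ suc)) (cong₂ _+_ row-1 (trans (∑-cong (allFin d) row-2) (∑-0 (allFin d))))))
  where
  t : Fin (suc (suc d)) → Fin (suc (suc d))
  t = applyT ⟨ zero , suc zero ⟩
  row : Fin (suc (suc d)) → ℤ
  row a = ∑ (allFin (suc (suc d))) (increasing (inverted t) a)
  unfold : ∀ a → row a ≡ increasing (inverted t) a zero + (increasing (inverted t) a (suc zero)
    + ∑ (allFin d) (λ b → increasing (inverted t) a (suc (suc b))))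
  unfold a = trans (∑-allFin (suc d) (increasing (inverted t) a))
    (cong (_+_ (increasing (inverted t) a zero)) (∑-allFin d (λ b → increasing (inverted t) a (suc b))))
  row-0 : row zero ≡ 1ℤ
  row-0 = trans (unfold zero) (cong (λ s → 0ℤ + (1ℤ + s)) (∑-0 (allFin d)))
  row-1 : row (suc zero) ≡ 0ℤ
  row-1 = trans (unfold (suc zero)) (cong (λ s → 0ℤ + (0ℤ + s)) (∑-0 (allFin d)))
  fixed : ∀ x → (if x then (if x xor x then 1ℤ else 0ℤ) else 0ℤ) ≡ 0ℤ
  fixed true  = refl
  fixed false = refl
  row-2 : ∀ a → row (suc (suc a)) ≡ 0ℤ
  row-2 a = trans (unfold (suc (suc a))) (cong (λ s → 0ℤ + (0ℤ + s))
    (trans (∑-cong (allFin d) (λ b → fixed (lt a b))) (∑-0 (allFin d))))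

-- Every transposition is conjugate to (0 1), for which the count is immediate, so the inversions of
-- a general transposition are never counted.
inversions-applyT : ∀ {d} (i j : Fin (suc (suc d))) → ¬ i ≡ j → inversions (applyT ⟨ i , j ⟩) ≡₂ 1ℤ
inversions-applyT {d} i j i≢j = ≡₂-trans
  (inversions-conj {f = π} (applyT-injective ⟨ zero , suc zero ⟩) (applyT-injective ⟨ i , j ⟩) π-inj
    (λ x → sym (trans (applyT-conj π-inj zero (suc zero) x) (cong₂ (λ a b → applyT ⟨ a , b ⟩ (π x)) π0 π1))))
  (≡₂-reflexive (inversions-01 d))
  where
  -- The conjugator has to send 0 to i and 1 to j. Since j′ is what (i 0) sends to j, swapping 1
  -- with j′ beforehand settles the image of 1; as j′ ≠ 0, this swap leaves 0 in place.
  j′ = applyT ⟨ i , zero ⟩ j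
  j′≢0 : ¬ j′ ≡ zero
  j′≢0 e = i≢j (applyT-injective ⟨ i , zero ⟩ (trans (applyT-fst i zero) (sym e)))
  π : Fin (suc (suc d)) → Fin (suc (suc d))
  π = applyT ⟨ i , zero ⟩ ∘ applyT ⟨ suc zero , j′ ⟩
  π-inj : Injective _≡_ _≡_ π
  π-inj e = applyT-injective ⟨ suc zero , j′ ⟩ (applyT-injective ⟨ i , zero ⟩ e)
  π0 : π zero ≡ i
  π0 = trans (cong (applyT ⟨ i , zero ⟩) (applyT-other {i = suc zero} {j′} {zero} (λ ()) (j′≢0 ∘ sym))) (applyT-snd i zero)
  π1 : π (suc zero) ≡ j
  π1 = trans (cong (applyT ⟨ i , zero ⟩) (applyT-fst (suc zero) j′)) (applyT-involutive ⟨ i , zero ⟩ j)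

inversions-id : ∀ {d} → inversions {d} id ≡ 0ℤ
inversions-id {d} = trans (∑∑-cong {d} {increasing (inverted id)} {λ _ _ → 0ℤ} (λ a b → fixed (lt a b))) (trans (∑-cong (allFin d) (λ _ → ∑-0 (allFin d))) (∑-0 (allFin d)))
  where
  fixed : ∀ x → (if x then (if x xor x then 1ℤ else 0ℤ) else 0ℤ) ≡ 0ℤ
  fixed true  = refl
  fixed false = refl

inversions-prodT : ∀ {d} (ts : List (Transp (suc (suc d)))) → All (λ t → ¬ Transp.fst t ≡ Transp.snd t) ts →
  inversions (prodT ts) ≡₂ (ℤ.+ length ts)
inversions-prodT {d} []       _        = ≡₂-reflexive (inversions-id {suc (suc d)})
inversions-prodT (⟨ i , j ⟩ ∷ ts) (h ∷ hs) = ≡₂-trans (inversions-∘ (applyT-injective ⟨ i , j ⟩) (prodT-injective ts))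
  (≡₂-+ (inversions-applyT i j h) (inversions-prodT ts hs))

∈-tuples-length : {A : Set} (r : ℕ) (xs : List A) {e : List A} → e ∈ tuples r xs → length e ≡ r
∈-tuples-length r xs e∈ with ∈-tuples⁻ r xs e∈
... | f , refl = ListP.length-tabulate f

∈-tuples-All : {A : Set} (r : ℕ) (xs : List A) {e : List A} → e ∈ tuples r xs → All (_∈ xs) e
∈-tuples-All zero    xs (here refl) = []
∈-tuples-All (suc r) xs e∈ with ∈-cartesianProductWith⁻ _∷_ xs (tuples r xs) (subst (_ ∈_) (tuples-product r xs) e∈)
... | x , e′ , x∈ , e′∈ , refl = x∈ ∷ ∈-tuples-All r xs e′∈

allTransp-≢ : ∀ {d} {t : Transp d} → t ∈ allTransp d → ¬ Transp.fst t ≡ Transp.snd t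
allTransp-≢ {d} {⟨ i , j ⟩} t∈ refl with ∈-filterᵇ⁻ (λ t → lt (Transp.fst t) (Transp.snd t)) {concatMap (λ i → map (λ j → ⟨ i , j ⟩) (allFin d)) (allFin d)} t∈
... | _ , e with () ← trans (sym (lt-irrefl i)) e

intertwiner : ∀ {d} {σ τ : Fin d → Fin d} {μ} → Injective _≡_ _≡_ σ → Injective _≡_ _≡_ τ →
  hasCycleType σ μ ≡ true → hasCycleType τ μ ≡ true → ∃ λ f → Injective _≡_ _≡_ f × τ ∘ f ≗ f ∘ σ
intertwiner {σ = σ} {τ} {μ} σ-inj τ-inj hσ hτ = extend , extend-inj _ _ , extend-comm
  where
  Cτ = cycleData τ μ τ-inj hτ
  open Centraliser.Extend σ τ σ-inj τ-inj (cycleData σ μ σ-inj hσ) Cτ (CycleData.base Cτ)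
    (λ {i} {j} e → trans (sym (CycleData.idx-base Cτ i)) (trans e (CycleData.idx-base Cτ j)))
    (λ i → cong (λ k → lookupℕ μ (toℕ k)) (CycleData.idx-base Cτ i))

-- Each transposition changes the parity, so r is the parity of the product, which is conjugate to
-- σ.
tuple-parity : ∀ {d μ} {σ : Fin (suc (suc d)) → Fin (suc (suc d))} → Injective _≡_ _≡_ σ → hasCycleType σ μ ≡ true →
  ∀ r {ts} → ts ∈ tuples r (allTransp (suc (suc d))) → hasCycleType (prodT ts) μ ≡ true → (ℤ.+ r) ≡₂ inversions σ
tuple-parity {d} {μ} {σ} σ-inj hσ r {ts} ts∈ hts with intertwiner {μ = μ} σ-inj (prodT-injective ts) hσ hts
... | f , f-inj , comm = ≡₂-trans (≡₂-trans
  (≡₂-reflexive (cong ℤ.+_ (sym (∈-tuples-length r (allTransp (suc (suc d))) ts∈))))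
  (≡₂-sym (inversions-prodT ts (All.map allTransp-≢ (∈-tuples-All r (allTransp (suc (suc d))) ts∈)))))
  (inversions-conj {f = f} σ-inj (prodT-injective ts) f-inj comm)

-- Folding exponentials, and the theorem

square-injective : ∀ {m n} → m < n → ¬ (ℤ.+ m * ℤ.+ m - ℤ.+ n * ℤ.+ n ≡ 0ℤ)
square-injective {m} {n} m<n e = ℕP.<-irrefl (ℤP.+-injective (trans (ℤP.pos-* m m) (trans (ℤP.i-j≡0⇒i≡j (ℤ.+ m * ℤ.+ m) (ℤ.+ n * ℤ.+ n) e) (sym (ℤP.pos-* n n))))) (ℕP.*-mono-< m<n m<n)

^-+2 : ∀ x r k → x ^ℤ (r ℕ.+ 2 ℕ.* suc k) ≡ x * x * x ^ℤ (r ℕ.+ 2 ℕ.* k)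
^-+2 x r k = trans (cong (x ^ℤ_) (exponent r k)) (sym (ℤP.*-assoc x x (x ^ℤ (r ℕ.+ 2 ℕ.* k))))
  where exponent : ∀ r k → r ℕ.+ 2 ℕ.* suc k ≡ suc (suc (r ℕ.+ 2 ℕ.* k))
        exponent = ℕ-Ring.solve-∀

∑-upTo-suc : ∀ n (f : ℕ → ℤ) → ∑ (upTo (suc n)) f ≡ ∑ (upTo n) f + f n
∑-upTo-suc n f = trans (cong (λ l → ∑ l f) (sym (ListP.upTo-∷ʳ n))) (trans (∑-++ (upTo n) (n ∷ []) f)
  (cong (∑ (upTo n) f +_) (ℤP.+-identityʳ (f n))))

^-nonzero : ∀ n r → ¬ ((ℤ.+ suc n) ^ℤ r ≡ 0ℤ)
^-nonzero n (suc r) e with ℤP.i*j≡0⇒i≡0∨j≡0 (ℤ.+ suc n) e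
... | inj₂ e′ = ^-nonzero n r e′

-- Vandermonde elimination: the relation at k + 1 minus the square of the largest base times the
-- relation at k removes that base and multiplies each other coefficient by a difference of squares.
-- These differences are nonzero because the bases are distinct and positive.
exponentials-independent : ∀ M (e : ℕ → ℤ) s →
  (∀ k → ∑ (upTo M) (λ j → e j * (ℤ.+ suc j) ^ℤ (s ℕ.+ 2 ℕ.* k)) ≡ 0ℤ) → ∀ {j} → j < M → e j ≡ 0ℤ
exponentials-independent (suc M) e s h {j} j<1+M = go (ℕP.m≤n⇒m<n∨m≡n (ℕ.s≤s⁻¹ j<1+M))
  where
  x : ℕ → ℤ
  x j = ℤ.+ suc j
  p : ℕ → ℕ → ℤ
  p k j = x j ^ℤ (s ℕ.+ 2 ℕ.* k)
  reduced : ∀ k → ∑ (upTo M) (λ j → e j * (x j * x j - x M * x M) * p k j) ≡ 0ℤ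
  reduced k = begin
    ∑ (upTo M) (λ j → e j * (x j * x j - x M * x M) * p k j)
      ≡⟨ ∑-cong (upTo M) (λ j → trans (lemma₁ (e j) (x j) (x M) (p k j)) (cong (λ z → e j * z + -xM² * (e j * p k j)) (sym (^-+2 (x j) s k)))) ⟩
    ∑ (upTo M) (λ j → e j * p (suc k) j + -xM² * (e j * p k j))
      ≡⟨ trans (∑-+ (upTo M) (λ j → e j * p (suc k) j) _) (cong (∑ (upTo M) (λ j → e j * p (suc k) j) +_) (∑-*ˡ (upTo M) -xM² _)) ⟩
    A₁ + -xM² * A₀
      ≡⟨ lemma₂ A₁ A₀ (e M * p k M) (x M) ⟩
    (A₁ + x M * x M * (e M * p k M)) + -xM² * (A₀ + e M * p k M)
      ≡⟨ cong₂ (λ a b → a + -xM² * b) (trans (cong (A₁ +_) (trans (lemma₃ (x M) (e M) (p k M)) (cong (e M *_) (sym (^-+2 (x M) s k)))))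
           (trans (sym (∑-upTo-suc M (λ j → e j * p (suc k) j))) (h (suc k))))
           (trans (sym (∑-upTo-suc M (λ j → e j * p k j))) (h k)) ⟩
    0ℤ + -xM² * 0ℤ
      ≡⟨ trans (ℤP.+-identityˡ _) (ℤP.*-zeroʳ -xM²) ⟩
    0ℤ ∎
    where
    open ≡-Reasoning
    -xM² = - (x M * x M)
    A₀ = ∑ (upTo M) (λ j → e j * p k j)
    A₁ = ∑ (upTo M) (λ j → e j * p (suc k) j)
    lemma₁ : ∀ e x y p → e * (x * x - y * y) * p ≡ e * (x * x * p) + (- (y * y)) * (e * p)
    lemma₁ = solve-∀
    lemma₂ : ∀ a₁ a₀ t y → a₁ + (- (y * y)) * a₀ ≡ (a₁ + y * y * t) + (- (y * y)) * (a₀ + t)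
    lemma₂ = solve-∀
    lemma₃ : ∀ y e p → y * y * (e * p) ≡ e * (y * y * p)
    lemma₃ = solve-∀
  lower : ∀ {j} → j < M → e j ≡ 0ℤ
  lower {j} j<M with ℤP.i*j≡0⇒i≡0∨j≡0 (e j) (exponentials-independent M (λ j → e j * (x j * x j - x M * x M)) s reduced j<M)
  ... | inj₁ e≡0 = e≡0
  ... | inj₂ bad = ⊥-elim (square-injective (s≤s j<M) bad)
  ∑-upTo-0 : ∑ (upTo M) (λ j → e j * p 0 j) ≡ 0ℤ
  ∑-upTo-0 = trans (∑-cong-∈ (upTo M) (λ {j} j∈ → trans (cong (_* p 0 j) (lower (∈-upTo⁻ j∈))) (ℤP.*-zeroˡ (p 0 j)))) (∑-0 (upTo M))
  go : j < M ⊎ j ≡ M → e j ≡ 0ℤ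
  go (inj₁ j<M)  = lower j<M
  go (inj₂ refl) with ℤP.i*j≡0⇒i≡0∨j≡0 (e M) (trans (sym (ℤP.+-identityˡ (e M * p 0 M))) (trans (cong (_+ e M * p 0 M) (sym ∑-upTo-0))
                        (trans (sym (∑-upTo-suc M (λ j → e j * p 0 j))) (h 0))))
  ... | inj₁ e≡0 = e≡0
  ... | inj₂ bad = ⊥-elim (^-nonzero M (s ℕ.+ 2 ℕ.* 0) bad)

sign : ℕ → ℤ
sign r = -1ℤ ^ℤ r

sign-+2 : ∀ r k → sign (r ℕ.+ 2 ℕ.* k) ≡ sign r
sign-+2 r zero    = cong sign (ℕP.+-identityʳ r)
sign-+2 r (suc k) = trans (^-+2 -1ℤ r k) (trans (ℤP.*-identityˡ _) (sign-+2 r k))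

neg-^ : ∀ j r → (ℤ.-[1+ j ]) ^ℤ r ≡ sign r * (ℤ.+ suc j) ^ℤ r
neg-^ j zero    = refl
neg-^ j (suc r) = trans (cong₂ _*_ (sym (ℤP.-1*i≡-i (ℤ.+ suc j))) (neg-^ j r)) (lemma (ℤ.+ suc j) (sign r) ((ℤ.+ suc j) ^ℤ r))
  where lemma : ∀ x s p → -1ℤ * x * (s * p) ≡ -1ℤ * s * (x * p)
        lemma = solve-∀

∑-pick-upTo : ∀ M j (F : ℕ → ℤ) → j < M → ∑ (upTo M) (λ k → if j ℕ.≡ᵇ k then F k else 0ℤ) ≡ F j
∑-pick-upTo (suc M) j F j<1+M = trans
  (cong (G 0 +_) (trans (cong (λ l → ∑ l G) (sym (ListP.map-upTo suc M))) (∑-map suc (upTo M) G))) (go j j<1+M)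
  where
  G : ℕ → ℤ
  G k = if j ℕ.≡ᵇ k then F k else 0ℤ
  go : ∀ j → j < suc M → (if j ℕ.≡ᵇ 0 then F 0 else 0ℤ) + ∑ (upTo M) (λ k → if j ℕ.≡ᵇ suc k then F (suc k) else 0ℤ) ≡ F j
  go zero    _         = trans (cong (F 0 +_) (∑-0 (upTo M))) (ℤP.+-identityʳ (F 0))
  go (suc j) (s≤s j<M) = trans (ℤP.+-identityˡ _) (∑-pick-upTo M j (F ∘ suc) j<M)

-- The coefficients of mʳ and (−m)ʳ, for m = k + 1, contributed by a term c * rootʳ.
plusCoeff minusCoeff : ℤ × ℤ → ℕ → ℤ
plusCoeff (c , ℤ.+ zero)     k = 0ℤ
plusCoeff (c , ℤ.+ (suc j))  k = if j ℕ.≡ᵇ k then c else 0ℤ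
plusCoeff (c , ℤ.-[1+ j ])   k = 0ℤ
minusCoeff (c , ℤ.+ m)       k = 0ℤ
minusCoeff (c , ℤ.-[1+ j ])  k = if j ℕ.≡ᵇ k then c else 0ℤ

if-* : ∀ b (c x : ℤ) → (if b then c else 0ℤ) * x ≡ (if b then c * x else 0ℤ)
if-* true  c x = refl
if-* false c x = ℤP.*-zeroˡ x

-- The exponent is a successor, so a root 0 contributes nothing; the bound on the root places its
-- absolute value among 1, ..., M.
term-fold : ∀ M r cm → ∣ proj₂ cm ∣ ≤ M → proj₁ cm * proj₂ cm ^ℤ suc r ≡
  ∑ (upTo M) (λ k → (plusCoeff cm k + sign (suc r) * minusCoeff cm k) * (ℤ.+ suc k) ^ℤ suc r)
term-fold M r (c , ℤ.+ zero) _ = trans (trans (cong (c *_) (ℤP.*-zeroˡ (0ℤ ^ℤ r))) (ℤP.*-zeroʳ c)) (sym (trans (∑-cong (upTo M) (λ k →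
    trans (cong (λ z → (0ℤ + z) * (ℤ.+ suc k) ^ℤ suc r) (ℤP.*-zeroʳ (sign (suc r)))) (ℤP.*-zeroˡ ((ℤ.+ suc k) ^ℤ suc r)))) (∑-0 (upTo M))))
term-fold M r (c , ℤ.+ (suc j)) h = sym (trans (∑-cong (upTo M) (λ k →
    trans (cong (_* (ℤ.+ suc k) ^ℤ suc r) (trans (cong ((if j ℕ.≡ᵇ k then c else 0ℤ) +_) (ℤP.*-zeroʳ (sign (suc r)))) (ℤP.+-identityʳ (if j ℕ.≡ᵇ k then c else 0ℤ))))
      (if-* (j ℕ.≡ᵇ k) c _)))
  (∑-pick-upTo M j (λ k → c * (ℤ.+ suc k) ^ℤ suc r) h))
term-fold M r (c , ℤ.-[1+ j ]) h = sym (trans (∑-cong (upTo M) (λ k →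
    trans (lemma (sign (suc r)) (if j ℕ.≡ᵇ k then c else 0ℤ) ((ℤ.+ suc k) ^ℤ suc r)) (if-* (j ℕ.≡ᵇ k) c _)))
  (trans (∑-pick-upTo M j (λ k → c * (sign (suc r) * (ℤ.+ suc k) ^ℤ suc r)) h) (cong (c *_) (sym (neg-^ j (suc r))))))
  where lemma : ∀ s c x → (0ℤ + s * c) * x ≡ c * (s * x)
        lemma = solve-∀

sumFrom1≡∑ : ∀ M f → sumFrom1 M f ≡ ∑ (upTo M) (f ∘ suc)
sumFrom1≡∑ M f = go (upTo M)
  where go : ∀ xs → Data.List.foldr _+_ 0ℤ (map (f ∘ suc) xs) ≡ ∑ xs (f ∘ suc)
        go []       = refl
        go (x ∷ xs) = cong (f (suc x) +_) (go xs)

-- Vanishing on one parity class forces C(−m) = ± C(m), which is where the factor 2 comes from.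
fold-exponential : ∀ {M b} → Exponential M b → ∀ r → (∀ k → b (suc (suc r) ℕ.+ 2 ℕ.* k) ≡ 0ℤ) →
  ∃ λ (c : ℕ → ℤ) → ∀ g → b (suc r ℕ.+ 2 ℕ.* g) ≡
    ℤ.+ 2 * sumFrom1 M (λ m → c m * (ℤ.+ m) ^ℤ (suc r ℕ.+ 2 ℕ.* g))
fold-exponential {M} {b} (cs , bounded , b≡) r vanishes = (λ m → plus (ℕ.pred m)) , main
  where
  plus minus : ℕ → ℤ
  plus k  = ∑ cs (λ cm → plusCoeff cm k)
  minus k = ∑ cs (λ cm → minusCoeff cm k)
  folded : ∀ r → b (suc r) ≡ ∑ (upTo M) (λ k → (plus k + sign (suc r) * minus k) * (ℤ.+ suc k) ^ℤ suc r)
  folded r = trans (b≡ (suc r)) (trans (∑-cong-∈ cs (λ {cm} cm∈ → term-fold M r cm (All.lookup bounded cm∈)))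
    (trans (∑-swap cs (upTo M) _) (∑-cong (upTo M) (λ k → trans (∑-*ʳ cs ((ℤ.+ suc k) ^ℤ suc r) _)
      (cong (_* (ℤ.+ suc k) ^ℤ suc r) (trans (∑-+ cs (λ cm → plusCoeff cm k) _)
        (cong (plus k +_) (∑-*ˡ cs (sign (suc r)) (λ cm → minusCoeff cm k)))))))))
  balanced : ∀ {k} → k < M → plus k + sign (suc (suc r)) * minus k ≡ 0ℤ
  balanced = exponentials-independent M (λ k → plus k + sign (suc (suc r)) * minus k) (suc (suc r)) (λ k →
    trans (∑-cong (upTo M) (λ j → cong (λ s → (plus j + s * minus j) * (ℤ.+ suc j) ^ℤ (suc (suc r) ℕ.+ 2 ℕ.* k)) (sym (sign-+2 (suc (suc r)) k))))
      (trans (sym (folded (suc r ℕ.+ 2 ℕ.* k))) (vanishes k)))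
  main : ∀ g → b (suc r ℕ.+ 2 ℕ.* g) ≡ ℤ.+ 2 * sumFrom1 M (λ m → plus (ℕ.pred m) * (ℤ.+ m) ^ℤ (suc r ℕ.+ 2 ℕ.* g))
  main g = begin
    b (suc r ℕ.+ 2 ℕ.* g)
      ≡⟨ folded (r ℕ.+ 2 ℕ.* g) ⟩
    ∑ (upTo M) (λ k → (plus k + sign (suc r ℕ.+ 2 ℕ.* g) * minus k) * x k)
      ≡⟨ ∑-cong-∈ (upTo M) (λ {k} k∈ → trans (cong (λ s → (plus k + s * minus k) * x k) (sign-+2 (suc r) g))
           (trans (lemma (plus k) (sign (suc r)) (minus k) (x k))
             (trans (cong (λ z → ℤ.+ 2 * (plus k * x k) - z * x k) (balanced (∈-upTo⁻ k∈)))
               (lemma₀ (ℤ.+ 2 * (plus k * x k)) (x k))))) ⟩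
    ∑ (upTo M) (λ k → ℤ.+ 2 * (plus k * x k))
      ≡⟨ trans (∑-*ˡ (upTo M) (ℤ.+ 2) _) (cong (ℤ.+ 2 *_) (sym (sumFrom1≡∑ M (λ m → plus (ℕ.pred m) * (ℤ.+ m) ^ℤ (suc r ℕ.+ 2 ℕ.* g))))) ⟩
    ℤ.+ 2 * sumFrom1 M (λ m → plus (ℕ.pred m) * (ℤ.+ m) ^ℤ (suc r ℕ.+ 2 ℕ.* g)) ∎
    where
    open ≡-Reasoning
    x : ℕ → ℤ
    x k = (ℤ.+ suc k) ^ℤ (suc r ℕ.+ 2 ℕ.* g)
    lemma : ∀ p s m x → (p + s * m) * x ≡ ℤ.+ 2 * (p * x) - (p + -1ℤ * s * m) * x
    lemma = solve-∀
    lemma₀ : ∀ y x → y - 0ℤ * x ≡ y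
    lemma₀ = solve-∀

neg-≡₂ : ∀ x → (- x) ≡₂ x
neg-≡₂ x = mod₂ (- x) (lemma x)
  where lemma : ∀ x → - x ≡ x + ℤ.+ 2 * (- x)
        lemma = solve-∀

parity : ∀ x → x ≡₂ 0ℤ ⊎ x ≡₂ 1ℤ
parity (ℤ.+ n) = nat n
  where
  nat : ∀ n → (ℤ.+ n) ≡₂ 0ℤ ⊎ (ℤ.+ n) ≡₂ 1ℤ
  nat zero          = inj₁ (≡₂-reflexive refl)
  nat (suc zero)    = inj₂ (≡₂-reflexive refl)
  nat (suc (suc n)) with nat n
  ... | inj₁ h = inj₁ (≡₂-trans (mod₂ 1ℤ (ℤP.+-comm (ℤ.+ 2) (ℤ.+ n))) h)
  ... | inj₂ h = inj₂ (≡₂-trans (mod₂ 1ℤ (ℤP.+-comm (ℤ.+ 2) (ℤ.+ n))) h)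
parity ℤ.-[1+ n ] with parity (ℤ.+ suc n)
... | inj₁ h = inj₁ (≡₂-trans (neg-≡₂ (ℤ.+ suc n)) h)
... | inj₂ h = inj₂ (≡₂-trans (neg-≡₂ (ℤ.+ suc n)) h)

1≢₂0 : ¬ 1ℤ ≡₂ 0ℤ
1≢₂0 (mod₂ q e) = odd ∣ q ∣ (trans (cong ∣_∣ (trans e (ℤP.+-identityˡ (ℤ.+ 2 * q)))) (ℤP.abs-* (ℤ.+ 2) q))
  where odd : ∀ k → ¬ 1 ≡ 2 ℕ.* k
        odd (suc k) h with () ← trans (ℕP.suc-injective h) (ℕP.+-suc k (k ℕ.+ 0))

≡₂-dec : ∀ x y → x ≡₂ y ⊎ ¬ x ≡₂ y
≡₂-dec x y with parity x | parity y
... | inj₁ hx | inj₁ hy = inj₁ (≡₂-trans hx (≡₂-sym hy))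
... | inj₂ hx | inj₂ hy = inj₁ (≡₂-trans hx (≡₂-sym hy))
... | inj₁ hx | inj₂ hy = inj₂ (λ h → 1≢₂0 (≡₂-trans (≡₂-sym hy) (≡₂-trans (≡₂-sym h) hx)))
... | inj₂ hx | inj₁ hy = inj₂ (λ h → 1≢₂0 (≡₂-trans (≡₂-sym hx) (≡₂-trans h hy)))

+2*-≡₂ : ∀ r k → (ℤ.+ (r ℕ.+ 2 ℕ.* k)) ≡₂ (ℤ.+ r)
+2*-≡₂ r k = mod₂ (ℤ.+ k) (cong (ℤ.+ r +_) (ℤP.pos-* 2 k))

countᵇ-none : {A : Set} (p : A → Bool) (xs : List A) → (∀ {x} → x ∈ xs → ¬ p x ≡ true) → countᵇ p xs ≡ 0
countᵇ-none p []       h = refl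
countᵇ-none p (x ∷ xs) h with p x in eq
... | true  = ⊥-elim (h (here refl) eq)
... | false = countᵇ-none p xs (h ∘ there)

module _ (d : ℕ) (μ : List ℕ) where

  contributes : List (Transp d) → Bool
  contributes ts = isTransitive ts ∧ hasCycleType (prodT ts) μ

  coverCount : ℕ → ℕ
  coverCount r = countᵇ contributes (tuples r (allTransp d))

  coverCount-zero : ∀ r → (∀ {ts} → ts ∈ tuples r (allTransp d) → ¬ hasCycleType (prodT ts) μ ≡ true) → coverCount r ≡ 0
  coverCount-zero r h = countᵇ-none contributes (tuples r (allTransp d)) (λ {ts} ts∈ e → h ts∈ (proj₂ (∧-elim {isTransitive ts} e)))

  -- The theorem with its denominators cleared, for exponents running through r, r + 2, r + 4, and
  -- so on; one function c has to serve all g.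
  Folded : ℕ → Set
  Folded r = ∃ λ (c : ℕ → ℤ) → ∀ g → ℤ.+ (autSize μ ℕ.* product μ) * ℤ.+ coverCount (r ℕ.+ 2 ℕ.* g) ≡
    ℤ.+ 2 * sumFrom1 (d C 2) (λ m → c m * (ℤ.+ m) ^ℤ (r ℕ.+ 2 ℕ.* g))

  folded-zero : ∀ r → (∀ g → coverCount (r ℕ.+ 2 ℕ.* g) ≡ 0) → Folded r
  folded-zero r h = (λ _ → 0ℤ) , λ g → trans (cong (λ n → ℤ.+ (autSize μ ℕ.* product μ) * ℤ.+ n) (h g))
    (trans (ℤP.*-zeroʳ (ℤ.+ (autSize μ ℕ.* product μ))) (sym (trans (cong (ℤ.+ 2 *_) (trans (sumFrom1≡∑ (d C 2) (λ m → 0ℤ * (ℤ.+ m) ^ℤ (r ℕ.+ 2 ℕ.* g)))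
      (trans (∑-cong (upTo (d C 2)) (λ k → ℤP.*-zeroˡ ((ℤ.+ suc k) ^ℤ (r ℕ.+ 2 ℕ.* g)))) (∑-0 (upTo (d C 2)))))) refl)))

  module _ (σ : Fin d → Fin d) (σ-inj : Injective _≡_ _≡_ σ) (hσ : hasCycleType σ μ ≡ true) where
    private ς = Orbits.inverse σ σ-inj

    coverCount-exponential : Exponential (d C 2) (λ r → ℤ.+ (autSize μ ℕ.* product μ) * ℤ.+ coverCount r)
    coverCount-exponential = exponential-cong
      (λ r → trans (∑-cong (tuples r (allTransp d)) pointwise)
        (trans (∑-*ˡ (tuples r (allTransp d)) z _) (cong (z *_) (sym (countᵇ≡∑ contributes (tuples r (allTransp d)))))))
      (transitive-exponential d ς)
      where
      z = ℤ.+ (autSize μ ℕ.* product μ)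
      scale : ∀ a b → (if a then (if b then z else 0ℤ) else 0ℤ) ≡ z * (if a ∧ b then 1ℤ else 0ℤ)
      scale true  true  = sym (ℤP.*-identityʳ z)
      scale true  false = sym (ℤP.*-zeroʳ z)
      scale false b     = sym (ℤP.*-zeroʳ z)
      pointwise : ∀ ts → (if isTransitive ts then TraceFormula.weight d ς ts else 0ℤ) ≡ z * (if contributes ts then 1ℤ else 0ℤ)
      pointwise ts = trans (cong (λ w → if isTransitive ts then w else 0ℤ) (weight-value σ σ-inj {μ} hσ ts))
        (scale (isTransitive ts) (hasCycleType (prodT ts) μ))

-- Deciding existence takes the place of constructing a permutation of type μ: if there is none, no
-- product of transpositions has this type and all counts vanish.
permutationOfType? : ∀ d μ → Dec (∃ λ f → (∀ x y → Action.decode d f x ≡ Action.decode d f y → x ≡ y) × hasCycleType (Action.decode d f) μ ≡ true)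
permutationOfType? d μ = FP.any? (λ f → injective? (Action.decode d f) ×-dec (hasCycleType (Action.decode d f) μ 𝔹.≟ true))

-- All exponents r + 2g have the same parity. If it differs from that of σ, every count is zero and
-- c = 0 serves; if it agrees, the exponents r + 1 + 2k give zero, which is the vanishing needed for
-- folding.
coverCount-folded : ∀ d μ r → 2 ≤ d → 1 ≤ r → Folded d μ r
coverCount-folded (suc (suc d)) μ (suc r) (s≤s (s≤s z≤n)) (s≤s z≤n) with permutationOfType? (suc (suc d)) μ
... | no none = folded-zero D μ (suc r) (λ g → coverCount-zero D μ (suc r ℕ.+ 2 ℕ.* g) (λ {ts} _ h → none (encode (prodT ts) ,
        (λ x y e → prodT-injective ts (trans (sym (dec ts x)) (trans e (dec ts y)))) ,
        hasCycleType-intertwine {μ = μ} (prodT-injective ts)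
          (λ {x} {y} e → prodT-injective ts (trans (sym (dec ts x)) (trans e (dec ts y)))) id id (dec ts) h)))
  where
  D = suc (suc d)
  open Action D using (encode; decode)
  dec : ∀ ts → decode (encode (prodT ts)) ≗ prodT ts
  dec ts = FP.finToFun-funToFin {D} {D} (prodT ts)
... | yes (f , inj , hσ) = byParity (≡₂-dec (ℤ.+ suc r) (inversions σ))
  where
  D = suc (suc d)
  σ = Action.decode D f
  zero-unless : ∀ r → ¬ (ℤ.+ r) ≡₂ inversions σ → coverCount D μ r ≡ 0
  zero-unless r h = coverCount-zero D μ r (λ ts∈ hts → h (tuple-parity {μ = μ} {σ = σ} (inj _ _) hσ r ts∈ hts))
  byParity : (ℤ.+ suc r) ≡₂ inversions σ ⊎ ¬ (ℤ.+ suc r) ≡₂ inversions σ → Folded D μ (suc r)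
  byParity (inj₂ h) = folded-zero D μ (suc r) (λ g → zero-unless (suc r ℕ.+ 2 ℕ.* g) (λ e → h (≡₂-trans (≡₂-sym (+2*-≡₂ (suc r) g)) e)))
  byParity (inj₁ h) = fold-exponential (coverCount-exponential D μ σ (inj _ _) hσ) r (λ k →
    trans (cong (λ n → ℤ.+ (autSize μ ℕ.* product μ) * ℤ.+ n) (zero-unless (suc (suc r) ℕ.+ 2 ℕ.* k)
      (λ e → 1≢₂0 (≡₂-cancelʳ (ℤ.+ suc r) (≡₂-trans (≡₂-sym (+2*-≡₂ (suc (suc r)) k)) (≡₂-trans e (≡₂-sym h)))))))
      (ℤP.*-zeroʳ (ℤ.+ (autSize μ ℕ.* product μ))))

÷ℕ-cong : ∀ a b k l → .{{_ : ℕ.NonZero k}} → .{{_ : ℕ.NonZero l}} → a * ℤ.+ l ≡ b * ℤ.+ k → a ÷ℕ k ≡ b ÷ℕ l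
÷ℕ-cong a b (suc k) (suc l) e = ℚP.fromℚᵘ-cong {ℚᵘ.mkℚᵘ a k} {ℚᵘ.mkℚᵘ b l} (ℚᵘ.*≡* e)

theorem1p5 : (μ : List ℕ) → All (0 <_) μ → 2 ≤ sum μ →
    Σ (ℕ → ℤ) (λ c → (g : ℕ) →
    H g μ ≡ (ℤ.+ 2 ℤ.* sumFrom1 (sum μ C 2) (λ m → c m ℤ.* (ℤ.+ m) ℤ.^ numBranch g μ))
    ÷ℕ (sum μ ! ℕ.* product μ))
theorem1p5 []        _   ()
theorem1p5 μ@(_ ∷ ν) pos 2≤d = proj₁ folded , identity
  where
  d n r₀ : ℕ
  d = sum μ
  n = length ν
  r₀ = d ℕ.+ suc n ℕ.∸ 2
  branch : ∀ g → numBranch g μ ≡ r₀ ℕ.+ 2 ℕ.* g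
  branch g = begin
    d ℕ.+ 2 ℕ.* g ℕ.+ suc n ℕ.∸ 2   ≡⟨ cong (ℕ._∸ 2) (swap d (2 ℕ.* g) (suc n)) ⟩
    2 ℕ.* g ℕ.+ (d ℕ.+ suc n) ℕ.∸ 2 ≡⟨ ℕP.+-∸-assoc (2 ℕ.* g) {d ℕ.+ suc n} {2} (ℕP.≤-trans 2≤d (ℕP.m≤m+n d (suc n))) ⟩
    2 ℕ.* g ℕ.+ r₀                  ≡⟨ ℕP.+-comm (2 ℕ.* g) r₀ ⟩
    r₀ ℕ.+ 2 ℕ.* g                  ∎
    where open ≡-Reasoning
          swap : ∀ a b c → a ℕ.+ b ℕ.+ c ≡ b ℕ.+ (a ℕ.+ c)
          swap = ℕ-Ring.solve-∀
  -- From d ≥ 2 and n ≥ 1. It makes every exponent a successor, as the removal of the base 0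
  -- requires.
  1≤r₀ : 1 ≤ r₀
  1≤r₀ = ℕP.m<n⇒0<n∸m (ℕP.≤-trans (s≤s 2≤d) (subst (suc d ≤_) (sym (ℕP.+-suc d n)) (s≤s (ℕP.m≤m+n d n))))
  folded : Folded d μ r₀
  folded = coverCount-folded d μ r₀ 2≤d 1≤r₀
  c = proj₁ folded
  identity : ∀ g → H g μ ≡ (ℤ.+ 2 * sumFrom1 (d C 2) (λ m → c m * (ℤ.+ m) ^ℤ numBranch g μ)) ÷ℕ (d ! ℕ.* product μ)
  -- Both denominators are nonzero, so `÷ℕ` never takes its dummy value and the equation can be
  -- cross-multiplied.
  identity g rewrite branch g = ÷ℕ-cong _ _ (d !) (d ! ℕ.* product μ) {{d!≢0}} {{ℕP.m*n≢0 (d !) (product μ) {{d!≢0}} {{product≢0 (All.map ℕ.>-nonZero pos)}}}} (begin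
    ℤ.+ (A ℕ.* N) * ℤ.+ (d ! ℕ.* product μ)         ≡⟨ cong₂ _*_ (ℤP.pos-* A N) (ℤP.pos-* (d !) (product μ)) ⟩
    ℤ.+ A * ℤ.+ N * (ℤ.+ (d !) * ℤ.+ product μ)     ≡⟨ lemma (ℤ.+ A) (ℤ.+ N) (ℤ.+ (d !)) (ℤ.+ product μ) ⟩
    ℤ.+ A * ℤ.+ product μ * ℤ.+ N * ℤ.+ (d !)       ≡⟨ cong (λ z → z * ℤ.+ N * ℤ.+ (d !)) (sym (ℤP.pos-* A (product μ))) ⟩
    ℤ.+ (A ℕ.* product μ) * ℤ.+ N * ℤ.+ (d !)       ≡⟨ cong (_* ℤ.+ (d !)) (proj₂ folded g) ⟩
    ℤ.+ 2 * sumFrom1 (d C 2) (λ m → c m * (ℤ.+ m) ^ℤ (r₀ ℕ.+ 2 ℕ.* g)) * ℤ.+ (d !) ∎)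
    where
    open ≡-Reasoning
    A = autSize μ
    N = coverCount d μ (r₀ ℕ.+ 2 ℕ.* g)
    d!≢0 : ℕ.NonZero (d !)
    d!≢0 = ℕP._!≢0 d
    lemma : ∀ a n f p → a * n * (f * p) ≡ a * p * n * f
    lemma = solve-∀
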